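{- For every $r\ge 1$, every $\mathfrak{s}=(s_1,\ldots,s_r)\in\mathbb{N}^r$ and every $\boldsymbol{\epsilon}=(\epsilon_1,\ldots,\epsilon_r)\in(\mathbb{F}_q^{\times})^r$, the alternating multizeta value $\zeta_A(\mathfrak{s};\boldsymbol{\epsilon})$ is nonzero.
   Context: Let $q$ be a power of a prime $p$, $\mathbb{F}_q$ the field with $q$ elements, $A=\mathbb{F}_q[\theta]$, $A_+$ the set of monic polynomials in $A$, $k=\mathbb{F}_q(\theta)$, $k_\infty=\mathbb{F}_q((1/\theta))$, and $\mathbb{N}=\{1,2,3,\ldots\}$. For $\mathfrak{s}=(s_1,\ldots,s_r)\in\mathbb{N}^r$ and $\boldsymbol{\epsilon}=(\epsilon_1,\ldots,\epsilon_r)\in(\mathbb{F}_q^\times)^r$ the alternating multizeta value is $$\zeta_A(\mathfrak{s};\boldsymbol{\epsilon})=\sum_{\substack{a_1,\ldots,a_r\in A_+\\ \deg a_1>\cdots>\deg a_r\ge 0}}\frac{\epsilon_1^{\deg a_1}\cdots\epsilon_r^{\deg a_r}}{a_1^{s_1}\cdots a_r^{s_r}}\in k_\infty .$$ -}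

module Defs where

open import Level using (Level; _⊔_)
open import Algebra.Bundles using (CommutativeRing)
open import Data.Nat as ℕ using (ℕ; zero; suc; _<ᵇ_; _∸_)
open import Data.Bool using (if_then_else_)
open import Data.List as List using (List; []; _∷_)
open import Data.List.Relation.Unary.Any using (Any)
open import Data.List.Relation.Unary.AllPairs using (AllPairs)
open import Data.Vec as Vec using (Vec; []; _∷_)
open import Data.Product using (Σ; _×_; _,_)
open import Relation.Nullary using (¬_)

-- A finite field 𝔽_q: a commutative ring with 1 ≠ 0 in which every
-- nonzero element is invertible, together with a duplicate-free
-- exhaustive enumeration of its elements (so q = length elems).
-- (Every finite field has prime-power order q = p^m, and every
-- prime power occurs, so quantifying over these records is the same
-- as quantifying over q and 𝔽_q.)

record FiniteField (c ℓ : Level) : Set (Level.suc (c ⊔ ℓ)) where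
  field
    cring    : CommutativeRing c ℓ
  open CommutativeRing cring public
  field
    1≉0      : ¬ (1# ≈ 0#)
    inverse  : ∀ x → ¬ (x ≈ 0#) → Σ Carrier λ y → (x * y) ≈ 1#
    elems    : List Carrier
    complete : ∀ x → Any (x ≈_) elems
    distinct : AllPairs (λ a b → ¬ (a ≈ b)) elems

-- Elements of k_∞ = 𝔽_q((1/θ)) that lie in 𝔽_q[[x]], x = 1/θ, are given
-- by their coefficient sequences n ↦ (coefficient of θ^{-n}).

module _ {c ℓ : Level} (F : FiniteField c ℓ) where
  open FiniteField F

  PS : Set c
  PS = ℕ → Carrier

  sumBelow : ℕ → (ℕ → Carrier) → Carrier
  sumBelow zero    f = 0#
  sumBelow (suc n) f = sumBelow n f + f n

  sumList : {A : Set c} → List A → (A → Carrier) → Carrier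
  sumList []       f = 0#
  sumList (a ∷ as) f = f a + sumList as f

  one : PS
  one zero    = 1#
  one (suc n) = 0#

  _·_ : PS → PS → PS
  (f · g) n = sumBelow (suc n) (λ i → f i * g (n ∸ i))

  _^ˢ_ : PS → ℕ → PS
  f ^ˢ zero  = one
  f ^ˢ suc s = f · (f ^ˢ s)

  shift : ℕ → PS → PS
  shift k f n = if n <ᵇ k then 0# else f (n ∸ k)

  _^ᶠ_ : Carrier → ℕ → Carrier
  e ^ᶠ zero  = 1#
  e ^ᶠ suc n = e * (e ^ᶠ n)

  -- A monic polynomial of degree d, a = θ^d + c_{d-1}θ^{d-1} + … + c_0,
  -- is represented by its lower coefficient vector (c_0, …, c_{d-1}).
  -- Then a = θ^d · u_a(1/θ) with u_a(x) = 1 + c_{d-1}x + … + c_0 x^d.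
  uCoeff : {d : ℕ} → Vec Carrier d → ℕ → Carrier
  uCoeff {d} cs zero    = 1#
  uCoeff {d} cs (suc i) = go (Vec.reverse cs) i
    where
    go : {m : ℕ} → Vec Carrier m → ℕ → Carrier
    go []       _       = 0#
    go (x ∷ xs) zero    = x
    go (x ∷ xs) (suc j) = go xs j

  -- Inverse of a power series u with u 0 = 1:
  -- b 0 = 1,  b n = - Σ_{i=1}^{n} u i · b (n - i).
  -- invUpto n = (b n , b (n-1) , … , b 0).
  invUpto : PS → ℕ → List Carrier
  invUpto u zero    = 1# ∷ []
  invUpto u (suc n) = (- conv 1 prev) ∷ prev
    where
    prev : List Carrier
    prev = invUpto u n
    conv : ℕ → List Carrier → Carrier
    conv i []       = 0#
    conv i (b ∷ bs) = u i * b + conv (suc i) bs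

  inv : PS → PS
  inv u n = hd (invUpto u n)
    where
    hd : List Carrier → Carrier
    hd []      = 0#
    hd (b ∷ _) = b

  -- 1 / a^s  =  x^{d s} · (u_a^{-1})^s   as an element of 𝔽_q[[x]]
  recipPow : {d : ℕ} → Vec Carrier d → ℕ → PS
  recipPow {d} cs s = shift (d ℕ.* s) (inv (uCoeff cs) ^ˢ s)

  monics : (d : ℕ) → List (Vec Carrier d)
  monics zero    = [] ∷ []
  monics (suc d) = List.concatMap (λ x → List.map (x ∷_) (monics d)) elems

  powerSum : ℕ → ℕ → PS
  powerSum d s n = sumList (monics d) (λ cs → recipPow cs s n)

  -- Z s ε b = Σ_{b > d_1 > … > d_r ≥ 0} Σ_{a_i monic, deg a_i = d_i}
  --              ε_1^{d_1}⋯ε_r^{d_r} / (a_1^{s_1}⋯a_r^{s_r})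
  Z : {r : ℕ} → Vec ℕ r → Vec Carrier r → ℕ → PS
  Z []       []       b = one
  Z (s ∷ ss) (e ∷ es) b n =
    sumBelow b (λ d → e ^ᶠ d * ((powerSum d s · Z ss es d) n))

  -- coefficient of θ^{-n} in ζ_A(𝔰; ε): only tuples with deg a_1 ≤ n
  -- can contribute to it, since 1/a_1^{s_1} ∈ θ^{-deg a_1} 𝔽_q[[1/θ]].
  zetaCoeff : {r : ℕ} → Vec ℕ r → Vec Carrier r → ℕ → Carrier
  zetaCoeff ss es n = Z ss es (suc n) n

  ZetaNonzero : {r : ℕ} → Vec ℕ r → Vec Carrier r → Set ℓ
  ZetaNonzero ss es = Σ ℕ λ n → ¬ (zetaCoeff ss es n ≈ 0#)

{-# OPTIONS --safe #-}

-- Let S_d(s) be the sum of 1/a^s over the monic a of degree d. Writing a = θ a′ + c and expanding gives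
--   S_{d+1}(s) = Σ_m (-1)^m C(s+m-1, m) (Σ_c c^m) θ^{-(s+m)} S_d(s+m),
-- where Σ_c c^m is -1 if m > 0 and q - 1 divides m, and 0 otherwise. With K = s - 1 and Lucas' theorem,
-- the nonzero terms of the iterated expansion are the chains K = N_0 < N_1 < … < N_d of numbers that are
-- congruent mod q - 1 and whose base p digits increase weakly; such a chain contributes in degree
-- Σ_{j≥1} (N_j + 1). The cheapest chain is unique, so this cost V_d(s) is the valuation of S_d(s), and V_d(s)
-- increases strictly with d. In the multizeta sum the degrees (r-1, …, 1, 0) therefore give strictly the
-- smallest valuation, and the coefficient there is a product of nonzero ones.
--
-- Uniqueness of the cheapest chain: the digits added to K are tokens of weight p^l, sorted by the class of l
-- mod e, where q = p^e. Token counts v have weight divisible by q - 1 iff p X_t - X_{t-1} = v_t for an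
-- integral X. Build a chain from the top, always taking the lightest admissible X of the required height. Compare
-- it with another chain, level by level, at the highest position l where they differ: the greedy chain has
-- fewer tokens there, and on the next level both still agree from l down to l - e. So the gain p^l outweighs
-- everything that can be lost on all lower levels.
module Submission where

open import Defs
open import Level using (Level)
open import Data.Nat using (ℕ; _≤_)
open import Data.Vec using (Vec)
open import Data.Vec.Relation.Unary.All using (All)
open import Relation.Nullary using (¬_)

open import Algebra.Bundles using (CommutativeMonoid)
open import Data.Bool using (if_then_else_)
open import Data.List as List using (List; []; _∷_; map; length)
open import Data.List.Membership.Propositional using () renaming (_∈_ to _∈≡_)
open import Data.List.Relation.Unary.All as Allᴸ using ([]; _∷_) renaming (All to Allᴸ)
open import Data.List.Relation.Unary.AllPairs using (AllPairs; []; _∷_)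
open import Data.List.Relation.Unary.Any as Any using (Any; here; there)
open import Data.Nat as ℕ using (zero; suc; z≤n; s≤s; _∸_; NonZero)
open import Data.Nat.DivMod using (_/_; _%_; m%n<n; m≡m%n+[m/n]*n; m<n*o⇒m/o<n)
open import Data.Nat.Divisibility using (_∣_; divides; m%n≡0⇒n∣m)
open import Data.Nat.Induction using (<-wellFounded)
import Data.Nat.Properties as ℕₚ
open import Data.Nat.Tactic.RingSolver using (solve-∀)
open import Data.Product using (Σ; ∃; _×_; _,_; proj₁; proj₂)
open import Data.Sum as Sum using (_⊎_; inj₁; inj₂)
open import Data.Vec as Vec using ([]; _∷_)
import Data.Vec.Properties as Vecₚ
open import Data.Vec.Relation.Unary.All using ([]; _∷_)
open import Function using (_∘_; id)
open import Induction.WellFounded using (Acc; acc)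
open import Relation.Binary.PropositionalEquality as ≡ using (_≡_; _≢_)
open import Relation.Nullary using (Dec; yes; no; does; contradiction; _×-dec_; _⊎-dec_)

-- The vector `X` measures height: `h X` lists the weights of `v` under all rotations of the
-- classes, where `h = q - 1`. Adding tokens raises every rotated weight, so it raises every entry
-- of `X` by at least 1. Conversely `X - 1` always fits into the tokens of `v`. Hence a
-- configuration tops a chain of `k` levels exactly when `X` is at least `k` everywhere, and the
-- greedy choice from the top never gets stuck. The obstacle is that a greedy level `B` is minimal
-- only under its own upper level `A`, while the competing `B′` lies under another `A′` and may use
-- tokens that `A` lacks. Minimality alone is therefore not inherited downwards. The invariant is
-- `NoBetter`, which grants a competitor the larger of the two token counts in all classes but one.
-- `Step` hands it down: a vector that beats `B` with the help of `B′` is cut down, along arcs of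
-- the cycle of classes, to one that beats `B` inside `A`. On the algebraic side `p` and `e` are not
-- given with the field. The characteristic is found as a least zero of the map from the naturals,
-- and `q - 1` enters as the exponent of the multiplicative group.

module Combinatorics where

  open import Algebra.Properties.CommutativeMonoid.Sum ℕₚ.+-0-commutativeMonoid using (sum; ∑-distrib-+; sum-cong-≗)
  open import Algebra.Properties.Semiring.Sum ℕₚ.+-*-semiring using (*-distribˡ-sum)
  open import Data.Bool using (Bool; true; false; _∨_)
  open import Data.Empty using (⊥; ⊥-elim)
  open import Data.Fin as Fin using (Fin) renaming (zero to fz; suc to fs)
  import Data.Fin.Properties as Finₚ
  open import Data.List using (_ʳ++_)
  open import Data.List.Relation.Binary.Pointwise using (Pointwise; []; _∷_)
  open import Data.Nat using (_+_; _*_; _^_; _<_; _⊔_; _⊓_; _≤?_; _<?_; >-nonZero)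
  open import Data.Nat.DivMod using (_mod_; m<n⇒m%n≡m; %-distribˡ-+; [m+n]%n≡m%n; [m+kn]%n≡m%n; +-distrib-/-∣ʳ; m<n⇒m/n≡0; m*n/n≡m)
  open import Data.Nat.Divisibility using (∣m+n∣m⇒∣n; ∣m∣n⇒∣m+n; ∣n⇒∣m*n; ∣m⇒∣m*n; ∣-refl; n∣m*n; quotient; _∣0)
  open import Data.Nat.Properties
  open import Function using (case_of_)
  open import Relation.Binary.Definitions using (tri<; tri≈; tri>)
  open import Relation.Binary.PropositionalEquality using (_≗_; refl; sym; trans; cong; cong₂; subst; subst₂; module ≡-Reasoning)
  open import Relation.Nullary using (map′)

  -- Sums over classes and minimisation over boxes of vectors.

  sum-mono-≤ : ∀ {k} {f g : Fin k → ℕ} → (∀ i → f i ≤ g i) → sum f ≤ sum g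
  sum-mono-≤ {zero}  f≤g = z≤n
  sum-mono-≤ {suc k} f≤g = +-mono-≤ (f≤g fz) (sum-mono-≤ (f≤g ∘ fs))

  term≤sum : ∀ {k} (f : Fin k → ℕ) i → f i ≤ sum f
  term≤sum f fz     = m≤m+n (f fz) _
  term≤sum f (fs i) = ≤-trans (term≤sum (f ∘ fs) i) (m≤n+m _ (f fz))

  at : ∀ {k} → Fin k → ℕ → Fin k → ℕ
  at i x j = if does (j Finₚ.≟ i) then x else 0

  at-same : ∀ {k} (i : Fin k) x → at i x i ≡ x
  at-same i x with i Finₚ.≟ i
  ... | yes _   = refl
  ... | no  i≢i = contradiction refl i≢i

  at-other : ∀ {k} (i : Fin k) x {j} → j ≢ i → at i x j ≡ 0
  at-other i x {j} j≢i with j Finₚ.≟ i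
  ... | yes j≡i = contradiction j≡i j≢i
  ... | no  _   = refl

  sum-at : ∀ {k} (i : Fin k) x → x ≤ sum (at i x)
  sum-at i x = subst (_≤ sum (at i x)) (at-same i x) (term≤sum (at i x) i)

  -- The shape of every cost comparison below: `x` is the weight saved in class `i`, and `h` bounds
  -- what may be lost class by class.
  sum-gain : ∀ {k} (i : Fin k) x {f g h : Fin k → ℕ} → f i + x ≤ g i + h i →
             (∀ j → j ≢ i → f j ≤ g j + h j) → sum f + x ≤ sum g + sum h
  sum-gain i x {f} {g} {h} fi fj = begin
    sum f + x                       ≤⟨ +-monoʳ-≤ (sum f) (sum-at i x) ⟩
    sum f + sum (at i x)            ≡⟨ ∑-distrib-+ f (at i x) ⟨
    sum (λ j → f j + at i x j)      ≤⟨ sum-mono-≤ each ⟩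
    sum (λ j → g j + h j)           ≡⟨ ∑-distrib-+ g h ⟩
    sum g + sum h                   ∎
    where
    open ≤-Reasoning
    each : ∀ j → f j + at i x j ≤ g j + h j
    each j with j Finₚ.≟ i
    ... | yes refl = fi
    ... | no  j≢i  = ≤-trans (≤-reflexive (+-identityʳ (f j))) (fj j j≢i)

  -- `resp` stands in for function extensionality: a vector rebuilt from its head and tail agrees
  -- with the original only pointwise.
  search : ∀ k (M : Fin k → ℕ) (P : (Fin k → ℕ) → Set) → (∀ {f g} → f ≗ g → P f → P g) →
           (∀ f → Dec (P f)) → Dec (∃ λ f → (∀ i → f i ≤ M i) × P f)
  search zero M P resp P? = map′ (λ q → none , (λ ()) , q) (λ (f , _ , q) → resp (λ ()) q) (P? none)
    where
    none : Fin 0 → ℕ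
    none ()
  search (suc k) M P resp P? = map′ to from (anyBelow (suc (M fz)))
    where
    cons : ℕ → (Fin k → ℕ) → Fin (suc k) → ℕ
    cons x f fz     = x
    cons x f (fs i) = f i

    Tail : ℕ → Set
    Tail x = ∃ λ f → (∀ i → f i ≤ M (fs i)) × P (cons x f)

    tail? : ∀ x → Dec (Tail x)
    tail? x = search k (M ∘ fs) (P ∘ cons x)
                (λ f≗g → resp λ { fz → refl ; (fs i) → f≗g i }) (λ f → P? (cons x f))

    anyBelow : ∀ m → Dec (∃ λ x → x < m × Tail x)
    anyBelow m = anyUpTo? tail? m

    to : (∃ λ x → x < suc (M fz) × Tail x) → ∃ λ f → (∀ i → f i ≤ M i) × P f
    to (x , s≤s x≤M , f , f≤M , q) = cons x f , (λ { fz → x≤M ; (fs i) → f≤M i }) , q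

    from : (∃ λ f → (∀ i → f i ≤ M i) × P f) → ∃ λ x → x < suc (M fz) × Tail x
    from (f , f≤M , q) = f fz , s≤s (f≤M fz) , f ∘ fs , f≤M ∘ fs , resp (λ { fz → refl ; (fs i) → refl }) q

  -- Only competitors no heavier than `f₀` have to lie in the box `M`, so a bound on the weight is
  -- enough to make each search finite.
  argmin : ∀ {k} (P : (Fin k → ℕ) → Set) → (∀ {f g} → f ≗ g → P f → P g) → (∀ f → Dec (P f)) →
           (W : (Fin k → ℕ) → ℕ) → (∀ {f g} → f ≗ g → W f ≡ W g) → ∀ f₀ → P f₀ →
           (M : Fin k → ℕ) → (∀ f → P f → W f ≤ W f₀ → ∀ i → f i ≤ M i) →
           ∃ λ f → P f × (∀ g → P g → W f ≤ W g)
  argmin {k} P resp P? W W-resp f₀ p₀ M bounded = go f₀ p₀ ≤-refl (<-wellFounded (W f₀))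
    where
    go : ∀ f → P f → W f ≤ W f₀ → Acc _<_ (W f) → ∃ λ f → P f × (∀ g → P g → W f ≤ W g)
    go f pf f≤ (acc rs)
      with search k M (λ g → P g × W g < W f)
             (λ f≗g (q , lt) → resp f≗g q , subst (_< W f) (W-resp f≗g) lt)
             (λ g → P? g ×-dec W g <? W f)
    ... | yes (g , _ , pg , g<f) = go g pg (≤-trans (<⇒≤ g<f) f≤) (rs g<f)
    ... | no  none = f , pf , λ g pg → ≮⇒≥ λ g<f →
                       none (g , bounded g pg (≤-trans (<⇒≤ g<f) f≤) , pg , g<f)

  iterate : ∀ {A : Set} → (A → A) → ℕ → A → A
  iterate f zero    x = x
  iterate f (suc m) x = iterate f m (f x)

  ⊔-lub-< : ∀ {a b c} → a < c → b < c → a ⊔ b < c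
  ⊔-lub-< {a} {b} a<c b<c with ⊔-sel a b
  ... | inj₁ q rewrite q = a<c
  ... | inj₂ q rewrite q = b<c

  -- Token counts on the cycle of classes and the exchange step.

  module Vectors {e : ℕ} (prev : Fin e → Fin e)
    (prev-injective : ∀ {s t} → prev s ≡ prev t → s ≡ t)
    (reach : ∀ s t → ∃ λ m → iterate prev (suc m) t ≡ s)
    (p : ℕ) (2≤p : 2 ≤ p) where

    1≤p : 1 ≤ p
    1≤p = ≤-trans (s≤s z≤n) 2≤p

    instance
      p-nonZero : NonZero p
      p-nonZero = >-nonZero 1≤p

    Vector : Set
    Vector = Fin e → ℕ

    -- Token counts v of weight divisible by p ^ e - 1, together with the integral vector X that
    -- witnesses the divisibility: v = (p - shift) X.
    record Cfg : Set where
      constructor cfg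
      field
        X  : Vector
        v  : Vector
        eq : ∀ t → p * X t ≡ v t + X (prev t)
    open Cfg public

    AtLeast : ℕ → Vector → Set
    AtLeast k x = ∀ t → k ≤ x t

    infix 4 _◁_
    _◁_ : Cfg → Cfg → Set
    B ◁ A = (∀ t → suc (X B t) ≤ X A t) × (∀ t → v B t ≤ v A t)

    toCfg : (x : Vector) → (∀ t → x (prev t) ≤ p * x t) → Cfg
    toCfg x ok = cfg x (λ t → p * x t ∸ x (prev t)) (λ t → sym (m∸n+n≡m (ok t)))

    Fits : Vector → Vector → Set
    Fits β z = ∀ t → p * z t ≤ β t + z (prev t)

    -- A lowering step at prev t only costs at t, where there is room as long as p z_t < z_(prev t).
    normalise : ∀ k β z → AtLeast k z → Fits β z →
                ∃ λ B → AtLeast k (X B) × (∀ t → X B t ≤ z t) × (∀ t → v B t ≤ β t)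
    normalise k β z lev fits = go z lev fits (<-wellFounded (sum z))
      where
      go : ∀ z → AtLeast k z → Fits β z → Acc _<_ (sum z) →
           ∃ λ B → AtLeast k (X B) × (∀ t → X B t ≤ z t) × (∀ t → v B t ≤ β t)
      go z lev fits (acc rs) with Finₚ.all? (λ t → z (prev t) ≤? p * z t)
      ... | yes ok = toCfg z ok , lev , (λ t → ≤-refl) ,
                     λ t → m≤n+o⇒m∸n≤o (p * z t) (z (prev t)) (≤-trans (fits t) (≤-reflexive (+-comm (β t) _)))
      ... | no ¬ok with Finₚ.¬∀⟶∃¬ e _ (λ t → z (prev t) ≤? p * z t) ¬ok
      ...   | t , bad = let (B , l , le , q) = go z′ lev′ fits′ (rs smaller)
                        in B , l , (λ i → ≤-trans (le i) (z′≤z i)) , q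
        where
        s = prev t
        z′ : Vector
        z′ i = z i ∸ at s 1 i
        z′≤z : ∀ i → z′ i ≤ z i
        z′≤z i = m∸n≤m (z i) (at s 1 i)
        room : p * z t < z s
        room = ≰⇒> bad
        k<zs : k < z s
        k<zs = ≤-<-trans (≤-trans (lev t) (m≤n*m (z t) p)) room
        at-s : z′ s ≡ z s ∸ 1
        at-s = cong (z s ∸_) (at-same s 1)
        lev′ : AtLeast k z′
        lev′ i with i Finₚ.≟ s
        ... | yes refl = m+n≤o⇒m≤o∸n k (≤-trans (≤-reflexive (+-comm k 1)) k<zs)
        ... | no  _    = lev i
        fits′ : Fits β z′
        fits′ i with prev i Finₚ.≟ s
        ... | yes i≡ = begin
            p * z′ i               ≤⟨ *-monoʳ-≤ p (z′≤z i) ⟩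
            p * z i                ≡⟨ cong (λ j → p * z j) (prev-injective i≡) ⟩
            p * z t                ≤⟨ m+n≤o⇒m≤o∸n (p * z t) (≤-trans (≤-reflexive (+-comm (p * z t) 1)) room) ⟩
            z s ∸ 1                ≡⟨ cong (λ j → z j ∸ 1) i≡ ⟨
            z (prev i) ∸ 1         ≤⟨ m≤n+m _ (β i) ⟩
            β i + (z (prev i) ∸ 1) ∎
          where open ≤-Reasoning
        ... | no  _  = ≤-trans (*-monoʳ-≤ p (z′≤z i)) (fits i)
        smaller : sum z′ < sum z
        smaller = ≤-trans (≤-reflexive (+-comm 1 (sum z′)))
                    (≤-trans (sum-gain s 1 {h = λ _ → 0} one-less (λ j _ → ≤-trans (z′≤z j) (m≤m+n _ 0)))
                      (≤-reflexive (trans (cong (sum z +_) (sum-0 {e})) (+-identityʳ _))))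
          where
          one-less : z′ s + 1 ≤ z s + 0
          one-less = ≤-reflexive (trans (cong (_+ 1) at-s)
                       (trans (m∸n+n≡m (≤-trans (s≤s z≤n) k<zs)) (sym (+-identityʳ _))))
          sum-0 : ∀ {k} → sum {k} (λ _ → 0) ≡ 0
          sum-0 {zero}  = refl
          sum-0 {suc k} = sum-0 {k}

    -- Even with the larger of both token counts elsewhere, no vector saves a token of class u.
    NoBetter : ℕ → Cfg → Cfg → Fin e → Set
    NoBetter k A A′ u = ∀ y → AtLeast k y → (∀ t → y t ≤ X A t ⊔ X A′ t) →
      suc (p * y u) ≤ v A u + y (prev u) →
      (∀ t → t ≢ u → p * y t ≤ (v A t ⊔ v A′ t) + y (prev t)) → ⊥

    -- One level of the descent: if y shows that B is beaten at σ with the help of B′, then A admits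
    -- a vector below it that beats B on its own.
    module Step (k : ℕ) (A A′ B B′ : Cfg)
      (levA : AtLeast (suc k) (X A))
      (B◁A : B ◁ A) (B′◁A′ : B′ ◁ A′)
      (High : Fin e → Set)
      (near : ∀ u → High u → v A u ≤ v A′ u × 2 + v A′ u ≤ v A u + p)
      (lex : ∀ u → High u → NoBetter (suc k) A A′ u)
      (m : Vector) (σ : Fin e) (mσ<b : m σ < v B σ)
      (high : ∀ u → m u + p ≤ v A u → High u)
      (below : ∀ t → t ≢ σ → v B t < v B′ t → v B′ t ≤ m t)
      (y : Vector) (levy : AtLeast k y) (y≤ : ∀ t → y t ≤ X B t ⊔ X B′ t)
      (yσ : suc (p * y σ) ≤ v B σ + y (prev σ))
      (y-fits : ∀ t → t ≢ σ → p * y t ≤ (v B t ⊔ v B′ t) + y (prev t)) where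

      x x′ : Vector
      x  = X A
      x′ = X A′

      -- The budget for a rival of `B`: one token fewer at `σ`, and elsewhere additionally the
      -- tokens of `A` that are cheap, as counted by `m`. It stays within `v A`, so whatever fits it
      -- competes with `B` under `A`.
      β : Vector
      β t = if does (t Finₚ.≟ σ) then v B t ∸ 1 else v B t ⊔ (v A t ⊓ m t)

      β-σ : suc (β σ) ≡ v B σ
      β-σ with σ Finₚ.≟ σ
      ... | yes _ = m+[n∸m]≡n (≤-trans (s≤s z≤n) mσ<b)
      ... | no  q = contradiction refl q

      β-other : ∀ {t} → t ≢ σ → β t ≡ v B t ⊔ (v A t ⊓ m t)
      β-other {t} t≢σ with t Finₚ.≟ σ
      ... | yes q = contradiction q t≢σ
      ... | no  _ = refl

      m≤β : ∀ t → β t < v A t → m t ≤ β t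
      m≤β t lt with t Finₚ.≟ σ
      ... | yes refl = m+n≤o⇒m≤o∸n (m t) (≤-trans (≤-reflexive (+-comm (m t) 1)) mσ<b)
      ... | no  _    with v A t ≤? m t
      ...   | yes v≤m = contradiction (≤-<-trans (≤-trans (≤-reflexive (sym (m≤n⇒m⊓n≡m v≤m))) (m≤n⊔m (v B t) _)) lt) (<-irrefl refl)
      ...   | no  v≰m = ≤-trans (≤-reflexive (sym (m≥n⇒m⊓n≡n (≰⇒≥ v≰m)))) (m≤n⊔m (v B t) _)

      -- The classes where `X A - 1` does not fit `β`: subtracting 1 from all of `X A` saves `p - 1`
      -- tokens in each class, which covers a deficit of at most `p - 1`.
      InS : Fin e → Set
      InS t = β t + p ≤ v A t

      inS? : ∀ t → Dec (InS t)
      inS? t = β t + p ≤? v A t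

      S⇒High : ∀ {u} → InS u → High u
      S⇒High {u} s = high u (≤-trans (+-monoˡ-≤ p (m≤β u (≤-trans (≤-trans (≤-reflexive (+-comm 1 (β u))) (+-monoʳ-≤ (β u) 1≤p)) s))) s)

      Good : Fin e → Set
      Good t = p * y t ≤ β t + y (prev t)

      -- A class that is not good has an available token that A does not use.
      good⊎bad : ∀ t → Good t ⊎ (v A t < v A′ t × v A t ≤ β t)
      good⊎bad t with t Finₚ.≟ σ
      ... | yes refl = inj₁ (+-cancelˡ-≤ 1 _ _ (≤-trans yσ (≤-reflexive (cong (_+ y (prev t)) (sym (m+[n∸m]≡n (≤-trans (s≤s z≤n) mσ<b)))))))
      ... | no t≢σ with v B′ t ≤? v B t ⊔ (v A t ⊓ m t)
      ...   | yes a≤β = inj₁ (≤-trans (y-fits t t≢σ) (+-monoˡ-≤ (y (prev t)) (⊔-lub (m≤m⊔n (v B t) _) a≤β)))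
      ...   | no  a≰β = inj₂ (<-≤-trans (≤-<-trans v≤β β<a) (proj₂ B′◁A′ t) , v≤β)
        where
        β<a : v B t ⊔ (v A t ⊓ m t) < v B′ t
        β<a = ≰⇒> a≰β
        a≤m : v B′ t ≤ m t
        a≤m = below t t≢σ (≤-<-trans (m≤m⊔n (v B t) _) β<a)
        v≤β : v A t ≤ v B t ⊔ (v A t ⊓ m t)
        v≤β with v A t ≤? m t
        ... | yes v≤m = ≤-trans (≤-reflexive (sym (m≤n⇒m⊓n≡m v≤m))) (m≤n⊔m (v B t) _)
        ... | no  v≰m = contradiction (≤-trans (≤-reflexive (sym (m≥n⇒m⊓n≡n (≰⇒≥ v≰m)))) (m≤n⊔m (v B t) _))
                          (<⇒≱ (<-≤-trans β<a a≤m))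

      S⇒good : ∀ {u} → InS u → Good u
      S⇒good {u} s with good⊎bad u
      ... | inj₁ g = g
      ... | inj₂ (_ , v≤β) = contradiction (≤-trans (≤-trans (≤-reflexive (+-comm 1 (β u))) (+-monoʳ-≤ (β u) 1≤p)) (≤-trans s v≤β)) (<-irrefl refl)

      y<x⊔x′ : ∀ t → suc (y t) ≤ x t ⊔ x′ t
      y<x⊔x′ t = ≤-trans (s≤s (y≤ t)) (⊔-lub-< (≤-trans (proj₁ B◁A t) (m≤m⊔n _ _)) (≤-trans (proj₁ B′◁A′ t) (m≤n⊔m (x t) _)))

      -- Joins only help: p z_t - z_(prev t) is at most the value of the vector attaining the maximum.
      join-fits : ∀ (r : Vector) t → (p * r t ≤ (v A t ⊔ v A′ t) + (x (prev t) ⊔ r (prev t))) →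
                  p * (x t ⊔ r t) ≤ (v A t ⊔ v A′ t) + (x (prev t) ⊔ r (prev t))
      join-fits r t rt with ≤-total (r t) (x t)
      ... | inj₁ r≤x rewrite m≥n⇒m⊔n≡m r≤x = ≤-trans (≤-reflexive (eq A t)) (+-mono-≤ (m≤m⊔n (v A t) (v A′ t)) (m≤m⊔n (x (prev t)) (r (prev t))))
      ... | inj₂ x≤r rewrite m≤n⇒m⊔n≡n x≤r = rt

      -- The join leaves the value at `u` unchanged but raises it at `prev u`, and each unit gained
      -- there replaces a token of class `u`.
      slack : ∀ (r : Vector) u → r u ≤ x u → x (prev u) < r (prev u) →
              suc (p * (x u ⊔ r u)) ≤ v A u + (x (prev u) ⊔ r (prev u))
      slack r u r≤x lt rewrite m≥n⇒m⊔n≡m r≤x | eq A u | m≤n⇒m⊔n≡n (<⇒≤ lt) =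
        ≤-trans (≤-reflexive (sym (+-suc (v A u) _))) (+-monoʳ-≤ (v A u) lt)

      x⁻ : Vector
      x⁻ t = x′ t ∸ 1

      -- Subtracting 1 saves `p` at `t` and loses at most 1 through `prev t`. Truncated subtraction
      -- is responsible for the exceptional case.
      x⁻-eq : ∀ t → p * x⁻ t + p ≤ suc (v A′ t + (x (prev t) ⊔ x⁻ (prev t))) ⊎ x′ t ≡ 0
      x⁻-eq t with x′ t in q
      ... | zero  = inj₂ refl
      ... | suc z = inj₁ (begin
          p * z + p                                         ≡⟨ +-comm (p * z) p ⟩
          p + p * z                                         ≡⟨ *-suc p z ⟨
          p * suc z                                         ≡⟨ cong (p *_) q ⟨
          p * x′ t                                          ≡⟨ eq A′ t ⟩
          v A′ t + x′ (prev t)                              ≤⟨ +-monoʳ-≤ (v A′ t) (≤-trans (m≤n+m∸n (x′ (prev t)) 1) (s≤s (m≤n⊔m _ _))) ⟩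
          v A′ t + suc (x (prev t) ⊔ x⁻ (prev t))           ≡⟨ +-suc (v A′ t) _ ⟩
          suc (v A′ t + (x (prev t) ⊔ x⁻ (prev t)))         ∎)
        where open ≤-Reasoning

      -- If `x′` were larger at `prev u`, the join of `x` and `x′ - 1` would save a token of class
      -- `u` and contradict `lex`.
      S-x′≤x : ∀ {u} → InS u → x′ (prev u) ≤ x (prev u)
      S-x′≤x {u} s with x′ (prev u) ≤? x (prev u)
      ... | yes q = q
      ... | no  q = ⊥-elim (lex u (S⇒High s) (λ t → x t ⊔ x⁻ t) (λ t → ≤-trans (levA t) (m≤m⊔n _ _))
                      (λ t → ⊔-lub (m≤m⊔n _ _) (≤-trans (m∸n≤m (x′ t) 1) (m≤n⊔m (x t) _))) at-u (λ t _ → join-fits x⁻ t (fit t)))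
        where
        open ≤-Reasoning
        lt : x (prev u) < x′ (prev u)
        lt = ≰⇒> q
        nr = near u (S⇒High s)
        fit : ∀ t → p * x⁻ t ≤ (v A t ⊔ v A′ t) + (x (prev t) ⊔ x⁻ (prev t))
        fit t with x⁻-eq t
        ... | inj₂ z rewrite z | *-zeroʳ p = z≤n
        ... | inj₁ h = ≤-trans (+-cancelʳ-≤ 1 _ _ (begin
            p * x⁻ t + 1                                   ≤⟨ +-monoʳ-≤ (p * x⁻ t) 1≤p ⟩
            p * x⁻ t + p                                   ≤⟨ h ⟩
            suc (v A′ t + (x (prev t) ⊔ x⁻ (prev t)))      ≡⟨ +-comm 1 _ ⟩
            v A′ t + (x (prev t) ⊔ x⁻ (prev t)) + 1        ∎)) (+-monoˡ-≤ _ (m≤n⊔m (v A t) _))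
        at-u : suc (p * (x u ⊔ x⁻ u)) ≤ v A u + (x (prev u) ⊔ x⁻ (prev u))
        at-u with x⁻ u ≤? x u
        ... | no x⁻≰x rewrite m≤n⇒m⊔n≡n (≰⇒≥ x⁻≰x) = case x⁻-eq u of λ where
                (inj₂ z) → contradiction (≤-trans (≤-reflexive (cong (_∸ 1) z)) z≤n) x⁻≰x
                (inj₁ h) → +-cancelʳ-≤ (suc p) _ _ (begin
                  suc (p * x⁻ u) + suc p                             ≡⟨ shuffle₁ (p * x⁻ u) p ⟩
                  2 + (p * x⁻ u + p)                                 ≤⟨ +-monoʳ-≤ 2 h ⟩
                  2 + suc (v A′ u + (x (prev u) ⊔ x⁻ (prev u)))      ≡⟨ shuffle₂ (v A′ u) (x (prev u) ⊔ x⁻ (prev u)) ⟩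
                  (2 + v A′ u) + suc (x (prev u) ⊔ x⁻ (prev u))      ≤⟨ +-monoˡ-≤ _ (proj₂ nr) ⟩
                  v A u + p + suc (x (prev u) ⊔ x⁻ (prev u))         ≡⟨ shuffle₃ (v A u) p (x (prev u) ⊔ x⁻ (prev u)) ⟩
                  v A u + (x (prev u) ⊔ x⁻ (prev u)) + suc p         ∎)
          where
          shuffle₁ : ∀ a b → suc a + suc b ≡ 2 + (a + b)
          shuffle₁ = solve-∀
          shuffle₂ : ∀ a b → 2 + suc (a + b) ≡ (2 + a) + suc b
          shuffle₂ = solve-∀
          shuffle₃ : ∀ a b c → a + b + suc c ≡ a + c + suc b
          shuffle₃ = solve-∀
        ... | yes x⁻≤x with x (prev u) <? x⁻ (prev u)
        ...   | yes h = slack x⁻ u x⁻≤x h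
        -- The join gains nothing here, so `x′ (prev u)` is exactly `x (prev u) + 1`. The two bounds
        -- of `near` then place `p * x′ u` strictly between `p * x u` and `p * (x u + 1)`.
        ...   | no  h = contradiction (*-cancelˡ-< p (x u) (x′ u) lower) (≤⇒≯ (≤-pred (*-cancelˡ-< p (x′ u) (suc (x u)) upper)))
          where
          one-more : x′ (prev u) ≡ suc (x (prev u))
          one-more = ≤-antisym (≤-trans (m≤n+m∸n (x′ (prev u)) 1) (s≤s (≮⇒≥ h))) lt
          lower : p * x u < p * x′ u
          lower = begin-strict
            p * x u                    ≡⟨ eq A u ⟩
            v A u + x (prev u)         <⟨ +-mono-≤-< (proj₁ nr) lt ⟩
            v A′ u + x′ (prev u)       ≡⟨ eq A′ u ⟨
            p * x′ u                   ∎
          upper : p * x′ u < p * suc (x u)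
          upper = begin
            suc (p * x′ u)                     ≡⟨ cong suc (eq A′ u) ⟩
            suc (v A′ u + x′ (prev u))         ≡⟨ cong (λ z → suc (v A′ u + z)) one-more ⟩
            suc (v A′ u + suc (x (prev u)))    ≡⟨ cong suc (+-suc (v A′ u) _) ⟩
            2 + v A′ u + x (prev u)            ≤⟨ +-monoˡ-≤ _ (proj₂ nr) ⟩
            v A u + p + x (prev u)             ≡⟨ shuffle (v A u) p (x (prev u)) ⟩
            p + (v A u + x (prev u))           ≡⟨ cong (p +_) (eq A u) ⟨
            p + p * x u                        ≡⟨ *-suc p (x u) ⟨
            p * suc (x u)                      ∎
            where
            shuffle : ∀ a b c → a + b + c ≡ b + (a + c)
            shuffle = solve-∀

      S-y<x-prev : ∀ {u} → InS u → suc (y (prev u)) ≤ x (prev u)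
      S-y<x-prev {u} s = ≤-trans (y<x⊔x′ (prev u)) (⊔-lub ≤-refl (S-x′≤x s))

      -- Walking back from i, a class with x = k + 1 is met no later than one of S.
      data R : Fin e → Set where
        here : ∀ {i} → x i ≡ suc k → R i
        back : ∀ {i} → ¬ InS i → R (prev i) → R i

      module _ (u₀ : Fin e) (u₀∈S : InS u₀) where

        -- Walking back round a cycle need not end by itself; the class `u₀` of S, at the known
        -- distance `m`, ends it.
        R? : ∀ m i → iterate prev m i ≡ u₀ → Dec (R i)
        R? m i eq₀ with x i ≟ suc k
        ... | yes q = yes (here q)
        ... | no  q with inS? i
        ...   | yes s = no λ { (here r) → q r ; (back ¬s _) → ¬s s }
        R? zero    i refl | no q | no ¬s = contradiction u₀∈S ¬s
        R? (suc m) i eq₀  | no q | no ¬s = map′ (back ¬s) (λ { (here r) → contradiction r q ; (back _ r) → r }) (R? m (prev i) eq₀)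

        module _ (t : Fin e) (unused : v A t < v A′ t) where

          -- Lowering x by one along the arc from i to prev t frees a token of class i
          -- and needs one more token of class t.
          lowered : ∀ (arc : Fin e → Bool) i → InS i → arc i ≡ true →
                    (∀ j → arc j ≡ true → suc (suc k) ≤ x j) →
                    (∀ j → arc (prev j) ≡ true → arc j ≡ true ⊎ j ≡ t) → ⊥
          lowered arc i s arc-i lev closed = lex i (S⇒High s) z level-z (λ j → ≤-trans (z≤x j) (m≤m⊔n _ _)) at-i fits
            where
            open ≤-Reasoning
            drop : Bool → ℕ
            drop b = if b then 1 else 0
            z : Vector
            z j = x j ∸ drop (arc j)
            z≤x : ∀ j → z j ≤ x j
            z≤x j = m∸n≤m (x j) (drop (arc j))
            level-z : AtLeast (suc k) z
            level-z j with arc j in q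
            ... | true  = m+n≤o⇒m≤o∸n (suc k) (≤-trans (≤-reflexive (+-comm (suc k) 1)) (lev j q))
            ... | false = levA j
            x≤1+z : ∀ j → x j ≤ suc (z j)
            x≤1+z j with arc j
            ... | true  = m≤n+m∸n (x j) 1
            ... | false = n≤1+n _
            on-arc : ∀ j → arc j ≡ true → p * z j + p ≤ v A j + suc (z (prev j))
            on-arc j q rewrite q = begin
              p * (x j ∸ 1) + p                ≡⟨ +-comm _ p ⟩
              p + p * (x j ∸ 1)                ≡⟨ *-suc p (x j ∸ 1) ⟨
              p * suc (x j ∸ 1)                ≡⟨ cong (p *_) (m+[n∸m]≡n (≤-trans (s≤s z≤n) (levA j))) ⟩
              p * x j                          ≡⟨ eq A j ⟩
              v A j + x (prev j)               ≤⟨ +-monoʳ-≤ (v A j) (x≤1+z (prev j)) ⟩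
              v A j + suc (z (prev j))         ∎
            -- Lowering at `i` saves `p ≥ 2`, and at most 1 is lost through `prev i`.
            at-i : suc (p * z i) ≤ v A i + z (prev i)
            at-i = +-cancelʳ-≤ 1 _ _ (begin
              suc (p * z i) + 1                ≡⟨ shuffle (p * z i) ⟩
              p * z i + 2                      ≤⟨ +-monoʳ-≤ (p * z i) 2≤p ⟩
              p * z i + p                      ≤⟨ on-arc i arc-i ⟩
              v A i + suc (z (prev i))         ≡⟨ shuffle′ (v A i) (z (prev i)) ⟩
              v A i + z (prev i) + 1           ∎)
              where
              shuffle : ∀ a → suc a + 1 ≡ a + 2
              shuffle = solve-∀
              shuffle′ : ∀ a b → a + suc b ≡ a + b + 1
              shuffle′ = solve-∀
            fits : ∀ j → j ≢ i → p * z j ≤ (v A j ⊔ v A′ j) + z (prev j)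
            fits j _ with arc (prev j) in q
            ... | false = begin
              p * z j                          ≤⟨ *-monoʳ-≤ p (z≤x j) ⟩
              p * x j                          ≡⟨ eq A j ⟩
              v A j + x (prev j)               ≤⟨ +-monoˡ-≤ _ (m≤m⊔n (v A j) _) ⟩
              (v A j ⊔ v A′ j) + x (prev j)    ∎
            ... | true with closed j q
            ...   | inj₁ r = begin
              p * z j                              ≤⟨ +-cancelʳ-≤ 1 _ _ (≤-trans (+-monoʳ-≤ (p * z j) 1≤p) (≤-trans (on-arc j r) (≤-reflexive (shuffle (v A j) (z (prev j)))))) ⟩
              v A j + z (prev j)                   ≡⟨ cong (λ b → v A j + (x (prev j) ∸ drop b)) q ⟩
              v A j + (x (prev j) ∸ 1)             ≤⟨ +-monoˡ-≤ _ (m≤m⊔n (v A j) _) ⟩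
              (v A j ⊔ v A′ j) + (x (prev j) ∸ 1)  ∎
              where
              shuffle : ∀ a b → a + suc b ≡ a + b + 1
              shuffle = solve-∀
            ...   | inj₂ refl = begin
              p * z j                              ≤⟨ *-monoʳ-≤ p (z≤x j) ⟩
              p * x j                              ≡⟨ eq A j ⟩
              v A j + x (prev j)                   ≤⟨ +-monoʳ-≤ (v A j) (m≤n+m∸n (x (prev j)) 1) ⟩
              v A j + suc (x (prev j) ∸ 1)         ≡⟨ +-suc (v A j) _ ⟩
              suc (v A j) + (x (prev j) ∸ 1)       ≤⟨ +-monoˡ-≤ _ (≤-trans unused (m≤n⊔m (v A j) _)) ⟩
              (v A j ⊔ v A′ j) + (x (prev j) ∸ 1)  ∎

          -- The arc collects the classes already passed. They all have `x ≥ k + 2`, so lowering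
          -- them keeps level `k + 1`; meeting a class of S while still on such entries is
          -- impossible by `lowered`.
          walk : ∀ m (arc : Fin e → Bool) i → iterate prev m i ≡ u₀ →
                 (∀ j → arc j ≡ true → suc (suc k) ≤ x j) →
                 (∀ j → arc (prev j) ≡ true → arc j ≡ true ⊎ j ≡ t) →
                 (∀ j → prev j ≡ i → arc j ≡ true ⊎ j ≡ t) → R i
          walk m arc i eq₀ lev closed next with x i ≟ suc k
          ... | yes q = here q
          ... | no  q = continue (inS? i)
            where
            arc′ : Fin e → Bool
            arc′ j = does (j Finₚ.≟ i) ∨ arc j
            arc′-i : arc′ i ≡ true
            arc′-i with i Finₚ.≟ i
            ... | yes _ = refl
            ... | no r  = contradiction refl r
            weaken : ∀ j → arc j ≡ true → arc′ j ≡ true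
            weaken j r with j Finₚ.≟ i
            ... | yes _ = refl
            ... | no _  = r
            lev′ : ∀ j → arc′ j ≡ true → suc (suc k) ≤ x j
            lev′ j r with j Finₚ.≟ i
            ... | yes refl = ≤∧≢⇒< (levA j) (q ∘ sym)
            ... | no _     = lev j r
            closed′ : ∀ j → arc′ (prev j) ≡ true → arc′ j ≡ true ⊎ j ≡ t
            closed′ j r with prev j Finₚ.≟ i
            ... | yes pj≡i = Sum.map₁ (weaken j) (next j pj≡i)
            ... | no _     = Sum.map₁ (weaken j) (closed j r)
            next′ : ∀ j → prev j ≡ prev i → arc′ j ≡ true ⊎ j ≡ t
            next′ j r with prev-injective r
            ... | refl = inj₁ arc′-i
            advance : ∀ m → iterate prev m i ≡ u₀ → ¬ InS i → R (prev i)
            advance zero     refl ¬s = contradiction u₀∈S ¬s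
            advance (suc m′) eq₁  ¬s = walk m′ arc′ (prev i) eq₁ lev′ closed′ next′
            continue : Dec (InS i) → R i
            continue (yes s) = ⊥-elim (lowered arc′ i s arc′-i lev′ closed′)
            continue (no ¬s) = back ¬s (advance m eq₀ ¬s)

          bad⇒R : R (prev t)
          bad⇒R with reach u₀ t
          ... | m , eq₀ = walk m (λ _ → false) (prev t) eq₀ (λ _ ()) (λ _ ()) (λ j r → inj₂ (prev-injective r))

      x⊖1 : Vector
      x⊖1 t = x t ∸ 1

      s-x⊖1 : ∀ t → suc (x⊖1 t) ≡ x t
      s-x⊖1 t = m+[n∸m]≡n (≤-trans (s≤s z≤n) (levA t))

      -- Passing from x to x - 1 saves p at t, which pays for the missing v - β < p tokens outside S.
      shrunk-fits : ∀ (z : Vector) t → ¬ InS t → z t ≤ x⊖1 t → x (prev t) ≤ suc (z (prev t)) → p * z t ≤ β t + z (prev t)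
      shrunk-fits z t ¬s zt zp = +-cancelʳ-≤ p _ _ (begin
        p * z t + p                      ≤⟨ +-monoˡ-≤ p (*-monoʳ-≤ p zt) ⟩
        p * x⊖1 t + p                    ≡⟨ +-comm _ p ⟩
        p + p * x⊖1 t                    ≡⟨ *-suc p (x⊖1 t) ⟨
        p * suc (x⊖1 t)                  ≡⟨ cong (p *_) (s-x⊖1 t) ⟩
        p * x t                          ≡⟨ eq A t ⟩
        v A t + x (prev t)               ≤⟨ +-monoʳ-≤ (v A t) zp ⟩
        v A t + suc (z (prev t))         ≡⟨ +-suc (v A t) _ ⟩
        suc (v A t) + z (prev t)         ≤⟨ +-monoˡ-≤ _ (≰⇒> ¬s) ⟩
        β t + p + z (prev t)             ≡⟨ shuffle (β t) p (z (prev t)) ⟩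
        β t + z (prev t) + p             ∎)
        where
        open ≤-Reasoning
        shuffle : ∀ a b c → a + b + c ≡ a + c + b
        shuffle = solve-∀

      k≤x⊖1 : ∀ t → k ≤ x⊖1 t
      k≤x⊖1 t = ≤-pred (≤-trans (levA t) (≤-reflexive (sym (s-x⊖1 t))))

      -- The vector `z` is the minimum of `y` and `X A - 1`, switched to `X A - 1` on `R`, because
      -- `y` may fail at a bad class. The switch can end where `X A` equals `k + 1`: there `X A - 1`
      -- is `k`, hence at most `y`, and the inequality for `y` takes over.
      beaten : ∃ λ z → AtLeast k z × (∀ t → suc (z t) ≤ x t) × Fits β z
      beaten with Finₚ.any? inS?
      ... | no none = x⊖1 , k≤x⊖1 , (λ t → ≤-reflexive (s-x⊖1 t)) ,
                      λ t → shrunk-fits x⊖1 t (λ s → none (t , s)) ≤-refl (≤-reflexive (sym (s-x⊖1 (prev t))))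
      ... | yes (u₀ , u₀∈S) = z , level-z , (λ t → ≤-trans (s≤s (z≤x⊖1 t)) (≤-reflexive (s-x⊖1 t))) , fits
        where
        r? : ∀ i → Dec (R i)
        r? i with reach u₀ i
        ... | m , eq₀ = R? u₀ u₀∈S (suc m) i eq₀
        z : Vector
        z i = if does (r? i) then x⊖1 i else y i ⊓ x⊖1 i
        z≤x⊖1 : ∀ i → z i ≤ x⊖1 i
        z≤x⊖1 i with r? i
        ... | yes _ = ≤-refl
        ... | no _  = m⊓n≤n (y i) _
        level-z : AtLeast k z
        level-z i with r? i
        ... | yes _ = k≤x⊖1 i
        ... | no _  = ⊓-glb (levy i) (k≤x⊖1 i)
        min≤z : ∀ i → y i ⊓ x⊖1 i ≤ z i
        min≤z i with r? i
        ... | yes _ = m⊓n≤n (y i) _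
        ... | no _  = ≤-refl
        on-R : ∀ i → R i → z i ≡ x⊖1 i
        on-R i r with r? i
        ... | yes _ = refl
        ... | no ¬r = contradiction r ¬r
        z≤y : ∀ i → (R i → x i ≡ suc k) → z i ≤ y i
        z≤y i h with r? i
        ... | no _  = m⊓n≤m (y i) _
        ... | yes r rewrite h r = levy i
        fits : Fits β z
        fits t with inS? t
        -- A class of S belongs to `R` only through `here`, so `z` does not exceed `y` at `t`.
        ... | yes s = ≤-trans (*-monoʳ-≤ p (z≤y t λ { (here q) → q ; (back ¬s _) → contradiction s ¬s }))
                        (≤-trans (S⇒good s) (+-monoʳ-≤ (β t) (≤-trans (≤-reflexive (sym (m≤n⇒m⊓n≡m yp≤))) (min≤z (prev t)))))
          where
          yp≤ : y (prev t) ≤ x⊖1 (prev t)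
          yp≤ = ≤-pred (≤-trans (S-y<x-prev s) (≤-reflexive (sym (s-x⊖1 (prev t)))))
        ... | no ¬s = off-S (r? (prev t))
          where
          off-S : Dec (R (prev t)) → p * z t ≤ β t + z (prev t)
          off-S (yes r) = shrunk-fits z t ¬s (z≤x⊖1 t) (≤-reflexive (trans (sym (s-x⊖1 (prev t))) (cong suc (sym (on-R (prev t) r)))))
          off-S (no ¬r) with good⊎bad t
          ... | inj₂ (unused , _) = contradiction (bad⇒R u₀ u₀∈S t unused) ¬r
          ... | inj₁ g with y (prev t) ≤? x⊖1 (prev t)
          ...   | yes q = ≤-trans (*-monoʳ-≤ p (z≤y t λ { (here q′) → q′ ; (back _ r) → contradiction r ¬r }))
                            (≤-trans g (+-monoʳ-≤ (β t) (≤-trans (≤-reflexive (sym (m≤n⇒m⊓n≡m q))) (min≤z (prev t)))))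
          ...   | no q  = shrunk-fits z t ¬s (z≤x⊖1 t) (≤-trans (≤-reflexive (sym (s-x⊖1 (prev t))))
                            (s≤s (≤-trans (≤-reflexive (sym (m≥n⇒m⊓n≡n (≰⇒≥ q)))) (min≤z (prev t)))))

  -- Greedy chains and their comparison with arbitrary chains.

  -- Bounds what two chains of k levels that agree from position l on can differ in cost.
  excess : ℕ → ℕ → ℕ → ℕ → ℕ
  excess p e zero    l = 0
  excess p e (suc k) l = (p ^ l ∸ 1) + excess p e k (l ∸ e)

  -- n t l is the number of tokens of class t at positions below l, and F t i is the total weight of
  -- the i lightest tokens of class t.
  module Chains {e : ℕ} (prev : Fin e → Fin e)
    (prev-injective : ∀ {s t} → prev s ≡ prev t → s ≡ t)
    (reach : ∀ s t → ∃ λ m → iterate prev (suc m) t ≡ s)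
    (p : ℕ) (2≤p : 2 ≤ p)
    (cls : ℕ → Fin e) (n : Fin e → ℕ → ℕ)
    (n-zero : ∀ t → n t 0 ≡ 0)
    (n-const : ∀ t l → t ≢ cls l → n t (suc l) ≡ n t l)
    (n-mono : ∀ t {l l′} → l ≤ l′ → n t l ≤ n t l′)
    (n-suc : ∀ t l → n t (suc l) < n t l + p)
    (n-period : ∀ t l → n t (l + e) < n t l + p)
    (n-unbounded : ∀ t i → ∃ λ l → i ≤ n t l)
    (F : Fin e → ℕ → ℕ)
    (F-step : ∀ t l i → n t l ≤ i → F t i + p ^ l ≤ F t (suc i))
    (F-below : ∀ l → sum (λ t → F t (n t l)) < p ^ l)
    (F-gap : ∀ k l → sum (λ t → if does (t Finₚ.≟ cls l) then 0 else F t (n t l)) + excess p e k (l ∸ e) < p ^ l)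
    where

    open Vectors prev prev-injective reach p 2≤p

    F-suc : ∀ t i → suc (F t i) ≤ F t (suc i)
    F-suc t i = ≤-trans (≤-reflexive (+-comm 1 _)) (F-step t 0 i (≤-trans (≤-reflexive (n-zero t)) z≤n))

    F-mono : ∀ t {i j} → i ≤ j → F t i ≤ F t j
    F-mono t {i} {j} i≤j with m≤n⇒∃[o]m+o≡n i≤j
    ... | o , refl = go o
      where
      go : ∀ o → F t i ≤ F t (i + o)
      go zero    = ≤-reflexive (cong (F t) (sym (+-identityʳ i)))
      go (suc o) = ≤-trans (go o) (≤-trans (n≤1+n _) (≤-trans (F-suc t (i + o)) (≤-reflexive (cong (F t) (sym (+-suc i o))))))

    i≤F : ∀ t i → i ≤ F t i
    i≤F t zero    = z≤n
    i≤F t (suc i) = ≤-trans (s≤s (i≤F t i)) (F-suc t i)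

    F-⊔ : ∀ t i j → F t (i ⊔ j) ≤ F t i + F t j
    F-⊔ t i j with ⊔-sel i j
    ... | inj₁ q rewrite q = m≤m+n _ _
    ... | inj₂ q rewrite q = m≤n+m _ _

    W : Vector → ℕ
    W u = sum (λ t → F t (u t))

    w : Cfg → ℕ
    w A = W (v A)

    -- The last of the `b σ` tokens lies at position `π` or higher and weighs at least `p ^ π`, more
    -- than all tokens below `π` together.
    cheaper : ∀ σ π (b u : Vector) → n σ π < b σ → suc (u σ) ≤ b σ →
              (∀ t → t ≢ σ → u t ≤ b t ⊔ n t π) → W u < W b
    cheaper σ π b u π< uσ ut = +-cancelʳ-< (p ^ π) _ _ (begin-strict
      W u + p ^ π                             ≤⟨ sum-gain σ (p ^ π) (at-σ π< uσ) (λ t t≢σ → ≤-trans (F-mono t (ut t t≢σ)) (F-⊔ t (b t) (n t π))) ⟩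
      W b + sum (λ t → F t (n t π))           <⟨ +-monoʳ-< (W b) (F-below π) ⟩
      W b + p ^ π                             ∎)
      where
      open ≤-Reasoning
      at-σ : ∀ {c} → n σ π < c → u σ < c → F σ (u σ) + p ^ π ≤ F σ c + F σ (n σ π)
      at-σ {suc c} (s≤s π≤c) (s≤s u≤c) = begin
        F σ (u σ) + p ^ π        ≤⟨ +-monoˡ-≤ (p ^ π) (F-mono σ u≤c) ⟩
        F σ c + p ^ π            ≤⟨ F-step σ π c π≤c ⟩
        F σ (suc c)              ≤⟨ m≤m+n _ _ ⟩
        F σ (suc c) + F σ (n σ π) ∎

    record Optimal (k : ℕ) (A B : Cfg) : Set where
      field
        level   : AtLeast k (X B)
        below   : B ◁ A
        minimal : ∀ B′ → AtLeast k (X B′) → B′ ◁ A → w B ≤ w B′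

    record Best (k : ℕ) (B : Cfg) : Set where
      field
        level   : AtLeast k (X B)
        minimal : ∀ B′ → AtLeast k (X B′) → w B ≤ w B′

    -- The invariant handed down, used for a position `l` above which `A` and `A′` agree. In `near`
    -- the excess of `A′` is at most `p - 2`: position `l` holds at most `p - 1` tokens, and `A`
    -- already uses one of them.
    record Hyp (k : ℕ) (A A′ : Cfg) (l : ℕ) : Set where
      field
        near : ∀ u → n u l < v A u → v A u ≤ v A′ u × 2 + v A′ u ≤ v A u + p
        lex  : ∀ u → n u l < v A u → NoBetter k A A′ u

    Below : Cfg → Cfg → Fin e → ℕ → Set
    Below B B′ σ π = ∀ t → t ≢ σ → v B t < v B′ t → v B′ t ≤ n t π

    -- The origin of `l ∸ e`: by `n-period` there are fewer than `p` tokens of a class from `π` up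
    -- to `π + e`. So a class in which `A` has `p` tokens beyond those below `π` also uses one at
    -- `l` or higher, where `hyp` applies. The vector from `beaten` then undercuts the minimal `B`.
    optimal⇒noBetter : ∀ {k A A′ B B′ l} → AtLeast (suc k) (X A) → Optimal k A B → B′ ◁ A′ →
      Hyp (suc k) A A′ l → ∀ σ π → l ∸ e ≤ π → n σ π < v B σ → Below B B′ σ π → NoBetter k B B′ σ
    optimal⇒noBetter {k} {A} {A′} {B} {B′} {l} levA opt B′◁A′ hyp σ π l≤π π< low y levy y≤ yσ yt =
      let (z , lev , z<x , fits) = S.beaten
          (C , levC , C≤z , vC≤β) = normalise k S.β z lev fits
      in <⇒≱ (cheaper σ π (v B) (v C) π< (≤-trans (s≤s (vC≤β σ)) (≤-reflexive S.β-σ))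
                (λ t t≢σ → ≤-trans (vC≤β t) (≤-trans (≤-reflexive (S.β-other t≢σ))
                             (⊔-lub (m≤m⊔n (v B t) (n t π)) (≤-trans (m⊓n≤n (v A t) _) (m≤n⊔m (v B t) _))))))
             (Optimal.minimal opt C levC ((λ t → ≤-trans (s≤s (C≤z t)) (z<x t)) , (λ t → ≤-trans (vC≤β t) (β≤v t))))
      where
      module S = Step k A A′ B B′ levA (Optimal.below opt) B′◁A′
                   (λ u → n u l < v A u) (Hyp.near hyp) (Hyp.lex hyp) (λ t → n t π) σ π<
                   (λ u h → <-≤-trans (≤-<-trans (n-mono u (≤-trans (m≤n+m∸n l e) (≤-trans (≤-reflexive (+-comm e _)) (+-monoˡ-≤ e l≤π)))) (n-period u π)) h)
                   low y levy y≤ yσ yt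
      β≤v : ∀ t → S.β t ≤ v A t
      β≤v t with t Finₚ.≟ σ
      ... | yes refl = ≤-trans (m∸n≤m (v B t) 1) (proj₂ (Optimal.below opt) t)
      ... | no  _    = ⊔-lub (proj₂ (Optimal.below opt) t) (m⊓n≤m (v A t) _)

    -- On the top level no upper configuration caps the budget, and `y` itself fits it.
    best⇒noBetter : ∀ {k B B′} → Best k B → ∀ σ π → n σ π < v B σ → Below B B′ σ π → NoBetter k B B′ σ
    best⇒noBetter {k} {B} {B′} best σ π π< low y levy y≤ yσ yt =
      let (C , levC , C≤y , vC≤β) = normalise k β y levy fits
      in <⇒≱ (cheaper σ π (v B) (v C) π< (≤-trans (s≤s (vC≤β σ)) (≤-reflexive β-σ))
                (λ t t≢σ → ≤-trans (vC≤β t) (≤-reflexive (β-other t≢σ))))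
             (Best.minimal best C levC)
      where
      β : Vector
      β t = if does (t Finₚ.≟ σ) then v B t ∸ 1 else v B t ⊔ n t π
      β-σ : suc (β σ) ≡ v B σ
      β-σ with σ Finₚ.≟ σ
      ... | yes _ = m+[n∸m]≡n (≤-trans (s≤s z≤n) π<)
      ... | no  q = contradiction refl q
      β-other : ∀ {t} → t ≢ σ → β t ≡ v B t ⊔ n t π
      β-other {t} t≢σ with t Finₚ.≟ σ
      ... | yes q = contradiction q t≢σ
      ... | no  _ = refl
      fits : Fits β y
      fits t with t Finₚ.≟ σ
      ... | yes refl = +-cancelˡ-≤ 1 _ _ (≤-trans yσ (≤-reflexive (cong (_+ y (prev t)) (sym (m+[n∸m]≡n (≤-trans (s≤s z≤n) π<))))))
      ... | no t≢σ with v B′ t ≤? v B t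
      ...   | yes q = ≤-trans (yt t t≢σ) (+-monoˡ-≤ (y (prev t)) (⊔-lub (m≤m⊔n _ _) (≤-trans q (m≤m⊔n _ _))))
      ...   | no  q = ≤-trans (yt t t≢σ) (+-monoˡ-≤ (y (prev t)) (⊔-lub (m≤m⊔n _ _) (≤-trans (low t t≢σ (≰⇒> q)) (m≤n⊔m (v B t) _))))

    -- B and B′ contain the same tokens at all positions from l on.
    Agree : Cfg → Cfg → ℕ → Set
    Agree B B′ l = ∀ t → v B t ≡ v B′ t ⊎ (v B t ≤ n t l × v B′ t ≤ n t l)

    record Differ (B B′ : Cfg) (l : ℕ) : Set where
      field
        agree : Agree B B′ (suc l)
        less  : v B (cls l) < v B′ (cls l)
        above : n (cls l) l < v B′ (cls l)

    agree⇒below : ∀ {B B′ l} → Agree B B′ l → ∀ t → v B t < v B′ t → v B′ t ≤ n t l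
    agree⇒below agr t lt with agr t
    ... | inj₁ q       = contradiction lt (<-irrefl q)
    ... | inj₂ (_ , q) = q

    agree⇒equal : ∀ {B B′ l} → Agree B B′ l → ∀ t → n t l < v B t → v B t ≡ v B′ t
    agree⇒equal agr t lt with agr t
    ... | inj₁ q       = q
    ... | inj₂ (q , _) = contradiction q (<⇒≱ lt)

    near-refl : ∀ {a b} → a ≡ b → a ≤ b × 2 + b ≤ a + p
    near-refl {a} refl = ≤-refl , ≤-trans (≤-reflexive (+-comm 2 a)) (+-monoʳ-≤ a 2≤p)

    agree-∞ : ∀ B B′ l₀ → ∃ λ m → Agree B B′ (m + l₀)
    agree-∞ B B′ l₀ = sum bound , λ t → inj₂ (≤-trans (m≤m⊔n _ (v B′ t)) (big t) , ≤-trans (m≤n⊔m (v B t) _) (big t))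
      where
      bound : Vector
      bound t = proj₁ (n-unbounded t (v B t ⊔ v B′ t))
      big : ∀ t → v B t ⊔ v B′ t ≤ n t (sum bound + l₀)
      big t = ≤-trans (proj₂ (n-unbounded t (v B t ⊔ v B′ t))) (n-mono t (≤-trans (term≤sum bound t) (m≤m+n _ l₀)))

    -- The highest position at or above l₀ where B and B′ differ, if any; B has less there.
    descend : ∀ k B B′ l₀ → AtLeast k (X B′) →
      (∀ σ π → l₀ ≤ π → n σ π < v B σ → Below B B′ σ π → NoBetter k B B′ σ) →
      (∃ λ l → Differ B B′ l × Hyp k B B′ l) ⊎ (Agree B B′ l₀ × Hyp k B B′ l₀)
    descend k B B′ l₀ levB′ T = go (proj₁ (agree-∞ B B′ l₀)) (proj₂ (agree-∞ B B′ l₀))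
      where
      go : ∀ m → Agree B B′ (m + l₀) →
           (∃ λ l → Differ B B′ l × Hyp k B B′ l) ⊎ (Agree B B′ l₀ × Hyp k B B′ l₀)
      go zero agr = inj₂ (agr , record
        { near = λ u lt → near-refl (agree⇒equal {B} {B′} agr u lt)
        ; lex  = λ u lt → T u l₀ ≤-refl lt (λ t _ → agree⇒below {B} {B′} agr t) })
      go (suc m) agr = at-l (agr σ)
        where
        l = m + l₀
        σ = cls l
        Result = (∃ λ l → Differ B B′ l × Hyp k B B′ l) ⊎ (Agree B B′ l₀ × Hyp k B B′ l₀)
        others : ∀ t → t ≢ σ → v B t ≡ v B′ t ⊎ (v B t ≤ n t l × v B′ t ≤ n t l)
        others t t≢σ = subst (λ z → v B t ≡ v B′ t ⊎ (v B t ≤ z × v B′ t ≤ z)) (n-const t l t≢σ) (agr t)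
        lower : v B σ ≡ v B′ σ ⊎ (v B σ ≤ n σ l × v B′ σ ≤ n σ l) → Result
        lower q = go m agr′
          where
          agr′ : Agree B B′ l
          agr′ t with t Finₚ.≟ σ
          ... | yes refl = q
          ... | no t≢σ   = others t t≢σ
        below-σ : Below B B′ σ l
        below-σ t t≢σ lt with others t t≢σ
        ... | inj₁ q       = contradiction lt (<-irrefl q)
        ... | inj₂ (_ , q) = q
        at-l : v B σ ≡ v B′ σ ⊎ (v B σ ≤ n σ (suc l) × v B′ σ ≤ n σ (suc l)) → Result
        at-l (inj₁ q) = lower (inj₁ q)
        at-l (inj₂ (b≤ , b′≤)) with <-cmp (v B σ) (v B′ σ)
        ... | tri≈ _ q _ = lower (inj₁ q)
        ... | tri> _ _ gt with n σ l <? v B σ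
        ...   | no q  = lower (inj₂ (≮⇒≥ q , ≤-trans (<⇒≤ gt) (≮⇒≥ q)))
        -- If `B` had more tokens at this position, `X B′` itself would be the vector that
        -- `NoBetter` excludes.
        ...   | yes q = ⊥-elim (T σ l (m≤n+m l₀ m) q below-σ (X B′) levB′ (λ t → m≤n⊔m (X B t) _)
                          (≤-trans (≤-reflexive (cong suc (eq B′ σ))) (+-monoˡ-≤ _ gt))
                          (λ t _ → ≤-trans (≤-reflexive (eq B′ t)) (+-monoˡ-≤ _ (m≤n⊔m (v B t) _))))
        at-l (inj₂ (b≤ , b′≤)) | tri< lt _ _ with n σ l <? v B′ σ
        ...   | no q  = lower (inj₂ (≤-trans (<⇒≤ lt) (≮⇒≥ q) , ≮⇒≥ q))
        ...   | yes q = inj₁ (l , record { agree = agr ; less = lt ; above = q } , record { near = near ; lex = lex })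
          where
          near : ∀ u → n u l < v B u → v B u ≤ v B′ u × 2 + v B′ u ≤ v B u + p
          near u h with u Finₚ.≟ σ
          ... | no u≢σ   = near-refl (agree⇒equal {B} {B′} agr u (≤-<-trans (≤-reflexive (n-const u l u≢σ)) h))
          ... | yes refl = <⇒≤ lt , (begin
              2 + v B′ σ             ≤⟨ +-monoʳ-≤ 2 b′≤ ⟩
              2 + n σ (suc l)        ≤⟨ s≤s (n-suc σ l) ⟩
              suc (n σ l) + p        ≤⟨ +-monoˡ-≤ p h ⟩
              v B σ + p              ∎)
            where open ≤-Reasoning
          lex : ∀ u → n u l < v B u → NoBetter k B B′ u
          lex u h with u Finₚ.≟ σ
          ... | yes refl = T σ l (m≤n+m l₀ m) h below-σ
          -- Position `l` carries no token of class `u`, so the critical position can be moved up to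
          -- `l + 1`, from where on both agree.
          ... | no u≢σ   = T u (suc l) (≤-trans (m≤n+m l₀ m) (n≤1+n l)) (≤-<-trans (≤-reflexive (n-const u l u≢σ)) h)
                             (λ t _ → agree⇒below {B} {B′} agr t)

    -- The configuration at `end` is a placeholder that is neither counted nor paid for: `Chain k A`
    -- has `k` levels, starting with `A` when `k` is positive.
    data Chain : ℕ → Cfg → Set where
      end  : ∀ {A} → Chain 0 A
      link : ∀ {k A B} → AtLeast k (X B) → B ◁ A → Chain k B → Chain (suc k) A

    data Greedy : ℕ → Cfg → Set where
      end  : ∀ {A} → Greedy 0 A
      link : ∀ {k A B} → Optimal k A B → Greedy k B → Greedy (suc k) A

    weights : ∀ {k A} → Chain k A → List ℕ
    weights         end            = []
    weights {A = A} (link _ _ c) = w A ∷ weights c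

    cost : ∀ {k A} → Chain k A → ℕ
    cost         end            = 0
    cost {A = A} (link _ _ c) = w A + cost c

    chain : ∀ {k A} → Greedy k A → Chain k A
    chain end          = end
    chain (link opt g) = link (Optimal.level opt) (Optimal.below opt) (chain g)

    agree-weights : ∀ {A A′ l} → Agree A A′ l → w A ≤ w A′ + (p ^ l ∸ 1)
    agree-weights {A} {A′} {l} agr = begin
      W (v A)                                     ≤⟨ sum-mono-≤ each ⟩
      sum (λ t → F t (v A′ t) + F t (n t l))      ≡⟨ ∑-distrib-+ (λ t → F t (v A′ t)) (λ t → F t (n t l)) ⟩
      W (v A′) + sum (λ t → F t (n t l))          ≤⟨ +-monoʳ-≤ (w A′) (m+n≤o⇒m≤o∸n _ (≤-trans (≤-reflexive (+-comm _ 1)) (F-below l))) ⟩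
      W (v A′) + (p ^ l ∸ 1)                      ∎
      where
      open ≤-Reasoning
      each : ∀ t → F t (v A t) ≤ F t (v A′ t) + F t (n t l)
      each t with agr t
      ... | inj₁ q       = ≤-trans (≤-reflexive (cong (F t) q)) (m≤m+n _ _)
      ... | inj₂ (q , _) = ≤-trans (F-mono t q) (m≤n+m _ _)

    -- `A′` has a token of class `cls l` more than `A`, of weight at least `p ^ l`. Against it stand
    -- only the tokens below `l` of the other classes, and `F-gap` leaves room for the losses of `k`
    -- further levels.
    differ-weights : ∀ k {A A′ l} → Differ A A′ l → w A + excess p e k (l ∸ e) < w A′
    differ-weights k {A} {A′} {l} d = +-cancelʳ-< (p ^ l) _ _ (begin-strict
      w A + ex + p ^ l                ≡⟨ shuffle (w A) ex (p ^ l) ⟩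
      w A + p ^ l + ex                ≤⟨ +-monoˡ-≤ ex (sum-gain σ (p ^ l) (at-σ less above) others) ⟩
      w A′ + sum H + ex               ≡⟨ +-assoc (w A′) _ _ ⟩
      w A′ + (sum H + ex)             <⟨ +-monoʳ-< (w A′) (F-gap k l) ⟩
      w A′ + p ^ l                    ∎)
      where
      open ≤-Reasoning
      open Differ d
      σ = cls l
      ex = excess p e k (l ∸ e)
      H : Vector
      H t = if does (t Finₚ.≟ σ) then 0 else F t (n t l)
      shuffle : ∀ a b c → a + b + c ≡ a + c + b
      shuffle = solve-∀
      at-σ : ∀ {c} → v A σ < c → n σ l < c → F σ (v A σ) + p ^ l ≤ F σ c + H σ
      at-σ {suc c} (s≤s a≤c) (s≤s l≤c) = ≤-trans (+-monoˡ-≤ (p ^ l) (F-mono σ a≤c)) (≤-trans (F-step σ l c l≤c) (m≤m+n _ _))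
      others : ∀ t → t ≢ σ → F t (v A t) ≤ F t (v A′ t) + H t
      others t t≢σ with t Finₚ.≟ σ | agree t
      ... | yes q | _            = contradiction q t≢σ
      ... | no _  | inj₁ q       = ≤-trans (≤-reflexive (cong (F t) q)) (m≤m+n _ _)
      ... | no _  | inj₂ (q , _) = ≤-trans (F-mono t (≤-trans q (≤-reflexive (n-const t l t≢σ)))) (m≤n+m _ _)

    mutual
      strict : ∀ k {A A′ l} → AtLeast (suc k) (X A) → Differ A A′ l → Hyp (suc k) A A′ l →
               (g : Greedy (suc k) A) (c : Chain (suc k) A′) → cost (chain g) < cost c
      strict k {A} {A′} {l} lev d h (link opt g) (link levB B◁ c) = begin-strict
        w A + cost (chain g)                                ≤⟨ +-monoʳ-≤ (w A) (tail k lev opt levB B◁ h g c) ⟩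
        w A + (cost c + excess p e k (l ∸ e))               ≡⟨ shuffle (w A) (cost c) _ ⟩
        w A + excess p e k (l ∸ e) + cost c                 <⟨ +-monoˡ-< (cost c) (differ-weights k d) ⟩
        w A′ + cost c                                       ∎
        where
        open ≤-Reasoning
        shuffle : ∀ a b c → a + (b + c) ≡ a + c + b
        shuffle = solve-∀

      weak : ∀ k {A A′ l} → AtLeast k (X A) → Agree A A′ l → Hyp k A A′ l →
             (g : Greedy k A) (c : Chain k A′) → cost (chain g) ≤ cost c + excess p e k l
      weak zero    lev agr h end end = z≤n
      weak (suc k) {A} {A′} {l} lev agr h (link opt g) (link levB B◁ c) = begin
        w A + cost (chain g)                                            ≤⟨ +-mono-≤ (agree-weights {A} {A′} agr) (tail k lev opt levB B◁ h g c) ⟩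
        w A′ + (p ^ l ∸ 1) + (cost c + excess p e k (l ∸ e))            ≡⟨ shuffle (w A′) (p ^ l ∸ 1) (cost c) _ ⟩
        w A′ + cost c + (p ^ l ∸ 1 + excess p e k (l ∸ e))              ∎
        where
        open ≤-Reasoning
        shuffle : ∀ a b c d → a + b + (c + d) ≡ a + c + (b + d)
        shuffle = solve-∀

      -- The hypotheses at `l` control the next level only from `l ∸ e` upwards. Either a difference
      -- shows up there, in favour of the greedy chain, or the comparison continues with agreement
      -- from `l ∸ e` on.
      tail : ∀ k {A A′ B B′ l} → AtLeast (suc k) (X A) → Optimal k A B → AtLeast k (X B′) → B′ ◁ A′ → Hyp (suc k) A A′ l →
             (g : Greedy k B) (c : Chain k B′) → cost (chain g) ≤ cost c + excess p e k (l ∸ e)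
      tail zero    lev opt levB′ B′◁ h end end = z≤n
      tail (suc k) {A} {A′} {B} {B′} {l} lev opt levB′ B′◁ h g c
        with descend (suc k) B B′ (l ∸ e) levB′ (optimal⇒noBetter {A′ = A′} {B′ = B′} lev opt B′◁ h)
      ... | inj₁ (l′ , d , h′) = ≤-trans (<⇒≤ (strict k (Optimal.level opt) d h′ g c)) (m≤m+n _ _)
      ... | inj₂ (agr , h′)    = weak (suc k) (Optimal.level opt) agr h′ g c

    agree-0 : ∀ {A A′} → Agree A A′ 0 → w A ≡ w A′
    agree-0 {A} {A′} agr = sum-cong-≗ (λ t → cong (F t) (same t))
      where
      same : ∀ t → v A t ≡ v A′ t
      same t with agr t
      ... | inj₁ q = q
      ... | inj₂ (a , b) rewrite n-zero t = trans (n≤0⇒n≡0 a) (sym (n≤0⇒n≡0 b))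

    -- Agreement from position 0 is equality of counts, and 0 is a fixed point of `l ∸ e`: equality
    -- passes from level to level until some difference makes the comparison strict.
    unique : ∀ k {A A′} → AtLeast k (X A) → Agree A A′ 0 → Hyp k A A′ 0 →
             (g : Greedy k A) (c : Chain k A′) → cost (chain g) < cost c ⊎ weights (chain g) ≡ weights c
    unique zero    lev agr h end end = inj₂ refl
    unique (suc zero) {A} {A′} lev agr h (link _ end) (link _ _ end) = inj₂ (cong (_∷ []) (agree-0 {A} {A′} agr))
    unique (suc (suc k)) {A} {A′} lev agr h (link {B = B} opt g) (link {B = B′} levB B◁ c)
      with descend (suc k) B B′ 0 levB (λ σ π _ → optimal⇒noBetter {A′ = A′} {B′ = B′} lev opt B◁ h σ π (≤-trans (m∸n≤m 0 e) z≤n))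
    ... | inj₁ (l′ , d , h′) = inj₁ (+-mono-≤-< (≤-reflexive (agree-0 {A} {A′} agr)) (strict k (Optimal.level opt) d h′ g c))
    ... | inj₂ (agr′ , h′) with unique (suc k) (Optimal.level opt) agr′ h′ g c
    ...   | inj₁ lt = inj₁ (+-mono-≤-< (≤-reflexive (agree-0 {A} {A′} agr)) lt)
    ...   | inj₂ q  = inj₂ (cong₂ _∷_ (agree-0 {A} {A′} agr) q)

    vec : Vector → Vector
    vec x t = p * x t ∸ x (prev t)

    vec-resp : ∀ {f g : Vector} → f ≗ g → W (vec f) ≡ W (vec g)
    vec-resp f≗g = sum-cong-≗ (λ t → cong (F t) (cong₂ _∸_ (cong (p *_) (f≗g t)) (f≗g (prev t))))

    w-vec : ∀ A → w A ≡ W (vec (X A))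
    w-vec A = sum-cong-≗ (λ t → cong (F t) (sym (trans (cong (_∸ X A (prev t)) (eq A t)) (m+n∸n≡m (v A t) (X A (prev t))))))

    -- `X A - 1` fits the budget `v A` and, once normalised, starts the minimisation. All
    -- competitors lie below `X A`, so the search is finite.
    optimal : ∀ k A → AtLeast (suc k) (X A) → ∃ λ B → Optimal k A B
    optimal k A lev =
      let (x , q , min) = argmin P resp P? (W ∘ vec) vec-resp (X B₀) (cfg-P B₀ (proj₁ B₀-ok) (proj₂ B₀-ok)) (X A)
                            (λ f q _ i → ≤-trans (n≤1+n _) (proj₁ (proj₂ (q i))))
      in toCfg x (λ t → proj₁ (proj₂ (proj₂ (q t)))) , record
           { level   = λ t → proj₁ (q t)
           ; below   = (λ t → proj₁ (proj₂ (q t))) , (λ t → m≤n+o⇒m∸n≤o (p * x t) (x (prev t)) (≤-trans (proj₂ (proj₂ (proj₂ (q t)))) (≤-reflexive (+-comm (v A t) _))))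
           ; minimal = λ B′ levB′ B′◁A → ≤-trans (min (X B′) (cfg-P B′ levB′ B′◁A)) (≤-reflexive (sym (w-vec B′))) }
      where
      P : Vector → Set
      P f = ∀ t → k ≤ f t × suc (f t) ≤ X A t × f (prev t) ≤ p * f t × p * f t ≤ v A t + f (prev t)
      resp : ∀ {f g} → f ≗ g → P f → P g
      resp f≗g q t rewrite sym (f≗g t) | sym (f≗g (prev t)) = q t
      P? : ∀ f → Dec (P f)
      P? f = Finₚ.all? (λ t → k ≤? f t ×-dec suc (f t) ≤? X A t ×-dec f (prev t) ≤? p * f t ×-dec p * f t ≤? v A t + f (prev t))
      cfg-P : ∀ B → AtLeast k (X B) → B ◁ A → P (X B)
      cfg-P B levB (B< , vB≤) t = levB t , B< t , ≤-trans (m≤n+m _ (v B t)) (≤-reflexive (sym (eq B t))) ,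
                                  ≤-trans (≤-reflexive (eq B t)) (+-monoˡ-≤ _ (vB≤ t))
      x⁻ : Vector
      x⁻ t = X A t ∸ 1
      s-x⁻ : ∀ t → suc (x⁻ t) ≡ X A t
      s-x⁻ t = m+[n∸m]≡n (≤-trans (s≤s z≤n) (lev t))
      fits : Fits (v A) x⁻
      fits t = +-cancelʳ-≤ 1 _ _ (begin
        p * x⁻ t + 1                  ≤⟨ +-monoʳ-≤ (p * x⁻ t) 1≤p ⟩
        p * x⁻ t + p                  ≡⟨ +-comm (p * x⁻ t) p ⟩
        p + p * x⁻ t                  ≡⟨ *-suc p (x⁻ t) ⟨
        p * suc (x⁻ t)                ≡⟨ cong (p *_) (s-x⁻ t) ⟩
        p * X A t                     ≡⟨ eq A t ⟩
        v A t + X A (prev t)          ≡⟨ cong (v A t +_) (s-x⁻ (prev t)) ⟨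
        v A t + suc (x⁻ (prev t))     ≡⟨ shuffle (v A t) (x⁻ (prev t)) ⟩
        v A t + x⁻ (prev t) + 1       ∎)
        where
        open ≤-Reasoning
        shuffle : ∀ a b → a + suc b ≡ a + b + 1
        shuffle = solve-∀
      start : ∃ λ B → AtLeast k (X B) × (∀ t → X B t ≤ x⁻ t) × (∀ t → v B t ≤ v A t)
      start = normalise k (v A) x⁻ (λ t → ≤-pred (≤-trans (lev t) (≤-reflexive (sym (s-x⁻ t))))) fits
      B₀ : Cfg
      B₀ = proj₁ start
      B₀-ok : AtLeast k (X B₀) × B₀ ◁ A
      B₀-ok = proj₁ (proj₂ start) , (λ t → ≤-trans (s≤s (proj₁ (proj₂ (proj₂ start)) t)) (≤-reflexive (s-x⁻ t))) , proj₂ (proj₂ (proj₂ start))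

    greedy : ∀ k A → AtLeast k (X A) → Greedy k A
    greedy zero    A lev = end
    greedy (suc k) A lev = let (B , opt) = optimal k A lev in link opt (greedy k B (Optimal.level opt))

    -- Going round the cycle, an entry larger than all v would grow strictly.
    X-bound : ∀ A m → (∀ t → v A t ≤ m) → ∀ s → X A s ≤ m
    X-bound A m v≤m s with X A s ≤? m
    ... | yes q = q
    ... | no  q with reach s s
    ...   | i , cyc = contradiction (subst (λ t → suc i + X A s ≤ X A t) cyc (grow (suc i) s (≰⇒> q))) (m+1+n≰m (X A s) ∘ ≤-trans (≤-reflexive (+-comm (X A s) (suc i))))
      where
      grow : ∀ i s → m < X A s → i + X A s ≤ X A (iterate prev i s)
      grow zero    s lt = ≤-refl
      grow (suc i) s lt = begin
        suc i + X A s                       ≡⟨ +-suc i (X A s) ⟨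
        i + suc (X A s)                     ≤⟨ +-monoʳ-≤ i bigger ⟩
        i + X A (prev s)                    ≤⟨ grow i (prev s) (<-trans lt bigger) ⟩
        X A (iterate prev i (prev s))       ∎
        where
        open ≤-Reasoning
        bigger : X A s < X A (prev s)
        bigger = +-cancelˡ-≤ m _ _ (begin
          m + suc (X A s)                   ≡⟨ +-suc m (X A s) ⟩
          suc m + X A s                     ≤⟨ +-monoˡ-≤ (X A s) lt ⟩
          X A s + X A s                     ≡⟨ cong (X A s +_) (+-identityʳ (X A s)) ⟨
          2 * X A s                         ≤⟨ *-monoˡ-≤ (X A s) 2≤p ⟩
          p * X A s                         ≡⟨ eq A s ⟩
          v A s + X A (prev s)              ≤⟨ +-monoˡ-≤ _ (v≤m s) ⟩
          m + X A (prev s)                  ∎)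

    -- The constant vector `k`, with `(p - 1) k` tokens in each class, starts the minimisation. Here
    -- the weight alone bounds the entries, through `X-bound`.
    best : ∀ k → ∃ λ A → Best k A
    best k =
      let (x , q , min) = argmin P resp P? (W ∘ vec) vec-resp (λ _ → k) (λ t → ≤-refl , m≤n*m k p)
                            (λ _ → W (vec (λ _ → k))) bounded
      in toCfg x (proj₂ ∘ q) , record
           { level   = proj₁ ∘ q
           ; minimal = λ B′ levB′ → ≤-trans (min (X B′) (λ t → levB′ t , ≤-trans (m≤n+m _ (v B′ t)) (≤-reflexive (sym (eq B′ t))))) (≤-reflexive (sym (w-vec B′))) }
      where
      P : Vector → Set
      P f = ∀ t → k ≤ f t × f (prev t) ≤ p * f t
      resp : ∀ {f g} → f ≗ g → P f → P g
      resp f≗g q t rewrite sym (f≗g t) | sym (f≗g (prev t)) = q t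
      P? : ∀ f → Dec (P f)
      P? f = Finₚ.all? (λ t → k ≤? f t ×-dec f (prev t) ≤? p * f t)
      bounded : ∀ f → P f → W (vec f) ≤ W (vec (λ _ → k)) → ∀ i → f i ≤ W (vec (λ _ → k))
      bounded f q le = X-bound (toCfg f (proj₂ ∘ q)) _ (λ t → ≤-trans (i≤F t (vec f t)) (≤-trans (term≤sum (λ t → F t (vec f t)) t) le))

    best-unique : ∀ k A → Best (suc k) A → (g : Greedy (suc k) A) → ∀ A′ → AtLeast (suc k) (X A′) →
                  (c : Chain (suc k) A′) → cost (chain g) < cost c ⊎ weights (chain g) ≡ weights c
    best-unique k A bst g A′ lev′ c with descend (suc k) A A′ 0 lev′ (λ σ π _ → best⇒noBetter {B′ = A′} bst σ π)
    ... | inj₁ (l , d , h)  = inj₁ (strict k (Best.level bst) d h g c)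
    ... | inj₂ (agr , h)    = unique (suc k) (Best.level bst) agr h g c

    Optimum : ℕ → Set
    Optimum k = ∃ λ A → AtLeast (suc k) (X A) × Σ (Chain (suc k) A) λ c₀ →
                ∀ A′ → AtLeast (suc k) (X A′) → (c : Chain (suc k) A′) → cost c₀ < cost c ⊎ weights c₀ ≡ weights c

    optimum : ∀ k → Optimum k
    optimum k = from-best (best (suc k))
      where
      from-best : (∃ λ A → Best (suc k) A) → Optimum k
      from-best (A , bst) = A , Best.level bst , chain g , best-unique k A bst g
        where g = greedy (suc k) A (Best.level bst)

  -- Tokens at positions: classes, counts and weight estimates.

  at-≤ : ∀ {k} (i : Fin k) x j → at i x j ≤ x
  at-≤ i x j with j Finₚ.≟ i
  ... | yes _ = ≤-refl
  ... | no  _ = z≤n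

  sum-zero : ∀ {k} {f : Fin k → ℕ} → (∀ i → f i ≡ 0) → sum f ≡ 0
  sum-zero {zero}  h = refl
  sum-zero {suc k} h = cong₂ _+_ (h fz) (sum-zero (h ∘ fs))

  sum-single : ∀ {k} (f : Fin k → ℕ) i → (∀ j → j ≢ i → f j ≡ 0) → sum f ≡ f i
  sum-single {suc k} f fz     h = trans (cong (f fz +_) (sum-zero (λ i → h (fs i) (λ ())))) (+-identityʳ _)
  sum-single {suc k} f (fs i) h = trans (cong (_+ sum (f ∘ fs)) (h fz (λ ())))
                                    (sum-single (f ∘ fs) i (λ j j≢i → h (fs j) (j≢i ∘ Finₚ.suc-injective)))

  -- Positions l are sorted into e residue classes; position l carries Y l < p tokens of weight p ^ l.
  module Tokens (p : ℕ) (2≤p : 2 ≤ p) (e′ : ℕ) (Y : ℕ → ℕ) (Y<p : ∀ l → Y l < p)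
                (l₀ : ℕ) (Y-pos : ∀ l → l₀ ≤ l → 0 < Y l) where

    e : ℕ
    e = suc e′

    instance
      p≢0 : NonZero p
      p≢0 = >-nonZero (≤-trans (s≤s z≤n) 2≤p)

    cls : ℕ → Fin e
    cls l = l mod e

    toℕ-cls : ∀ l → Fin.toℕ (cls l) ≡ l % e
    toℕ-cls l = Finₚ.toℕ-fromℕ< (m%n<n l e)

    cls-≡ : ∀ l l′ → l % e ≡ l′ % e → cls l ≡ cls l′
    cls-≡ l l′ q = Finₚ.toℕ-injective (trans (toℕ-cls l) (trans q (sym (toℕ-cls l′))))

    cls-≡⁻¹ : ∀ l l′ → cls l ≡ cls l′ → l % e ≡ l′ % e
    cls-≡⁻¹ l l′ q = trans (sym (toℕ-cls l)) (trans (cong Fin.toℕ q) (toℕ-cls l′))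

    cls-toℕ : ∀ t → cls (Fin.toℕ t) ≡ t
    cls-toℕ t = Finₚ.toℕ-injective (trans (toℕ-cls (Fin.toℕ t)) (m<n⇒m%n≡m (Finₚ.toℕ<n t)))

    cls-+e : ∀ l → cls (l + e) ≡ cls l
    cls-+e l = cls-≡ (l + e) l ([m+n]%n≡m%n l e)

    cls-suc : ∀ l l′ → cls l ≡ cls l′ → cls (suc l) ≡ cls (suc l′)
    cls-suc l l′ q = cls-≡ (suc l) (suc l′) (trans (%-distribˡ-+ 1 l e)
                       (trans (cong (λ z → (1 % e + z) % e) (cls-≡⁻¹ l l′ q)) (sym (%-distribˡ-+ 1 l′ e))))

    cls-+ : ∀ l l′ m → cls l ≡ cls l′ → cls (l + m) ≡ cls (l′ + m)
    cls-+ l l′ zero    q = trans (cong cls (+-identityʳ l)) (trans q (cong cls (sym (+-identityʳ l′))))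
    cls-+ l l′ (suc m) q = trans (cong cls (+-suc l m)) (trans (cls-suc (l + m) (l′ + m) (cls-+ l l′ m q)) (cong cls (sym (+-suc l′ m))))

    prev : Fin e → Fin e
    prev t = cls (Fin.toℕ t + e′)

    prev-cls : ∀ l → prev (cls (suc l)) ≡ cls l
    prev-cls l = trans (cls-+ (Fin.toℕ (cls (suc l))) (suc l) e′ (cls-toℕ (cls (suc l)))) (trans (cong cls (sym (+-suc l e′))) (cls-+e l))

    prev-injective : ∀ {s t} → prev s ≡ prev t → s ≡ t
    prev-injective {s} {t} q = trans (sym (back s)) (trans (cls-suc (Fin.toℕ s + e′) (Fin.toℕ t + e′) q) (back t))
      where
      back : ∀ t → cls (suc (Fin.toℕ t + e′)) ≡ t
      back t = trans (cong cls (sym (+-suc (Fin.toℕ t) e′))) (trans (cls-+e (Fin.toℕ t)) (cls-toℕ t))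

    iterate-prev : ∀ m l → iterate prev m (cls (l + m)) ≡ cls l
    iterate-prev zero    l = cong cls (+-identityʳ l)
    iterate-prev (suc m) l = trans (cong (iterate prev m) (trans (cong (prev ∘ cls) (+-suc l m)) (prev-cls (l + m)))) (iterate-prev m l)

    reach : ∀ s t → ∃ λ m → iterate prev (suc m) t ≡ s
    reach s t = m , trans (cong (iterate prev (suc m)) (sym t≡)) (trans (iterate-prev (suc m) (Fin.toℕ s)) (cls-toℕ s))
      where
      m = Fin.toℕ t + (e′ ∸ Fin.toℕ s)
      t≡ : cls (Fin.toℕ s + suc m) ≡ t
      t≡ = trans (cong cls (trans (shuffle (Fin.toℕ s) (Fin.toℕ t) (e′ ∸ Fin.toℕ s))
             (cong (λ z → Fin.toℕ t + suc z) (m+[n∸m]≡n (≤-pred (Finₚ.toℕ<n s))))))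
             (trans (cls-+e (Fin.toℕ t)) (cls-toℕ t))
        where
        shuffle : ∀ a b c → a + suc (b + c) ≡ b + suc (a + c)
        shuffle = solve-∀

    cls-distinct : ∀ l {i m} → i < e → m < e → cls (l + i) ≡ cls (l + m) → i ≡ m
    cls-distinct zero {i} {m} i<e m<e q = trans (sym (m<n⇒m%n≡m i<e)) (trans (cls-≡⁻¹ i m q) (m<n⇒m%n≡m m<e))
    cls-distinct (suc l) {i} {m} i<e m<e q = cls-distinct l i<e m<e (trans (sym (prev-cls (l + i))) (trans (cong prev q) (prev-cls (l + m))))

    hit : ∀ l s → ∃ λ i → i < e × cls (l + i) ≡ s
    hit zero    s = Fin.toℕ s , Finₚ.toℕ<n s , cls-toℕ s
    hit (suc l) s with hit l s
    ... | zero  , _   , q = e′ , ≤-refl , trans (cong cls (sym (+-suc l e′))) (trans (cls-+e l) (trans (cong cls (sym (+-identityʳ l))) q))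
    ... | suc i , lt  , q = i , <-trans (n<1+n i) lt , trans (cong cls (sym (+-suc l i))) q

    count : (ℕ → ℕ) → Fin e → ℕ → ℕ
    count u t zero    = 0
    count u t (suc l) = count u t l + at (cls l) (u l) t

    count-mono : ∀ u t {l l′} → l ≤ l′ → count u t l ≤ count u t l′
    count-mono u t {l} {l′} l≤l′ with m≤n⇒∃[o]m+o≡n l≤l′
    ... | o , refl = go o
      where
      go : ∀ o → count u t l ≤ count u t (l + o)
      go zero    = ≤-reflexive (cong (count u t) (sym (+-identityʳ l)))
      go (suc o) = ≤-trans (go o) (≤-trans (m≤m+n _ _) (≤-reflexive (cong (count u t) (sym (+-suc l o)))))

    n : Fin e → ℕ → ℕ
    n = count Y

    n-const : ∀ t l → t ≢ cls l → n t (suc l) ≡ n t l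
    n-const t l q = trans (cong (n t l +_) (at-other (cls l) (Y l) q)) (+-identityʳ _)

    n-hit : ∀ l → n (cls l) (suc l) ≡ n (cls l) l + Y l
    n-hit l = cong (n (cls l) l +_) (at-same (cls l) (Y l))

    n-suc : ∀ t l → n t (suc l) < n t l + p
    n-suc t l = +-monoʳ-< (n t l) (≤-<-trans (at-≤ (cls l) (Y l) t) (Y<p l))

    -- Among `e` consecutive positions at most one has class `t`, and it carries fewer than `p`
    -- tokens.
    n-period : ∀ t l → n t (l + e) < n t l + p
    n-period t l = bound (upto e ≤-refl)
      where
      State : ℕ → Set
      State m = n t (l + m) ≡ n t l ⊎ ∃ λ i → i < m × cls (l + i) ≡ t × n t (l + m) ≡ n t l + Y (l + i)
      upto : ∀ m → m ≤ e → State m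
      upto zero    _   = inj₁ (cong (n t) (+-identityʳ l))
      upto (suc m) m<e rewrite +-suc l m with t Finₚ.≟ cls (l + m) | upto m (<⇒≤ m<e)
      ... | yes q | inj₁ r = inj₂ (m , ≤-refl , sym q , cong (_+ Y (l + m)) r)
      ... | yes q | inj₂ (i , i<m , ci , r) = contradiction (cls-distinct l (<-trans i<m m<e) m<e (trans ci q)) (<⇒≢ i<m)
      ... | no  q | inj₁ r = inj₁ (trans (+-identityʳ _) r)
      ... | no  q | inj₂ (i , i<m , ci , r) = inj₂ (i , m<n⇒m<1+n i<m , ci , trans (+-identityʳ _) r)
      bound : State e → n t (l + e) < n t l + p
      bound (inj₁ r) = ≤-trans (≤-reflexive (trans (cong suc r) (+-comm 1 (n t l)))) (+-monoʳ-≤ (n t l) (≤-trans (s≤s z≤n) 2≤p))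
      bound (inj₂ (i , _ , _ , r)) = ≤-<-trans (≤-reflexive r) (+-monoʳ-< (n t l) (Y<p (l + i)))

    -- From `l₀` on no position is empty, so each period adds a token to every class.
    n-unbounded : ∀ t i → ∃ λ l → i ≤ n t l
    n-unbounded t i = i * e + l₁ , go i
      where
      m₀ = proj₁ (hit l₀ t)
      l₁ = l₀ + m₀
      go : ∀ i → i ≤ n t (i * e + l₁)
      cls-l : ∀ i → cls (i * e + l₁) ≡ t
      cls-l zero    = proj₂ (proj₂ (hit l₀ t))
      cls-l (suc i) = trans (cong cls (shuffle e (i * e) l₁)) (trans (cls-+e (i * e + l₁)) (cls-l i))
        where
        shuffle : ∀ a b c → a + b + c ≡ b + c + a
        shuffle = solve-∀
      go zero    = z≤n
      go (suc i) = begin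
        suc i                                          ≤⟨ +-mono-≤ (Y-pos (i * e + l₁) (≤-trans (m≤m+n l₀ m₀) (m≤n+m l₁ (i * e)))) (go i) ⟩
        Y (i * e + l₁) + n t (i * e + l₁)              ≡⟨ +-comm (Y (i * e + l₁)) _ ⟩
        n t (i * e + l₁) + Y (i * e + l₁)              ≡⟨ cong (λ s → n s (i * e + l₁) + Y (i * e + l₁)) (cls-l i) ⟨
        n (cls (i * e + l₁)) (i * e + l₁) + Y (i * e + l₁) ≡⟨ n-hit (i * e + l₁) ⟨
        n (cls (i * e + l₁)) (suc (i * e + l₁))        ≡⟨ cong (λ s → n s (suc (i * e + l₁))) (cls-l i) ⟩
        n t (suc (i * e + l₁))                         ≤⟨ count-mono Y t (s≤s (≤-trans (m≤n+m _ e′) (≤-reflexive (sym (+-assoc e′ (i * e) l₁))))) ⟩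
        n t (suc i * e + l₁)                           ∎
        where open ≤-Reasoning

    locate : ∀ t i L → i < n t L → ∃ λ l → n t l ≤ i × i < n t (suc l)
    locate t i (suc L) lt with i <? n t L
    ... | yes q = locate t i L q
    ... | no  q = L , ≮⇒≥ q , lt

    located : ∀ t i → ∃ λ l → n t l ≤ i × i < n t (suc l)
    located t i = locate t i (proj₁ (n-unbounded t (suc i))) (proj₂ (n-unbounded t (suc i)))

    -- The position of token number `i`, counted from 0, when the tokens of class `t` are ordered by
    -- weight.
    pos : Fin e → ℕ → ℕ
    pos t i = proj₁ (located t i)

    pos-≥ : ∀ t i l → n t l ≤ i → l ≤ pos t i
    pos-≥ t i l q = ≮⇒≥ λ lt → <⇒≱ (proj₂ (proj₂ (located t i))) (≤-trans (count-mono Y t lt) q)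

    pos-≤ : ∀ t i l → i < n t (suc l) → pos t i ≤ l
    pos-≤ t i l q = ≮⇒≥ λ lt → <⇒≱ q (≤-trans (count-mono Y t lt) (proj₁ (proj₂ (located t i))))

    cls-pos : ∀ t i → cls (pos t i) ≡ t
    cls-pos t i with t Finₚ.≟ cls (pos t i)
    ... | yes q = sym q
    ... | no  q = contradiction (≤-trans (proj₂ (proj₂ (located t i))) (≤-reflexive (n-const t (pos t i) q)))
                    (≤⇒≯ (proj₁ (proj₂ (located t i))))

    F : Fin e → ℕ → ℕ
    F t zero    = 0
    F t (suc i) = F t i + p ^ pos t i

    F-step : ∀ t l i → n t l ≤ i → F t i + p ^ l ≤ F t (suc i)
    F-step t l i q = +-monoʳ-≤ (F t i) (^-monoʳ-≤ p (pos-≥ t i l q))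

    F-upper : ∀ t l a m → a + m ≤ n t (suc l) → F t (a + m) ≤ F t a + m * p ^ l
    F-upper t l a zero    q = ≤-reflexive (trans (cong (F t) (+-identityʳ a)) (sym (+-identityʳ _)))
    F-upper t l a (suc m) q rewrite +-suc a m = begin
      F t (a + m) + p ^ pos t (a + m)        ≤⟨ +-mono-≤ (F-upper t l a m (≤-trans (n≤1+n _) q)) (^-monoʳ-≤ p (pos-≤ t (a + m) l q)) ⟩
      F t a + m * p ^ l + p ^ l              ≡⟨ shuffle (F t a) (m * p ^ l) (p ^ l) ⟩
      F t a + (p ^ l + m * p ^ l)            ∎
      where
      open ≤-Reasoning
      shuffle : ∀ a b c → a + b + c ≡ a + (c + b)
      shuffle = solve-∀

    F-lower : ∀ t l a m → n t l ≤ a → F t a + m * p ^ l ≤ F t (a + m)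
    F-lower t l a zero    q = ≤-reflexive (trans (+-identityʳ _) (cong (F t) (sym (+-identityʳ a))))
    F-lower t l a (suc m) q rewrite +-suc a m = begin
      F t a + (p ^ l + m * p ^ l)            ≡⟨ shuffle (F t a) (m * p ^ l) (p ^ l) ⟩
      F t a + m * p ^ l + p ^ l              ≤⟨ +-mono-≤ (F-lower t l a m q) (^-monoʳ-≤ p (pos-≥ t (a + m) l (≤-trans q (m≤m+n a m)))) ⟩
      F t (a + m) + p ^ pos t (a + m)        ∎
      where
      open ≤-Reasoning
      shuffle : ∀ a b c → a + (c + b) ≡ a + b + c
      shuffle = solve-∀

    p^-suc : ∀ l → p ^ l + (p ∸ 1) * p ^ l ≡ p ^ suc l
    p^-suc l = trans (cong (_* p ^ l) (m+[n∸m]≡n (≤-trans (s≤s z≤n) 2≤p))) refl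

    Y≤ : ∀ l → Y l ≤ p ∸ 1
    Y≤ l = m+n≤o⇒m≤o∸n (Y l) (≤-trans (≤-reflexive (+-comm (Y l) 1)) (Y<p l))

    F-n-suc : ∀ t l → F t (n t (suc l)) ≤ F t (n t l) + at (cls l) (Y l) t * p ^ l
    F-n-suc t l = F-upper t l (n t l) (at (cls l) (Y l) t) ≤-refl

    -- All tokens below `l` together form the number with base `p` digits `Y 0`, ..., `Y (l - 1)`.
    F-below : ∀ l → sum (λ t → F t (n t l)) < p ^ l
    F-below zero    = s≤s (≤-reflexive (sum-zero {e} (λ t → refl)))
    F-below (suc l) = begin-strict
      sum (λ t → F t (n t (suc l)))                                        ≤⟨ sum-mono-≤ (λ t → F-n-suc t l) ⟩
      sum (λ t → F t (n t l) + at (cls l) (Y l) t * p ^ l)                 ≡⟨ ∑-distrib-+ (λ t → F t (n t l)) (λ t → at (cls l) (Y l) t * p ^ l) ⟩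
      sum (λ t → F t (n t l)) + sum (λ t → at (cls l) (Y l) t * p ^ l)     ≡⟨ cong (sum (λ t → F t (n t l)) +_) (sum-single _ (cls l) (λ j q → cong (_* p ^ l) (at-other (cls l) (Y l) q))) ⟩
      sum (λ t → F t (n t l)) + at (cls l) (Y l) (cls l) * p ^ l           ≡⟨ cong (λ z → sum (λ t → F t (n t l)) + z * p ^ l) (at-same (cls l) (Y l)) ⟩
      sum (λ t → F t (n t l)) + Y l * p ^ l                                <⟨ +-mono-<-≤ (F-below l) (*-monoˡ-≤ (p ^ l) (Y≤ l)) ⟩
      p ^ l + (p ∸ 1) * p ^ l                                              ≡⟨ p^-suc l ⟩
      p ^ suc l                                                            ∎
      where open ≤-Reasoning

    others : Fin e → ℕ → ℕ
    others σ l = sum (λ t → if does (t Finₚ.≟ σ) then 0 else F t (n t l))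

    others≤ : ∀ σ l → others σ l ≤ sum (λ t → F t (n t l))
    others≤ σ l = sum-mono-≤ each
      where
      each : ∀ t → (if does (t Finₚ.≟ σ) then 0 else F t (n t l)) ≤ F t (n t l)
      each t with t Finₚ.≟ σ
      ... | yes _ = z≤n
      ... | no  _ = ≤-refl

    -- Position `l` carries tokens of the omitted class only.
    others-same : ∀ l → others (cls l) (suc l) ≤ others (cls l) l
    others-same l = sum-mono-≤ each
      where
      each : ∀ t → (if does (t Finₚ.≟ cls l) then 0 else F t (n t (suc l))) ≤ (if does (t Finₚ.≟ cls l) then 0 else F t (n t l))
      each t with t Finₚ.≟ cls l
      ... | yes _ = z≤n
      ... | no  q = ≤-reflexive (cong (F t) (+-identityʳ (n t l)))

    others-suc : ∀ σ l → others σ (suc l) ≤ others σ l + (p ∸ 1) * p ^ l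
    others-suc σ l = begin
      others σ (suc l)                                                  ≤⟨ sum-mono-≤ each ⟩
      sum (λ t → o t + at (cls l) (Y l) t * p ^ l)                      ≡⟨ ∑-distrib-+ o (λ t → at (cls l) (Y l) t * p ^ l) ⟩
      sum o + sum (λ t → at (cls l) (Y l) t * p ^ l)                    ≡⟨ cong (sum o +_) (sum-single _ (cls l) (λ j q → cong (_* p ^ l) (at-other (cls l) (Y l) q))) ⟩
      sum o + at (cls l) (Y l) (cls l) * p ^ l                          ≤⟨ +-monoʳ-≤ (sum o) (*-monoˡ-≤ (p ^ l) (≤-trans (at-≤ (cls l) (Y l) (cls l)) (Y≤ l))) ⟩
      sum o + (p ∸ 1) * p ^ l                                           ∎
      where
      open ≤-Reasoning
      o : Fin e → ℕ
      o t = if does (t Finₚ.≟ σ) then 0 else F t (n t l)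
      each : ∀ t → (if does (t Finₚ.≟ σ) then 0 else F t (n t (suc l))) ≤ o t + at (cls l) (Y l) t * p ^ l
      each t with t Finₚ.≟ σ
      ... | yes _ = z≤n
      ... | no  _ = F-n-suc t l

    others-+ : ∀ σ l i → others σ (l + i) + p ^ l ≤ others σ l + p ^ (l + i)
    others-+ σ l zero    rewrite +-identityʳ l = ≤-refl
    others-+ σ l (suc i) rewrite +-suc l i = begin
      others σ (suc (l + i)) + p ^ l                              ≤⟨ +-monoˡ-≤ (p ^ l) (others-suc σ (l + i)) ⟩
      others σ (l + i) + (p ∸ 1) * p ^ (l + i) + p ^ l            ≡⟨ shuffle (others σ (l + i)) _ (p ^ l) ⟩
      others σ (l + i) + p ^ l + (p ∸ 1) * p ^ (l + i)            ≤⟨ +-monoˡ-≤ _ (others-+ σ l i) ⟩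
      others σ l + p ^ (l + i) + (p ∸ 1) * p ^ (l + i)            ≡⟨ +-assoc (others σ l) _ _ ⟩
      others σ l + (p ^ (l + i) + (p ∸ 1) * p ^ (l + i))          ≡⟨ cong (others σ l +_) (p^-suc (l + i)) ⟩
      others σ l + p ^ suc (l + i)                                ∎
      where
      open ≤-Reasoning
      shuffle : ∀ a b c → a + b + c ≡ a + c + b
      shuffle = solve-∀

    excess-0 : ∀ k → excess p e k 0 ≡ 0
    excess-0 zero    = refl
    excess-0 (suc k) = excess-0 k

    -- Induction in steps of `e`, with `l = e + l′`. Position `l′` has the omitted class, which
    -- leaves a room of `p ^ (l′ + 1)`, at least `2 p ^ l′`. One `p ^ l′` pays for the first summand
    -- of `excess`, the other for the induction hypothesis. Below `e` the excess vanishes.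
    F-gap : ∀ k l → others (cls l) l + excess p e k (l ∸ e) < p ^ l
    F-gap zero    l = ≤-<-trans (≤-reflexive (+-identityʳ _)) (≤-<-trans (others≤ (cls l) l) (F-below l))
    F-gap (suc k) l with e ≤? l
    ... | no  q rewrite m≤n⇒m∸n≡0 (≰⇒≥ q) | excess-0 k = ≤-<-trans (≤-reflexive (+-identityʳ _)) (≤-<-trans (others≤ (cls l) l) (F-below l))
    ... | yes q with m≤n⇒∃[o]m+o≡n q
    ...   | l′ , refl rewrite m+n∸m≡n e l′ = +-cancelʳ-< (p ^ suc l′) _ _ (begin-strict
      others σ′ (e + l′) + (P ∸ 1 + ex) + p ^ suc l′         ≡⟨ cong (λ s → others s (e + l′) + (P ∸ 1 + ex) + p ^ suc l′) σ≡ ⟩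
      others σ (e + l′) + (P ∸ 1 + ex) + p ^ suc l′          ≡⟨ shuffle₁ (others σ (e + l′)) (P ∸ 1 + ex) (p ^ suc l′) ⟩
      others σ (e + l′) + p ^ suc l′ + (P ∸ 1 + ex)          ≤⟨ +-monoˡ-≤ (P ∸ 1 + ex) step ⟩
      others σ l′ + p ^ (e + l′) + (P ∸ 1 + ex)              ≡⟨ shuffle₂ (others σ l′) (p ^ (e + l′)) (P ∸ 1) ex ⟩
      (others σ l′ + ex) + (P ∸ 1) + p ^ (e + l′)            <⟨ +-monoˡ-< (p ^ (e + l′)) (+-mono-<-≤ (F-gap k l′) (m∸n≤m P 1)) ⟩
      P + P + p ^ (e + l′)                                   ≡⟨ cong (λ z → P + z + p ^ (e + l′)) (+-identityʳ P) ⟨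
      2 * P + p ^ (e + l′)                                   ≤⟨ +-monoˡ-≤ (p ^ (e + l′)) (*-monoˡ-≤ P 2≤p) ⟩
      p ^ suc l′ + p ^ (e + l′)                              ≡⟨ +-comm (p ^ suc l′) _ ⟩
      p ^ (e + l′) + p ^ suc l′                              ∎)
      where
      open ≤-Reasoning
      P = p ^ l′
      ex = excess p e k (l′ ∸ e)
      σ = cls l′
      σ′ = cls (e + l′)
      σ≡ : σ′ ≡ σ
      σ≡ = trans (cong cls (+-comm e l′)) (cls-+e l′)
      step : others σ (e + l′) + p ^ suc l′ ≤ others σ l′ + p ^ (e + l′)
      step = begin
        others σ (e + l′) + p ^ suc l′          ≡⟨ cong (λ z → others σ z + p ^ suc l′) (cong suc (+-comm e′ l′)) ⟩
        others σ (suc l′ + e′) + p ^ suc l′     ≤⟨ others-+ σ (suc l′) e′ ⟩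
        others σ (suc l′) + p ^ (suc l′ + e′)   ≤⟨ +-mono-≤ (others-same l′) (≤-reflexive (cong (p ^_) (cong suc (+-comm l′ e′)))) ⟩
        others σ l′ + p ^ (e + l′)              ∎
      shuffle₁ : ∀ a b c → a + b + c ≡ a + c + b
      shuffle₁ = solve-∀
      shuffle₂ : ∀ a b c d → a + b + (c + d) ≡ (a + d) + c + b
      shuffle₂ = solve-∀

    open Vectors prev prev-injective reach p 2≤p public
      using (Cfg; cfg; X; v; eq; AtLeast; _◁_; Vector)
    open Chains prev prev-injective reach p 2≤p cls n (λ t → refl) n-const (λ t → count-mono Y t) n-suc n-period n-unbounded
      F F-step F-below F-gap public
      using (W; w; Chain; end; link; weights; cost; Optimum; optimum; F-mono; F-suc)

  -- Base `p` digits.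

  m⊓[n+o] : ∀ m a b → m ⊓ (a + b) ≡ m ⊓ a + (m ∸ a) ⊓ b
  m⊓[n+o] zero    a       b = cong (_⊓ b) (sym (0∸n≡0 a))
  m⊓[n+o] (suc m) zero    b = refl
  m⊓[n+o] (suc m) (suc a) b = cong suc (m⊓[n+o] m a b)

  module Digits (p : ℕ) (2≤p : 2 ≤ p) where

    instance
      p-nz : NonZero p
      p-nz = >-nonZero (≤-trans (s≤s z≤n) 2≤p)

    dig : ℕ → ℕ → ℕ
    dig m zero    = m % p
    dig m (suc l) = dig (m / p) l

    dig<p : ∀ m l → dig m l < p
    dig<p m zero    = m%n<n m p
    dig<p m (suc l) = dig<p (m / p) l

    infix 4 _⊑_
    _⊑_ : ℕ → ℕ → Set
    m ⊑ m′ = ∀ l → dig m l ≤ dig m′ l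

    val : (ℕ → ℕ) → ℕ → ℕ
    val x zero    = 0
    val x (suc L) = x 0 + p * val (x ∘ suc) L

    val-snoc : ∀ x L → val x (suc L) ≡ val x L + x L * p ^ L
    val-snoc x zero    = shuffle (x 0) p
      where
      shuffle : ∀ a b → a + b * 0 ≡ 0 + a * 1
      shuffle = solve-∀
    val-snoc x (suc L) = trans (cong (λ z → x 0 + p * z) (val-snoc (x ∘ suc) L))
                           (shuffle (x 0) p (val (x ∘ suc) L) (x (suc L)) (p ^ L))
      where
      shuffle : ∀ a b c d f → a + b * (c + d * f) ≡ a + b * c + d * (b * f)
      shuffle = solve-∀

    val-+ : ∀ x y L → val (λ l → x l + y l) L ≡ val x L + val y L
    val-+ x y zero    = refl
    val-+ x y (suc L) = trans (cong (λ z → x 0 + y 0 + p * z) (val-+ (x ∘ suc) (y ∘ suc) L))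
                          (shuffle (x 0) (y 0) p (val (x ∘ suc) L) (val (y ∘ suc) L))
      where
      shuffle : ∀ a b c d f → a + b + c * (d + f) ≡ a + c * d + (b + c * f)
      shuffle = solve-∀

    val-cong : ∀ {x y} → x ≗ y → ∀ L → val x L ≡ val y L
    val-cong x≗y zero    = refl
    val-cong x≗y (suc L) = cong₂ (λ a b → a + p * b) (x≗y 0) (val-cong (x≗y ∘ suc) L)

    val-dig : ∀ m L → m < p ^ L → val (dig m) L ≡ m
    val-dig zero    zero    lt = refl
    val-dig (suc m) zero    (s≤s ())
    val-dig m (suc L) lt = trans (cong (λ z → m % p + p * z) (val-dig (m / p) L (m<n*o⇒m/o<n (≤-trans lt (≤-reflexive (*-comm p (p ^ L)))))))
                             (trans (cong (m % p +_) (*-comm p (m / p))) (sym (m≡m%n+[m/n]*n m p)))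

    dig-small : ∀ m l → m < p ^ l → dig m l ≡ 0
    dig-small zero    zero    lt = m<n⇒m%n≡m {n = p} {m = 0} (≤-trans (s≤s z≤n) 2≤p)
    dig-small (suc m) zero    (s≤s ())
    dig-small m (suc l) lt = dig-small (m / p) l (m<n*o⇒m/o<n (≤-trans lt (≤-reflexive (*-comm p (p ^ l)))))

    dig-0 : ∀ l → dig 0 l ≡ 0
    dig-0 zero    = dig-small 0 0 (s≤s z≤n)
    dig-0 (suc l) = trans (cong (λ z → dig z l) (m<n⇒m/n≡0 {0} {p} (≤-trans (s≤s z≤n) 2≤p))) (dig-0 l)

    a+pb%p : ∀ a b → a < p → (a + p * b) % p ≡ a
    a+pb%p a b a<p = trans (cong (λ z → (a + z) % p) (*-comm p b)) (trans ([m+kn]%n≡m%n a b p) (m<n⇒m%n≡m a<p))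

    a+pb/p : ∀ a b → a < p → (a + p * b) / p ≡ b
    a+pb/p a b a<p = trans (cong (λ z → (a + z) / p) (*-comm p b))
      (trans (+-distrib-/-∣ʳ a (n∣m*n b)) (cong₂ _+_ (m<n⇒m/n≡0 a<p) (m*n/n≡m b p)))

    dig-val : ∀ x L → (∀ l → x l < p) → (∀ l → L ≤ l → x l ≡ 0) → ∀ l → dig (val x L) l ≡ x l
    dig-val x zero    x<p x0 l       = trans (dig-0 l) (sym (x0 l z≤n))
    dig-val x (suc L) x<p x0 zero    = a+pb%p (x 0) _ (x<p 0)
    dig-val x (suc L) x<p x0 (suc l) = trans (cong (λ z → dig z l) (a+pb/p (x 0) _ (x<p 0)))
                                         (dig-val (x ∘ suc) L (x<p ∘ suc) (λ l q → x0 (suc l) (s≤s q)) l)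

    m<p^m : ∀ m → m < p ^ m
    m<p^m zero    = s≤s z≤n
    m<p^m (suc m) = begin
      suc (suc m)             ≤⟨ s≤s (m<p^m m) ⟩
      suc (p ^ m)             ≤⟨ +-monoˡ-≤ (p ^ m) (m^n>0 p m) ⟩
      p ^ m + p ^ m           ≡⟨ cong (p ^ m +_) (+-identityʳ (p ^ m)) ⟨
      2 * p ^ m               ≤⟨ *-monoˡ-≤ (p ^ m) 2≤p ⟩
      p ^ suc m               ∎
      where open ≤-Reasoning

    m<p^L : ∀ {m L} → m ≤ L → m < p ^ L
    m<p^L {m} m≤L = <-≤-trans (m<p^m m) (^-monoʳ-≤ p m≤L)

  -- Translation between paths of integers and chains of token counts.

  module Paths (p : ℕ) (2≤p : 2 ≤ p) (e′ : ℕ) where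

    open Digits p 2≤p

    e : ℕ
    e = suc e′

    h : ℕ
    h = p ^ e ∸ 1

    1+h : suc h ≡ p ^ e
    1+h = m+[n∸m]≡n (m^n>0 p e)

    h-pos : 0 < h
    h-pos = m<n⇒0<n∸m (≤-trans 2≤p (≤-trans (≤-reflexive (sym (*-identityʳ p))) (*-monoʳ-≤ p (m^n>0 p e′))))

    instance
      h-nz : NonZero h
      h-nz = >-nonZero h-pos

    infix 4 _⇝_
    record _⇝_ (m m′ : ℕ) : Set where
      constructor step
      field
        less : m < m′
        cong-h : h ∣ m′ ∸ m
        digits : m ⊑ m′

    data IsPath : ℕ → List ℕ → Set where
      []  : ∀ {m} → IsPath m []
      _∷_ : ∀ {m m′ ms} → m ⇝ m′ → IsPath m′ ms → IsPath m (m′ ∷ ms)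

    pcost : List ℕ → ℕ
    pcost []       = 0
    pcost (m ∷ ms) = suc m + pcost ms

    module From (K : ℕ) where

      -- The room left in digit `l` of `K`: adding at most `Y l` there causes no carry.
      Y : ℕ → ℕ
      Y l = p ∸ 1 ∸ dig K l

      dig≤ : ∀ m l → dig m l ≤ p ∸ 1
      dig≤ m l = m+n≤o⇒m≤o∸n (dig m l) (≤-trans (≤-reflexive (+-comm (dig m l) 1)) (dig<p m l))

      p∸1<p : p ∸ 1 < p
      p∸1<p = ≤-reflexive (m+[n∸m]≡n (≤-trans (s≤s z≤n) 2≤p))

      Y<p : ∀ l → Y l < p
      Y<p l = ≤-<-trans (m∸n≤m (p ∸ 1) (dig K l)) p∸1<p

      Y-pos : ∀ l → K ≤ l → 0 < Y l
      Y-pos l K≤l = subst (λ z → 0 < p ∸ 1 ∸ z) (sym (dig-small K l (m<p^L K≤l))) (m<n⇒0<n∸m 2≤p)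

      open Tokens p 2≤p e′ Y Y<p K Y-pos hiding (e)

      ≡ₕ : ℕ → ℕ → Set
      ≡ₕ a b = ∃ λ c → a ≡ b + c * h

      -- As `p ^ e = 1 + h`, exponents of `p` only matter mod `e`.
      pow-≡ₕ : ∀ L → ≡ₕ (p ^ L) (p ^ Fin.toℕ (cls L))
      pow-≡ₕ L = let (c , q) = pow (L / e) in p ^ Fin.toℕ (cls L) * c , (begin
        p ^ L                                                   ≡⟨ cong (p ^_) (m≡m%n+[m/n]*n L e) ⟩
        p ^ (L % e + L / e * e)                                 ≡⟨ cong (λ z → p ^ (z + L / e * e)) (toℕ-cls L) ⟨
        p ^ (Fin.toℕ (cls L) + L / e * e)                       ≡⟨ ^-distribˡ-+-* p (Fin.toℕ (cls L)) (L / e * e) ⟩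
        p ^ Fin.toℕ (cls L) * p ^ (L / e * e)                   ≡⟨ cong (p ^ Fin.toℕ (cls L) *_) q ⟩
        p ^ Fin.toℕ (cls L) * (1 + c * h)                       ≡⟨ shuffle (p ^ Fin.toℕ (cls L)) c h ⟩
        p ^ Fin.toℕ (cls L) + p ^ Fin.toℕ (cls L) * c * h       ∎)
        where
        open ≡-Reasoning
        shuffle : ∀ a b c → a * (1 + b * c) ≡ a + a * b * c
        shuffle = solve-∀
        pow : ∀ i → ∃ λ c → p ^ (i * e) ≡ 1 + c * h
        pow zero    = 0 , refl
        pow (suc i) = let (c , q) = pow i in 1 + c + c * h , (begin
          p ^ (e + i * e)            ≡⟨ ^-distribˡ-+-* p e (i * e) ⟩
          p ^ e * p ^ (i * e)        ≡⟨ cong₂ _*_ (sym 1+h) q ⟩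
          suc h * (1 + c * h)        ≡⟨ shuffle′ h c ⟩
          1 + (1 + c + c * h) * h    ∎)
          where
          shuffle′ : ∀ h c → suc h * (1 + c * h) ≡ 1 + (1 + c + c * h) * h
          shuffle′ = solve-∀

      S₀ : Vector → ℕ
      S₀ g = sum (λ t → p ^ Fin.toℕ t * g t)

      ≡ₕ-+ : ∀ {a b c d} → ≡ₕ a b → ≡ₕ c d → ≡ₕ (a + c) (b + d)
      ≡ₕ-+ {b = b} {d = d} (x , refl) (y , refl) = x + y , shuffle b x h d y
        where
        shuffle : ∀ b x h d y → b + x * h + (d + y * h) ≡ b + d + (x + y) * h
        shuffle = solve-∀

      ≡ₕ-* : ∀ z {a b} → ≡ₕ a b → ≡ₕ (z * a) (z * b)
      ≡ₕ-* z {b = b} (x , refl) = z * x , shuffle z b x h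
        where
        shuffle : ∀ z b x h → z * (b + x * h) ≡ z * b + z * x * h
        shuffle = solve-∀

      ≡ₕ-sum : ∀ {k} {f g : Fin k → ℕ} → (∀ t → ≡ₕ (f t) (g t)) → ≡ₕ (sum f) (sum g)
      ≡ₕ-sum {zero}  q = 0 , refl
      ≡ₕ-sum {suc k} q = ≡ₕ-+ (q fz) (≡ₕ-sum (q ∘ fs))

      val-≡ₕ : ∀ u L → ≡ₕ (val u L) (S₀ (λ t → count u t L))
      val-≡ₕ u zero    = 0 , sym (trans (+-identityʳ _) (sum-zero {e} (λ t → *-zeroʳ (p ^ Fin.toℕ t))))
      val-≡ₕ u (suc L) = subst₂ ≡ₕ (sym (val-snoc u L)) (sym split)
                           (≡ₕ-+ (val-≡ₕ u L) (≡ₕ-* (u L) (pow-≡ₕ L)))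
        where
        split : S₀ (λ t → count u t (suc L)) ≡ S₀ (λ t → count u t L) + u L * p ^ Fin.toℕ (cls L)
        split = trans (sum-cong-≗ (λ t → *-distribˡ-+ (p ^ Fin.toℕ t) (count u t L) (at (cls L) (u L) t)))
          (trans (∑-distrib-+ (λ t → p ^ Fin.toℕ t * count u t L) (λ t → p ^ Fin.toℕ t * at (cls L) (u L) t))
            (cong (S₀ (λ t → count u t L) +_)
              (trans (sum-single _ (cls L) (λ j q → trans (cong (p ^ Fin.toℕ j *_) (at-other (cls L) (u L) q)) (*-zeroʳ (p ^ Fin.toℕ j))))
                (trans (cong (p ^ Fin.toℕ (cls L) *_) (at-same (cls L) (u L))) (*-comm (p ^ Fin.toℕ (cls L)) (u L))))))

      F-≡ₕ : ∀ t i → ≡ₕ (F t i) (p ^ Fin.toℕ t * i)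
      F-≡ₕ t zero    = 0 , sym (trans (+-identityʳ _) (*-zeroʳ (p ^ Fin.toℕ t)))
      F-≡ₕ t (suc i) = subst (≡ₕ (F t (suc i))) (trans (+-comm _ (p ^ Fin.toℕ t)) (sym (*-suc (p ^ Fin.toℕ t) i)))
                         (≡ₕ-+ (F-≡ₕ t i) (subst (λ s → ≡ₕ (p ^ pos t i) (p ^ Fin.toℕ s)) (cls-pos t i) (pow-≡ₕ (pos t i))))

      W-≡ₕ : ∀ g → ≡ₕ (W g) (S₀ g)
      W-≡ₕ g = ≡ₕ-sum (λ t → F-≡ₕ t (g t))

      -- Horner form of the sum of `p ^ i * g (cls (l + i))` over `i < m`. For `m = e` it is the
      -- weight of `g` with the classes rotated by `l`; `R-suc` says that rotation is multiplication
      -- by `p` mod `h`.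
      rs : Vector → ℕ → ℕ → ℕ
      rs g zero    l = 0
      rs g (suc m) l = g (cls l) + p * rs g m (suc l)

      rs-last : ∀ g m l → rs g (suc m) l ≡ rs g m l + p ^ m * g (cls (l + m))
      rs-last g zero    l = trans (shuffle (g (cls l)) p) (cong (λ z → 0 + 1 * g (cls z)) (sym (+-identityʳ l)))
        where
        shuffle : ∀ a b → a + b * 0 ≡ 0 + 1 * a
        shuffle = solve-∀
      rs-last g (suc m) l = trans (cong (λ z → g (cls l) + p * z) (rs-last g m (suc l)))
        (trans (shuffle (g (cls l)) p (rs g m (suc l)) (p ^ m) _) (cong (λ z → g (cls l) + p * rs g m (suc l) + p * p ^ m * g (cls z)) (sym (+-suc l m))))
        where
        shuffle : ∀ a b c d f → a + b * (c + d * f) ≡ a + b * c + b * d * f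
        shuffle = solve-∀

      R : Vector → ℕ → ℕ
      R g = rs g e

      R-suc : ∀ g l → p * R g (suc l) ≡ R g l + h * g (cls l)
      R-suc g l = +-cancelˡ-≡ (g (cls l)) _ _ (begin
        g (cls l) + p * R g (suc l)               ≡⟨ rs-last g e l ⟩
        R g l + p ^ e * g (cls (l + e))           ≡⟨ cong₂ (λ a s → R g l + a * g s) (sym 1+h) (cls-+e l) ⟩
        R g l + suc h * g (cls l)                 ≡⟨ shuffle (R g l) h (g (cls l)) ⟩
        g (cls l) + (R g l + h * g (cls l))       ∎)
        where
        open ≡-Reasoning
        shuffle : ∀ a b c → a + suc b * c ≡ c + (a + b * c)
        shuffle = solve-∀

      rs-cong : ∀ g m l l′ → cls l ≡ cls l′ → rs g m l ≡ rs g m l′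
      rs-cong g zero    l l′ q = refl
      rs-cong g (suc m) l l′ q = cong₂ (λ a b → g a + p * b) q (rs-cong g m (suc l) (suc l′) (cls-suc l l′ q))

      rs-ext : ∀ {g g′} → g ≗ g′ → ∀ m l → rs g m l ≡ rs g′ m l
      rs-ext q zero    l = refl
      rs-ext q (suc m) l = cong₂ (λ a b → a + p * b) (q (cls l)) (rs-ext q m (suc l))

      rs-mono : ∀ {g g′} → (∀ t → g t ≤ g′ t) → ∀ m l → rs g m l ≤ rs g′ m l
      rs-mono q zero    l = z≤n
      rs-mono q (suc m) l = +-mono-≤ (q (cls l)) (*-monoʳ-≤ p (rs-mono q m (suc l)))

      rs-mono-< : ∀ {g g′} → (∀ t → g t ≤ g′ t) → ∀ m l i → i < m → g (cls (l + i)) < g′ (cls (l + i)) → rs g m l < rs g′ m l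
      rs-mono-< q (suc m) l zero    _         lt rewrite +-identityʳ l = +-mono-<-≤ lt (*-monoʳ-≤ p (rs-mono q m (suc l)))
      rs-mono-< q (suc m) l (suc i) (s≤s i<m) lt rewrite +-suc l i = +-mono-≤-< (q (cls l)) (*-monoʳ-< p (rs-mono-< q m (suc l) i i<m lt))

      R-0 : ∀ g → R g 0 ≡ S₀ g
      R-0 g = trans (sym (horner e 0)) (sum-cong-≗ (λ t → cong (λ s → p ^ Fin.toℕ t * g s) (cls-toℕ t)))
        where
        horner : ∀ m l → sum {m} (λ t → p ^ Fin.toℕ t * g (cls (l + Fin.toℕ t))) ≡ rs g m l
        horner zero    l = refl
        horner (suc m) l = cong₂ _+_ (trans (+-identityʳ _) (cong (g ∘ cls) (+-identityʳ l)))
          (trans (sum-cong-≗ {m} (λ t → trans (*-assoc p (p ^ Fin.toℕ t) _) (cong (λ z → p * (p ^ Fin.toℕ t * g (cls z))) (+-suc l (Fin.toℕ t)))))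
            (trans (sym (*-distribˡ-sum {m} p (λ t → p ^ Fin.toℕ t * g (cls (suc l + Fin.toℕ t))))) (cong (p *_) (horner m (suc l)))))

      -- Telescoping `eq` once round the cycle; it identifies `X` as the vector of rotated weights
      -- divided by `h`.
      R-cfg : ∀ A l → R (v A) l ≡ h * X A (prev (cls l))
      R-cfg A l = +-cancelʳ-≡ (x̂ l) _ _ (begin
        R (v A) l + x̂ l              ≡⟨ telescope e l ⟩
        p ^ e * x̂ (l + e)            ≡⟨ cong₂ (λ a s → a * X A (prev s)) (sym 1+h) (cls-+e l) ⟩
        suc h * x̂ l                  ≡⟨ +-comm (x̂ l) _ ⟩
        h * x̂ l + x̂ l                ∎)
        where
        open ≡-Reasoning
        x̂ : ℕ → ℕ
        x̂ l = X A (prev (cls l))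
        telescope : ∀ m l → rs (v A) m l + x̂ l ≡ p ^ m * x̂ (l + m)
        telescope zero    l = trans (cong x̂ (sym (+-identityʳ l))) (sym (*-identityˡ _))
        telescope (suc m) l = begin
          v A (cls l) + p * rs (v A) m (suc l) + x̂ l            ≡⟨ shuffle (v A (cls l)) (p * rs (v A) m (suc l)) (x̂ l) ⟩
          p * rs (v A) m (suc l) + (v A (cls l) + x̂ l)          ≡⟨ cong (p * rs (v A) m (suc l) +_) (eq A (cls l)) ⟨
          p * rs (v A) m (suc l) + p * X A (cls l)              ≡⟨ cong (λ s → p * rs (v A) m (suc l) + p * X A s) (prev-cls l) ⟨
          p * rs (v A) m (suc l) + p * x̂ (suc l)                ≡⟨ *-distribˡ-+ p _ _ ⟨
          p * (rs (v A) m (suc l) + x̂ (suc l))                  ≡⟨ cong (p *_) (telescope m (suc l)) ⟩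
          p * (p ^ m * x̂ (suc l + m))                           ≡⟨ *-assoc p (p ^ m) _ ⟨
          p ^ suc m * x̂ (suc l + m)                             ≡⟨ cong (λ z → p ^ suc m * x̂ z) (+-suc l m) ⟨
          p ^ suc m * x̂ (l + suc m)                             ∎
          where
          shuffle : ∀ a b c → a + b + c ≡ b + (a + c)
          shuffle = solve-∀

      h∣w : ∀ A → h ∣ w A
      h∣w A = let (c , q) = W-≡ₕ (v A) in
        subst (h ∣_) (sym q) (∣m∣n⇒∣m+n (subst (h ∣_) (trans (sym (R-cfg A 0)) (R-0 (v A))) (∣m⇒∣m*n (X A (prev (cls 0))) ∣-refl)) (n∣m*n c))

      sum-mono-<F : ∀ {g g′ : Vector} → (∀ t → g t ≤ g′ t) → ∀ s → g s < g′ s → W g < W g′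
      sum-mono-<F {g} {g′} q s lt = begin-strict
        W g                               <⟨ ≤-reflexive (+-comm 1 (W g)) ⟩
        W g + 1                           ≤⟨ sum-gain s 1 {h = λ _ → 0} at-s (λ t _ → ≤-trans (F-mono t (q t)) (m≤m+n _ 0)) ⟩
        W g′ + sum {e} (λ _ → 0)          ≡⟨ trans (cong (W g′ +_) (sum-zero {e} (λ _ → refl))) (+-identityʳ _) ⟩
        W g′                              ∎
        where
        open ≤-Reasoning
        at-s : F s (g s) + 1 ≤ F s (g′ s) + 0
        at-s = ≤-trans (≤-reflexive (+-comm _ 1)) (≤-trans (F-suc s (g s)) (≤-trans (F-mono s lt) (m≤m+n _ 0)))

      -- The token counts determine `X` by `R-cfg`, so they cannot coincide, and some class pays for
      -- a further token.
      ◁⇒w< : ∀ {B A} → B ◁ A → w B < w A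
      ◁⇒w< {B} {A} (X< , v≤) with Finₚ.any? (λ t → v B t <? v A t)
      ... | yes (s , lt) = sum-mono-<F v≤ s lt
      ... | no none = contradiction (*-cancelˡ-≡ _ _ h same) (<⇒≢ (X< (prev (cls 0))))
        where
        same : h * X B (prev (cls 0)) ≡ h * X A (prev (cls 0))
        same = trans (sym (R-cfg B 0)) (trans (rs-ext (λ t → ≤-antisym (v≤ t) (≮⇒≥ (λ lt → none (t , lt)))) e 0) (R-cfg A 0))

      -- How many tokens at position `l` are among the `g (cls l)` lightest of their class.
      low : Vector → ℕ → ℕ
      low g l = (g (cls l) ∸ n (cls l) l) ⊓ Y l

      low-val : ∀ g L → sum (λ t → F t (g t ⊓ n t L)) ≡ val (low g) L
      low-val g zero    = sum-zero {e} (λ t → cong (F t) (⊓-zeroʳ (g t)))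
      low-val g (suc L) = begin
        sum (λ t → F t (g t ⊓ n t (suc L)))                             ≡⟨ sum-cong-≗ each ⟩
        sum (λ t → F t (g t ⊓ n t L) + m t * p ^ L)                     ≡⟨ ∑-distrib-+ (λ t → F t (g t ⊓ n t L)) (λ t → m t * p ^ L) ⟩
        sum (λ t → F t (g t ⊓ n t L)) + sum (λ t → m t * p ^ L)         ≡⟨ cong₂ _+_ (low-val g L) (sum-single _ (cls L) off) ⟩
        val (low g) L + m (cls L) * p ^ L                               ≡⟨ cong (λ z → val (low g) L + (g (cls L) ∸ n (cls L) L) ⊓ z * p ^ L) (at-same (cls L) (Y L)) ⟩
        val (low g) L + low g L * p ^ L                                 ≡⟨ val-snoc (low g) L ⟨
        val (low g) (suc L)                                             ∎
        where
        open ≡-Reasoning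
        m : Vector
        m t = (g t ∸ n t L) ⊓ at (cls L) (Y L) t
        off : ∀ j → j ≢ cls L → m j * p ^ L ≡ 0
        off j q = cong (_* p ^ L) (trans (cong ((g j ∸ n j L) ⊓_) (at-other (cls L) (Y L) q)) (⊓-zeroʳ _))
        each : ∀ t → F t (g t ⊓ n t (suc L)) ≡ F t (g t ⊓ n t L) + m t * p ^ L
        each t with n t L ≤? g t
        ... | yes q = trans (cong (F t) split) (≤-antisym
                        (F-upper t L (g t ⊓ n t L) (m t) (≤-trans (≤-reflexive (sym split)) (m⊓n≤n (g t) _)))
                        (F-lower t L (g t ⊓ n t L) (m t) (≤-reflexive (sym (m≥n⇒m⊓n≡n q)))))
          where
          split : g t ⊓ n t (suc L) ≡ g t ⊓ n t L + m t
          split = m⊓[n+o] (g t) (n t L) (at (cls L) (Y L) t)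
        ... | no  q = trans (cong (F t) (trans (m≤n⇒m⊓n≡m (≤-trans (≰⇒≥ q) (m≤m+n _ _))) (sym (m≤n⇒m⊓n≡m (≰⇒≥ q)))))
                        (sym (trans (cong (λ z → F t (g t ⊓ n t L) + z ⊓ at (cls L) (Y L) t * p ^ L) (m≤n⇒m∸n≡0 (≰⇒≥ q))) (+-identityʳ _)))

      bound : Vector → ℕ
      bound g = K + sum (λ t → proj₁ (n-unbounded t (g t)))

      bound-ok : ∀ g t → g t ≤ n t (bound g)
      bound-ok g t = ≤-trans (proj₂ (n-unbounded t (g t)))
        (count-mono Y t (≤-trans (term≤sum (λ t → proj₁ (n-unbounded t (g t))) t) (m≤n+m _ K)))

      K+W : ∀ g l → dig (K + W g) l ≡ dig K l + low g l
      K+W g l = trans (cong (λ z → dig z l) (sym K+W≡)) (dig-val y L y<p y≡0 l)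
        where
        L = bound g
        y : ℕ → ℕ
        y l = dig K l + low g l
        K+W≡ : val y L ≡ K + W g
        K+W≡ = trans (val-+ (dig K) (low g) L)
          (cong₂ _+_ (val-dig K L (m<p^L (m≤m+n K _)))
            (trans (sym (low-val g L)) (sum-cong-≗ (λ t → cong (F t) (m≤n⇒m⊓n≡m (bound-ok g t))))))
        y<p : ∀ l → y l < p
        y<p l = ≤-<-trans (≤-trans (+-monoʳ-≤ (dig K l) (m⊓n≤n _ (Y l))) (≤-reflexive (m+[n∸m]≡n (dig≤ K l)))) p∸1<p
        y≡0 : ∀ l → L ≤ l → y l ≡ 0
        y≡0 l L≤l = cong₂ _+_ (dig-small K l (m<p^L (≤-trans (m≤m+n K _) L≤l)))
          (cong (_⊓ Y l) (m≤n⇒m∸n≡0 (≤-trans (bound-ok g (cls l)) (count-mono Y (cls l) L≤l))))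

      ◁⇒⇝ : ∀ {B A} → B ◁ A → K + w B ⇝ K + w A
      ◁⇒⇝ {B} {A} B◁A = step (+-monoʳ-< K (◁⇒w< {B} {A} B◁A))
        (subst (h ∣_) (sym ([m+n]∸[m+o]≡n∸o K (w A) (w B)))
          (∣m+n∣m⇒∣n (subst (h ∣_) (sym (m+[n∸m]≡n (<⇒≤ (◁⇒w< {B} {A} B◁A)))) (h∣w A)) (h∣w B)))
        (λ l → subst₂ _≤_ (sym (K+W (v B) l)) (sym (K+W (v A) l))
          (+-monoʳ-≤ (dig K l) (⊓-monoˡ-≤ (Y l) (∸-monoˡ-≤ (n (cls l) l) (proj₂ B◁A (cls l))))))

      zeroCfg : Cfg
      zeroCfg = cfg (λ _ → 0) (λ _ → 0) (λ t → *-zeroʳ p)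

      -- A chain lists its levels from the top and a path begins next to `K`, hence the reversed
      -- append.
      nodes : List ℕ → List ℕ → List ℕ
      nodes us ms = map (K +_) us ʳ++ ms

      fromChain : ∀ {j A} → AtLeast (suc j) (X A) → (c : Chain (suc j) A) → ∀ {ms} → IsPath (K + w A) ms → IsPath K (nodes (weights c) ms)
      fromChain {zero}  {A} lev (link _ _ end) ps = subst (_⇝ K + w A) K+0 (◁⇒⇝ {zeroCfg} {A} (lev , λ t → z≤n)) ∷ ps
        where
        K+0 : K + w zeroCfg ≡ K
        K+0 = trans (cong (K +_) (sum-zero {e} (λ t → refl))) (+-identityʳ K)
      fromChain {suc j} {A} lev (link {B = B} levB B◁A c) ps = fromChain levB c (◁⇒⇝ {B} {A} B◁A ∷ ps)

      record Above (m : ℕ) : Set where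
        field
          ge     : K ≤ m
          cong-h : h ∣ m ∸ K
          digits : K ⊑ m

      module Cfgs {m : ℕ} (ab : Above m) where
        open Above ab

        u : ℕ → ℕ
        u l = dig m l ∸ dig K l

        u≤Y : ∀ l → u l ≤ Y l
        u≤Y l = ∸-monoˡ-≤ (dig K l) (dig≤ m l)

        K+val : ∀ L → m ≤ L → K + val u L ≡ m
        K+val L m≤L = trans (cong (_+ val u L) (sym (val-dig K L (m<p^L (≤-trans ge m≤L)))))
          (trans (sym (val-+ (dig K) u L)) (trans (val-cong (λ l → m+[n∸m]≡n (digits l)) L) (val-dig m L (m<p^L m≤L))))

        g : Vector
        g t = count u t m

        -- Rotation 0 is the weight of `m - K` up to multiples of `h`. The others follow because `p`
        -- is invertible mod `h`, with inverse `p ^ e′`.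
        h∣R : ∀ l → h ∣ R g l
        h∣R zero    = subst (h ∣_) (sym (R-0 g)) (let (c , q) = val-≡ₕ u m in
          ∣m+n∣m⇒∣n (subst (h ∣_) (trans (+-cancelˡ-≡ K _ _ (trans (m+[n∸m]≡n ge) (sym (K+val m ≤-refl)))) (trans q (+-comm _ (c * h)))) cong-h) (n∣m*n c))
        h∣R (suc l) = ∣m+n∣m⇒∣n {m = h * R g (suc l)} (subst (h ∣_) (begin
            p ^ e′ * (p * R g (suc l))             ≡⟨ shuffle (p ^ e′) p (R g (suc l)) ⟩
            p ^ e * R g (suc l)                    ≡⟨ cong (_* R g (suc l)) 1+h ⟨
            suc h * R g (suc l)                    ≡⟨ +-comm (R g (suc l)) _ ⟩
            h * R g (suc l) + R g (suc l)          ∎)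
            (∣n⇒∣m*n (p ^ e′) (subst (h ∣_) (sym (R-suc g l)) (∣m∣n⇒∣m+n (h∣R l) (∣m⇒∣m*n (g (cls l)) ∣-refl)))))
          (∣m⇒∣m*n (R g (suc l)) ∣-refl)
          where
          open ≡-Reasoning
          shuffle : ∀ a b c → a * (b * c) ≡ b * a * c
          shuffle = solve-∀

        Q : ℕ → ℕ
        Q l = quotient (h∣R l)

        Q-eq : ∀ l → R g l ≡ h * Q l
        Q-eq l = trans (Data.Nat.Divisibility._∣_.equality (h∣R l)) (*-comm (Q l) h)

        Q-cls : ∀ l l′ → cls l ≡ cls l′ → Q l ≡ Q l′
        Q-cls l l′ q = *-cancelˡ-≡ _ _ h (trans (sym (Q-eq l)) (trans (rs-cong g e l l′ q) (Q-eq l′)))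

        -- The index is shifted as in `R-cfg`: rotation by `l` gives the entry at the class before
        -- `l`.
        xs : Vector
        xs t = Q (suc (Fin.toℕ t))

        xs-cls : ∀ l → xs (cls l) ≡ Q (suc l)
        xs-cls l = Q-cls (suc (Fin.toℕ (cls l))) (suc l) (cls-suc (Fin.toℕ (cls l)) l (cls-toℕ (cls l)))

        Q-suc : ∀ l → p * Q (suc l) ≡ g (cls l) + Q l
        Q-suc l = *-cancelˡ-≡ _ _ h (begin
          h * (p * Q (suc l))             ≡⟨ shuffle₁ h p (Q (suc l)) ⟩
          p * (h * Q (suc l))             ≡⟨ cong (p *_) (Q-eq (suc l)) ⟨
          p * R g (suc l)                 ≡⟨ R-suc g l ⟩
          R g l + h * g (cls l)           ≡⟨ cong (_+ h * g (cls l)) (Q-eq l) ⟩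
          h * Q l + h * g (cls l)         ≡⟨ shuffle₂ h (Q l) (g (cls l)) ⟩
          h * (g (cls l) + Q l)           ∎)
          where
          open ≡-Reasoning
          shuffle₁ : ∀ a b c → a * (b * c) ≡ b * (a * c)
          shuffle₁ = solve-∀
          shuffle₂ : ∀ a b c → a * b + a * c ≡ a * (c + b)
          shuffle₂ = solve-∀

        config : Cfg
        config = cfg xs g λ t → trans (Q-suc-t t) (cong (g t +_) (sym (xs-prev t)))
          where
          lt : Fin e → ℕ
          lt t = Fin.toℕ t + e′
          cls-lt : ∀ t → cls (suc (lt t)) ≡ t
          cls-lt t = trans (cong cls (sym (+-suc (Fin.toℕ t) e′))) (trans (cls-+e (Fin.toℕ t)) (cls-toℕ t))
          xs-prev : ∀ t → xs (prev t) ≡ Q (suc (lt t))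
          xs-prev t = xs-cls (lt t)
          Q-suc-t : ∀ t → p * xs t ≡ g t + Q (suc (lt t))
          Q-suc-t t = trans (cong (p *_) (trans (cong xs (sym (cls-lt t))) (xs-cls (suc (lt t)))))
                        (trans (Q-suc (suc (lt t))) (cong (λ s → g s + Q (suc (lt t))) (cls-lt t)))

        -- The tokens that lead from `K` to `m` need not be the lightest of their classes, so the
        -- configuration only bounds `m - K` from below.
        F≤val : ∀ L → sum (λ t → F t (count u t L)) ≤ val u L
        F≤val zero    = ≤-reflexive (sum-zero {e} (λ t → refl))
        F≤val (suc L) = begin
          sum (λ t → F t (count u t (suc L)))                                   ≤⟨ sum-mono-≤ (λ t → F-upper t L (count u t L) (at (cls L) (u L) t) (count≤n t (suc L))) ⟩
          sum (λ t → F t (count u t L) + at (cls L) (u L) t * p ^ L)            ≡⟨ ∑-distrib-+ (λ t → F t (count u t L)) (λ t → at (cls L) (u L) t * p ^ L) ⟩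
          sum (λ t → F t (count u t L)) + sum (λ t → at (cls L) (u L) t * p ^ L) ≡⟨ cong (sum (λ t → F t (count u t L)) +_) (trans (sum-single _ (cls L) (λ j q → cong (_* p ^ L) (at-other (cls L) (u L) q))) (cong (_* p ^ L) (at-same (cls L) (u L)))) ⟩
          sum (λ t → F t (count u t L)) + u L * p ^ L                           ≤⟨ +-monoˡ-≤ _ (F≤val L) ⟩
          val u L + u L * p ^ L                                                 ≡⟨ val-snoc u L ⟨
          val u (suc L)                                                         ∎
          where
          open ≤-Reasoning
          at-mono : ∀ t l → at (cls l) (u l) t ≤ at (cls l) (Y l) t
          at-mono t l with t Finₚ.≟ cls l
          ... | yes _ = u≤Y l
          ... | no  _ = z≤n
          count≤n : ∀ t l → count u t l ≤ n t l
          count≤n t zero    = z≤n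
          count≤n t (suc l) = +-mono-≤ (count≤n t l) (at-mono t l)

        w≤ : w config ≤ m ∸ K
        w≤ = ≤-trans (F≤val m) (≤-reflexive (+-cancelˡ-≡ K _ _ (trans (K+val m ≤-refl) (sym (m+[n∸m]≡n ge)))))

      count-mono-u : ∀ {u u′} → (∀ l → u l ≤ u′ l) → ∀ t L → count u t L ≤ count u′ t L
      count-mono-u q t zero    = z≤n
      count-mono-u {u} {u′} q t (suc L) = +-mono-≤ (count-mono-u q t L) at-mono
        where
        at-mono : at (cls L) (u L) t ≤ at (cls L) (u′ L) t
        at-mono with t Finₚ.≟ cls L
        ... | yes _ = q L
        ... | no  _ = z≤n

      count-mono-< : ∀ {u u′} → (∀ l → u l ≤ u′ l) → ∀ L → val u L < val u′ L → ∃ λ t → count u t L < count u′ t L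
      count-mono-< {u} {u′} q (suc L) lt with u L <? u′ L
      ... | yes r = cls L , +-mono-≤-< (count-mono-u q (cls L) L) (subst₂ _<_ (sym (at-same (cls L) (u L))) (sym (at-same (cls L) (u′ L))) r)
      ... | no  r = let (t , s) = count-mono-< q L smaller in t , +-mono-<-≤ s (at-mono t)
        where
        smaller : val u L < val u′ L
        smaller = +-cancelʳ-< (u L * p ^ L) _ _ (≤-trans (subst₂ _<_ (val-snoc u L) (val-snoc u′ L) lt) (+-monoʳ-≤ (val u′ L) (*-monoˡ-≤ (p ^ L) (≮⇒≥ r))))
        at-mono : ∀ t → at (cls L) (u L) t ≤ at (cls L) (u′ L) t
        at-mono t with t Finₚ.≟ cls L
        ... | yes _ = q L
        ... | no  _ = z≤n

      -- Some class gains a token, and every rotation involves every class. So all rotated weights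
      -- grow strictly, and with them all entries of `X`.
      ⇝⇒◁ : ∀ {m m′} (ab : Above m) (ab′ : Above m′) → m ⇝ m′ → Cfgs.config ab ◁ Cfgs.config ab′
      ⇝⇒◁ {m} {m′} ab ab′ (step m<m′ _ ds) = (λ t → X< t) , g≤
        where
        module A = Cfgs ab
        module A′ = Cfgs ab′
        u≤ : ∀ l → A.u l ≤ A′.u l
        u≤ l = ∸-monoˡ-≤ (dig K l) (ds l)
        g≤ : ∀ t → A.g t ≤ A′.g t
        g≤ t = ≤-trans (count-mono A.u t (<⇒≤ m<m′)) (count-mono-u u≤ t m′)
        strict : ∃ λ t → count A.u t m′ < count A′.u t m′
        strict = count-mono-< u≤ m′ (+-cancelˡ-< K _ _ (subst₂ _<_ (sym (A.K+val m′ (<⇒≤ m<m′))) (sym (A′.K+val m′ ≤-refl)) m<m′))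
        R< : ∀ l → R A.g l < R A′.g l
        R< l = let (s , s<) = strict
                   (i , i<e , q) = hit l s
               in rs-mono-< g≤ e l i i<e (subst (λ t → A.g t < A′.g t) (sym q) (≤-<-trans (count-mono A.u s (<⇒≤ m<m′)) s<))
        X< : ∀ t → suc (A.xs t) ≤ A′.xs t
        X< t = *-cancelˡ-< h _ _ (subst₂ _<_ (A.Q-eq (suc (Fin.toℕ t))) (A′.Q-eq (suc (Fin.toℕ t))) (R< (suc (Fin.toℕ t))))

      above-⇝ : ∀ {m m′} → Above m → m ⇝ m′ → Above m′
      above-⇝ {m} {m′} ab (step m<m′ q ds) = record
        { ge     = ≤-trans ge (<⇒≤ m<m′)
        ; cong-h = subst (h ∣_) (+-cancelˡ-≡ K _ _ (trans (sym (+-assoc K (m ∸ K) _)) (trans (cong (_+ (m′ ∸ m)) (m+[n∸m]≡n ge))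
                     (trans (m+[n∸m]≡n (<⇒≤ m<m′)) (sym (m+[n∸m]≡n (≤-trans ge (<⇒≤ m<m′)))))))) (∣m∣n⇒∣m+n cong-h q)
        ; digits = λ l → ≤-trans (digits l) (ds l) }
        where open Above ab

      above-refl : Above K
      above-refl = record { ge = ≤-refl ; cong-h = subst (h ∣_) (sym (n∸n≡0 K)) (h ∣0) ; digits = λ l → ≤-refl }

      -- Each node read becomes the new top of the chain. `done` records the actual increments over
      -- `K` in the order of the chain, to be compared with the possibly smaller weights of the
      -- configurations.
      toChain : ∀ {m j} (ab : Above m) → AtLeast j (X (Cfgs.config ab)) → (c : Chain j (Cfgs.config ab)) →
                ∀ done → Pointwise _≤_ (weights c) done → ∀ {ms} → IsPath m ms →
                ∃ λ us → nodes us [] ≡ nodes done ms × Σ ℕ λ j′ → j′ ≡ length ms + j × Σ Cfg λ A →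
                  AtLeast j′ (X A) × Σ (Chain j′ A) λ c′ → Pointwise _≤_ (weights c′) us
      toChain {j = j} ab lev c done pw []       = done , refl , j , refl , Cfgs.config ab , lev , c , pw
      toChain {m} {j} ab lev c done pw (_∷_ {m′ = m′} {ms} s ps) =
        let (us , q , j′ , r , rest) = toChain {j = suc j} ab′ lev′ (link lev B◁ c) ((m′ ∸ K) ∷ done) (Cfgs.w≤ ab′ ∷ pw) ps
        in us , trans q (cong (λ z → map (K +_) done ʳ++ (z ∷ ms)) (m+[n∸m]≡n (Above.ge ab′))) , j′ , trans r (+-suc (length ms) j) , rest
        where
        ab′ : Above m′
        ab′ = above-⇝ ab s
        B◁ : Cfgs.config ab ◁ Cfgs.config ab′
        B◁ = ⇝⇒◁ ab ab′ s
        lev′ : AtLeast (suc j) (X (Cfgs.config ab′))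
        lev′ t = ≤-trans (s≤s (lev t)) (proj₁ B◁ t)

      listSum : List ℕ → ℕ
      listSum []       = 0
      listSum (x ∷ xs) = x + listSum xs

      pcost-nodes : ∀ us ms → pcost (nodes us ms) ≡ length us * suc K + listSum us + pcost ms
      pcost-nodes []       ms = refl
      pcost-nodes (x ∷ us) ms = trans (pcost-nodes us (K + x ∷ ms)) (shuffle (length us * suc K) (listSum us) K x (pcost ms))
        where
        shuffle : ∀ a b K x c → a + b + (suc (K + x) + c) ≡ suc K + a + (x + b) + c
        shuffle = solve-∀

      length-nodes : ∀ us ms → length (nodes us ms) ≡ length us + length ms
      length-nodes []       ms = refl
      length-nodes (x ∷ us) ms = trans (length-nodes us (K + x ∷ ms)) (+-suc (length us) (length ms))

      weights-length : ∀ {k A} (c : Chain k A) → length (weights c) ≡ k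
      weights-length end          = refl
      weights-length (link _ _ c) = cong suc (weights-length c)

      weights-sum : ∀ {k A} (c : Chain k A) → listSum (weights c) ≡ cost c
      weights-sum end          = refl
      weights-sum {A = A} (link _ _ c) = cong (w A +_) (weights-sum c)

      pointwise-sum : ∀ {ws us} → Pointwise _≤_ ws us → ws ≡ us ⊎ listSum ws < listSum us
      pointwise-sum [] = inj₁ refl
      pointwise-sum {x ∷ ws} {y ∷ us} (le ∷ pw) with x ≟ y | pointwise-sum pw
      ... | yes refl | inj₁ refl = inj₁ refl
      ... | yes refl | inj₂ lt   = inj₂ (+-monoʳ-< x lt)
      ... | no  q    | inj₁ refl = inj₂ (+-monoˡ-< (listSum ws) (≤∧≢⇒< le q))
      ... | no  q    | inj₂ lt   = inj₂ (+-mono-≤-< le lt)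

      pointwise-≤ : ∀ {ws us} → Pointwise _≤_ ws us → listSum ws ≤ listSum us
      pointwise-≤ pw with pointwise-sum pw
      ... | inj₁ refl = ≤-refl
      ... | inj₂ lt   = <⇒≤ lt

      Unique : ℕ → Set
      Unique d = ∃ λ ms₀ → length ms₀ ≡ d × IsPath K ms₀ ×
                 (∀ ms → length ms ≡ d → IsPath K ms → pcost ms₀ < pcost ms ⊎ ms₀ ≡ ms)

      cheaper-nodes : ∀ {k} ws us → length ws ≡ k → length us ≡ k → listSum ws < listSum us →
                      pcost (nodes ws []) < pcost (nodes us [])
      cheaper-nodes {k} ws us len-w len-u lt = begin-strict
        pcost (nodes ws [])                    ≡⟨ pcost-nodes ws [] ⟩
        length ws * suc K + listSum ws + 0     ≡⟨ cong (λ z → z * suc K + listSum ws + 0) (trans len-w (sym len-u)) ⟩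
        length us * suc K + listSum ws + 0     <⟨ +-monoˡ-< 0 (+-monoʳ-< (length us * suc K) lt) ⟩
        length us * suc K + listSum us + 0     ≡⟨ pcost-nodes us [] ⟨
        pcost (nodes us [])                    ∎
        where open ≤-Reasoning

      -- A path that uses lightest tokens on every level is the path of its chain; any other path is
      -- strictly dearer than its chain.
      compareLists : ∀ {k} ws₀ ws us → length ws₀ ≡ k → length us ≡ k → Pointwise _≤_ ws us →
                     listSum ws₀ < listSum ws ⊎ ws₀ ≡ ws →
                     pcost (nodes ws₀ []) < pcost (nodes us []) ⊎ nodes ws₀ [] ≡ nodes us []
      compareLists ws₀ ws us l₁ l₂ pw (inj₁ lt)   = inj₁ (cheaper-nodes ws₀ us l₁ l₂ (<-≤-trans lt (pointwise-≤ pw)))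
      compareLists ws₀ ws us l₁ l₂ pw (inj₂ refl) with pointwise-sum pw
      ... | inj₁ refl = inj₂ refl
      ... | inj₂ lt   = inj₁ (cheaper-nodes ws₀ us l₁ l₂ lt)

      Converted : ℕ → List ℕ → Set
      Converted k ms = ∃ λ us → nodes us [] ≡ ms × Σ Cfg λ A → AtLeast k (X A) × Σ (Chain k A) λ c → Pointwise _≤_ (weights c) us

      convert : ∀ {k ms} → length ms ≡ k → IsPath K ms → Converted k ms
      convert {k} {ms} len ps = fix (toChain {j = 0} above-refl (λ t → z≤n) end [] [] ps)
        where
        fix : (∃ λ us → nodes us [] ≡ ms × Σ ℕ λ j′ → j′ ≡ length ms + 0 × Σ Cfg λ A →
                 AtLeast j′ (X A) × Σ (Chain j′ A) λ c′ → Pointwise _≤_ (weights c′) us) → Converted k ms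
        fix (us , q , j′ , r , rest) = us , q , subst (λ j → Σ Cfg λ A → AtLeast j (X A) × Σ (Chain j A) λ c → Pointwise _≤_ (weights c) us)
                                                  (trans r (trans (+-identityʳ _) len)) rest

      fromOptimum : ∀ k → Optimum k → Unique (suc k)
      fromOptimum k (A , lev , c₀ , opt) = nodes (weights c₀) [] , len₀ , fromChain lev c₀ [] , compare
        where
        len₀ : length (nodes (weights c₀) []) ≡ suc k
        len₀ = trans (length-nodes (weights c₀) []) (trans (+-identityʳ _) (weights-length c₀))
        conclude : ∀ {ms} → length ms ≡ suc k → Converted (suc k) ms →
                   pcost (nodes (weights c₀) []) < pcost ms ⊎ nodes (weights c₀) [] ≡ ms
        conclude len (us , refl , A′ , lev′ , c , pw) =
          compareLists (weights c₀) (weights c) us (weights-length c₀) (trans (sym (+-identityʳ _)) (trans (sym (length-nodes us [])) len)) pw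
            (Sum.map₁ (subst₂ _<_ (sym (weights-sum c₀)) (sym (weights-sum c))) (opt A′ lev′ c))
        compare : ∀ ms → length ms ≡ suc k → IsPath K ms → pcost (nodes (weights c₀) []) < pcost ms ⊎ nodes (weights c₀) [] ≡ ms
        compare ms len ps = conclude len (convert len ps)

      uniquePath : ∀ d → Unique d
      uniquePath zero    = [] , refl , [] , λ { [] _ _ → inj₂ refl }
      uniquePath (suc k) = fromOptimum k (optimum k)

open Combinatorics using (module Digits; module Paths)

-- Finite fields: decidable equality and folds over all elements.

module FieldFacts {c ℓ : Level} (F : FiniteField c ℓ) where
  open FiniteField F
  open import Relation.Binary.Reasoning.Setoid setoid
  open import Algebra.Properties.Ring ring using (-‿involutive; -0#≈0#)

  infix 4 _∈_
  _∈_ : Carrier → List Carrier → Set _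
  x ∈ xs = Any (x ≈_) xs

  Distinct : List Carrier → Set _
  Distinct = AllPairs (λ a b → ¬ (a ≈ b))

  ∈-resp : ∀ {x y xs} → x ≈ y → x ∈ xs → y ∈ xs
  ∈-resp x≈y = Any.map (trans (sym x≈y))

  distinct-∉ : ∀ {a x xs} → Allᴸ (λ b → ¬ (a ≈ b)) xs → x ∈ xs → ¬ (x ≈ a)
  distinct-∉ (a≉ ∷ _)  (here x≈b)  x≈a = a≉ (trans (sym x≈a) x≈b)
  distinct-∉ (_ ∷ a≉)  (there x∈) x≈a = distinct-∉ a≉ x∈ x≈a

  infix 4 _≈?_
  -- Two elements are compared by their places in the duplicate-free enumeration.
  _≈?_ : ∀ x y → Dec (x ≈ y)
  x ≈? y = go elems distinct (complete x) (complete y)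
    where
    go : ∀ xs → Distinct xs → x ∈ xs → y ∈ xs → Dec (x ≈ y)
    go (a ∷ xs) (d ∷ ds) (here x≈a) (here y≈a) = yes (trans x≈a (sym y≈a))
    go (a ∷ xs) (d ∷ ds) (here x≈a) (there y∈) = no λ x≈y → distinct-∉ d y∈ (trans (sym x≈y) x≈a)
    go (a ∷ xs) (d ∷ ds) (there x∈) (here y≈a) = no λ x≈y → distinct-∉ d x∈ (trans x≈y y≈a)
    go (a ∷ xs) (d ∷ ds) (there x∈) (there y∈) = go xs ds x∈ y∈

  *-cancel-0 : ∀ {x y} → ¬ (x ≈ 0#) → x * y ≈ 0# → y ≈ 0#
  *-cancel-0 {x} {y} x≉0 xy≈0 = let (z , xz≈1) = inverse x x≉0 in begin
    y             ≈⟨ *-identityˡ y ⟨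
    1# * y        ≈⟨ *-congʳ xz≈1 ⟨
    (x * z) * y   ≈⟨ *-congʳ (*-comm x z) ⟩
    (z * x) * y   ≈⟨ *-assoc z x y ⟩
    z * (x * y)   ≈⟨ *-congˡ xy≈0 ⟩
    z * 0#        ≈⟨ zeroʳ z ⟩
    0#            ∎

  *-nonzero : ∀ {x y} → ¬ (x ≈ 0#) → ¬ (y ≈ 0#) → ¬ (x * y ≈ 0#)
  *-nonzero x≉0 y≉0 = y≉0 ∘ *-cancel-0 x≉0

  *-cancelˡ : ∀ {x y z} → ¬ (x ≈ 0#) → x * y ≈ x * z → y ≈ z
  *-cancelˡ {x} {y} {z} x≉0 q = begin
    y             ≈⟨ +-identityʳ y ⟨
    y + 0#        ≈⟨ +-congˡ (-‿inverseˡ z) ⟨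
    y + (- z + z) ≈⟨ +-assoc y (- z) z ⟨
    (y + - z) + z ≈⟨ +-congʳ diff ⟩
    0# + z        ≈⟨ +-identityˡ z ⟩
    z             ∎
    where
    diff : y + - z ≈ 0#
    diff = *-cancel-0 x≉0 (begin
      x * (y + - z)       ≈⟨ distribˡ x y (- z) ⟩
      x * y + x * - z     ≈⟨ +-congʳ q ⟩
      x * z + x * - z     ≈⟨ distribˡ x z (- z) ⟨
      x * (z + - z)       ≈⟨ *-congˡ (-‿inverseʳ z) ⟩
      x * 0#              ≈⟨ zeroʳ x ⟩
      0#                  ∎)

  -1≉0 : ¬ (- 1# ≈ 0#)
  -1≉0 q = 1≉0 (trans (sym (-‿involutive 1#)) (trans (-‿cong q) -0#≈0#))

  -- Any commutative monoid is allowed because sums are reindexed by translation and scaling, and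
  -- products by scaling.
  module Folds {g₁ g₂ : Level} (G : CommutativeMonoid g₁ g₂) where
    private module G = CommutativeMonoid G
    open G using (_∙_; ε) renaming (Carrier to C; _≈_ to _≋_)

    fold : List Carrier → (Carrier → C) → C
    fold []       f = ε
    fold (x ∷ xs) f = f x ∙ fold xs f

    Resp : (Carrier → C) → Set _
    Resp f = ∀ {x y} → x ≈ y → f x ≋ f y

    fold-cong : ∀ xs {f g} → (∀ x → f x ≋ g x) → fold xs f ≋ fold xs g
    fold-cong []       q = G.refl
    fold-cong (x ∷ xs) q = G.∙-cong (q x) (fold-cong xs q)

    fold-∙ : ∀ xs f g → fold xs (λ x → f x ∙ g x) ≋ fold xs f ∙ fold xs g
    fold-∙ []       f g = G.sym (G.identityˡ ε)
    fold-∙ (x ∷ xs) f g = G.trans (G.∙-congˡ (fold-∙ xs f g)) (interchange (f x) (g x) (fold xs f) (fold xs g))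
      where open import Algebra.Properties.CommutativeSemigroup G.commutativeSemigroup using (interchange)

    record Extracted (f : Carrier → C) (a : Carrier) (xs : List Carrier) : Set (Level._⊔_ (Level._⊔_ c ℓ) g₂) where
      field
        rest      : List Carrier
        fold-eq   : fold xs f ≋ f a ∙ fold rest f
        distinct′ : Distinct rest
        to        : ∀ {x} → x ∈ xs → x ≈ a ⊎ x ∈ rest
        from      : ∀ {x} → x ∈ rest → x ∈ xs × ¬ (x ≈ a)
        all       : ∀ {b} → Allᴸ (λ y → ¬ (b ≈ y)) xs → Allᴸ (λ y → ¬ (b ≈ y)) rest

    extract : ∀ {f} → Resp f → ∀ a xs → Distinct xs → a ∈ xs → Extracted f a xs
    extract f-resp a (x ∷ xs) (d ∷ ds) (here a≈x) = record
      { rest = xs ; fold-eq = G.∙-congʳ (f-resp (sym a≈x)) ; distinct′ = ds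
      ; to = λ { (here q) → inj₁ (trans q (sym a≈x)) ; (there q) → inj₂ q }
      ; from = λ q → there q , λ q≈a → distinct-∉ d q (trans q≈a a≈x)
      ; all = λ { (_ ∷ ps) → ps } }
    extract {f} f-resp a (x ∷ xs) (d ∷ ds) (there a∈) = record
      { rest = x ∷ rest
      ; fold-eq = G.trans (G.∙-congˡ fold-eq) (x∙yz≈y∙xz (f x) (f a) (fold rest f))
      ; distinct′ = all d ∷ distinct′
      ; to = λ { (here q) → inj₂ (here q) ; (there q) → Sum.map₂ there (to q) }
      ; from = λ { (here q) → here q , λ q≈a → distinct-∉ d a∈ (trans (sym q≈a) q)
                 ; (there q) → there (proj₁ (from q)) , proj₂ (from q) }
      ; all = λ { (px ∷ ps) → px ∷ all ps } }
      where
      open Extracted (extract f-resp a xs ds a∈)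
      open import Algebra.Properties.CommutativeSemigroup G.commutativeSemigroup using (x∙yz≈y∙xz)

    fold-set : ∀ {f} → Resp f → ∀ as bs → Distinct as → Distinct bs →
               (∀ {x} → x ∈ as → x ∈ bs) → (∀ {x} → x ∈ bs → x ∈ as) → fold as f ≋ fold bs f
    fold-set f-resp [] []       _ _ to from = G.refl
    fold-set f-resp [] (b ∷ bs) _ _ to from with from {b} (here refl)
    ... | ()
    fold-set {f} f-resp (a ∷ as) bs (d ∷ ds) dbs to from =
      G.trans (G.∙-congˡ (fold-set f-resp as E.rest ds E.distinct′ to′ from′)) (G.sym E.fold-eq)
      where
      module E = Extracted (extract {f} f-resp a bs dbs (to (here refl)))
      to′ : ∀ {x} → x ∈ as → x ∈ E.rest
      to′ x∈ with E.to (to (there x∈))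
      ... | inj₁ x≈a = contradiction x≈a (distinct-∉ d x∈)
      ... | inj₂ q   = q
      from′ : ∀ {x} → x ∈ E.rest → x ∈ as
      from′ x∈ with from (proj₁ (E.from x∈))
      ... | here x≈a = contradiction x≈a (proj₂ (E.from x∈))
      ... | there q  = q

    fold-map : ∀ φ f xs → fold (map φ xs) f ≡ fold xs (f ∘ φ)
    fold-map φ f []       = ≡.refl
    fold-map φ f (x ∷ xs) = ≡.cong (f (φ x) ∙_) (fold-map φ f xs)

    reindex : ∀ {f} → Resp f → (φ : Carrier → Carrier) → (∀ {x y} → x ≈ y → φ x ≈ φ y) →
              (∀ {x y} → φ x ≈ φ y → x ≈ y) → (∀ y → ∃ λ x → φ x ≈ y) →
              fold elems (f ∘ φ) ≋ fold elems f
    reindex {f} f-resp φ φ-cong φ-inj φ-surj =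
      G.trans (G.reflexive (≡.sym (fold-map φ f elems)))
        (fold-set f-resp (map φ elems) elems (distinct-map elems distinct) distinct (λ {x} _ → complete x)
          (λ {x} _ → let (y , q) = φ-surj x in ∈-resp q (∈-map elems (complete y))))
      where
      all-map : ∀ {a xs} → Allᴸ (λ b → ¬ (a ≈ b)) xs → Allᴸ (λ b → ¬ (φ a ≈ b)) (map φ xs)
      all-map []       = []
      all-map (q ∷ qs) = (q ∘ φ-inj) ∷ all-map qs
      distinct-map : ∀ xs → Distinct xs → Distinct (map φ xs)
      distinct-map []       []       = []
      distinct-map (x ∷ xs) (d ∷ ds) = all-map d ∷ distinct-map xs ds
      ∈-map : ∀ {y} xs → y ∈ xs → φ y ∈ map φ xs
      ∈-map (x ∷ xs) (here q)  = here (φ-cong q)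
      ∈-map (x ∷ xs) (there q) = there (∈-map xs q)

-- Least witnesses, binomial coefficients and finite sums.

least : ∀ {ℓ} (P : ℕ → Set ℓ) → (∀ m → Dec (P m)) → ∀ m → P m → ∃ λ k → P k × (∀ i → i ℕ.< k → ¬ P i)
least P P? m pm = go m pm (<-wellFounded m)
  where
  go : ∀ m → P m → Acc ℕ._<_ m → ∃ λ k → P k × (∀ i → i ℕ.< k → ¬ P i)
  go m pm (acc rs) with ℕₚ.anyUpTo? P? m
  ... | yes (i , i<m , pi) = go i pi (rs i<m)
  ... | no none = m , pm , λ i i<m pi → none (i , i<m , pi)

binomial : ℕ → ℕ → ℕ
binomial n       zero    = 1
binomial zero    (suc k) = 0
binomial (suc n) (suc k) = binomial n k ℕ.+ binomial n (suc k)

binomial-zero : ∀ {n k} → n ℕ.< k → binomial n k ≡ 0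
binomial-zero {zero}  {suc k} _         = ≡.refl
binomial-zero {suc n} {suc k} (s≤s n<k) = ≡.cong₂ ℕ._+_ (binomial-zero n<k) (binomial-zero (ℕₚ.m<n⇒m<1+n n<k))

binomial-diag : ∀ n → binomial n n ≡ 1
binomial-diag zero    = ≡.refl
binomial-diag (suc n) = ≡.cong₂ ℕ._+_ (binomial-diag n) (binomial-zero (ℕₚ.n<1+n n))

binomial-pred : ∀ n → binomial (suc n) n ≡ suc n
binomial-pred zero    = ≡.refl
binomial-pred (suc n) = ≡.trans (≡.cong₂ ℕ._+_ (binomial-pred n) (binomial-diag (suc n))) (ℕₚ.+-comm (suc n) 1)

binomial-1 : ∀ n → binomial n 1 ≡ n
binomial-1 zero    = ≡.refl
binomial-1 (suc n) = ≡.cong suc (binomial-1 n)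

binomial-absorb : ∀ n k → suc k ℕ.* binomial (suc n) (suc k) ≡ suc n ℕ.* binomial n k
binomial-absorb zero    zero    = ≡.refl
binomial-absorb zero    (suc k) = ℕₚ.*-zeroʳ (suc (suc k))
binomial-absorb (suc n) zero    = ≡.trans (ℕₚ.*-identityˡ _) (≡.trans (binomial-1 (suc (suc n))) (≡.sym (ℕₚ.*-identityʳ (suc (suc n)))))
binomial-absorb (suc n) (suc k) = ≡.trans (ℕₚ.*-distribˡ-+ (suc (suc k)) (binomial (suc n) (suc k)) (binomial (suc n) (suc (suc k))))
  (≡.trans (≡.cong₂ ℕ._+_ (≡.cong (binomial (suc n) (suc k) ℕ.+_) (binomial-absorb n k)) (binomial-absorb n (suc k)))
    (shuffle (binomial n k) (binomial n (suc k)) n))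
  where
  shuffle : ∀ a b n → a ℕ.+ b ℕ.+ suc n ℕ.* a ℕ.+ suc n ℕ.* b ≡ suc (suc n) ℕ.* (a ℕ.+ b)
  shuffle = solve-∀

-- (1 - x)^(-s) = Σ multichoose s m x^m.
multichoose : ℕ → ℕ → ℕ
multichoose s       zero    = 1
multichoose zero    (suc m) = 0
multichoose (suc s) (suc m) = multichoose s (suc m) ℕ.+ multichoose (suc s) m

multichoose-binomial : ∀ K m → multichoose (suc K) m ≡ binomial (K ℕ.+ m) K
multichoose-binomial K zero = ≡.sym (≡.trans (≡.cong (λ z → binomial z K) (ℕₚ.+-identityʳ K)) (binomial-diag K))
multichoose-binomial zero    (suc m) = multichoose-binomial zero m
multichoose-binomial (suc K) (suc m) = ≡.trans
  (≡.cong₂ ℕ._+_ (≡.trans (multichoose-binomial K (suc m)) (≡.cong (λ z → binomial z K) (ℕₚ.+-suc K m))) (multichoose-binomial (suc K) m))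
  (≡.cong (λ z → binomial (suc z) (suc K)) (≡.sym (ℕₚ.+-suc K m)))

module Sums {c ℓ : Level} (F : FiniteField c ℓ) where
  open FiniteField F hiding (zero)
  open import Algebra.Properties.CommutativeSemigroup +-commutativeSemigroup using () renaming (interchange to +-interchange)

  Σ< : ℕ → (ℕ → Carrier) → Carrier
  Σ< = sumBelow F

  Σ<-cong : ∀ n {f g : ℕ → Carrier} → (∀ i → i ℕ.< n → f i ≈ g i) → Σ< n f ≈ Σ< n g
  Σ<-cong zero    q = refl
  Σ<-cong (suc n) q = +-cong (Σ<-cong n (λ i i<n → q i (ℕₚ.m<n⇒m<1+n i<n))) (q n (ℕₚ.n<1+n n))

  Σ<-zero : ∀ n {f : ℕ → Carrier} → (∀ i → i ℕ.< n → f i ≈ 0#) → Σ< n f ≈ 0#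
  Σ<-zero zero    q = refl
  Σ<-zero (suc n) q = trans (+-cong (Σ<-zero n (λ i i<n → q i (ℕₚ.m<n⇒m<1+n i<n))) (q n (ℕₚ.n<1+n n))) (+-identityˡ 0#)

  Σ<-+ : ∀ n (f g : ℕ → Carrier) → Σ< n (λ i → f i + g i) ≈ Σ< n f + Σ< n g
  Σ<-+ zero    f g = sym (+-identityˡ 0#)
  Σ<-+ (suc n) f g = trans (+-congʳ (Σ<-+ n f g)) (+-interchange _ _ _ _)

  Σ<-*ˡ : ∀ n a (f : ℕ → Carrier) → Σ< n (λ i → a * f i) ≈ a * Σ< n f
  Σ<-*ˡ zero    a f = sym (zeroʳ a)
  Σ<-*ˡ (suc n) a f = trans (+-congʳ (Σ<-*ˡ n a f)) (sym (distribˡ a _ _))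

  Σ<-first : ∀ n (f : ℕ → Carrier) → Σ< (suc n) f ≈ f 0 + Σ< n (f ∘ suc)
  Σ<-first zero    f = +-comm 0# (f 0)
  Σ<-first (suc n) f = trans (+-congʳ (Σ<-first n f)) (+-assoc _ _ _)

  Σ<-single : ∀ n (f : ℕ → Carrier) j → j ℕ.< n → (∀ i → i ℕ.< n → i ≢ j → f i ≈ 0#) → Σ< n f ≈ f j
  Σ<-single (suc n) f j j<n q with j ℕ.≟ n
  ... | yes ≡.refl = trans (+-congʳ (Σ<-zero n (λ i i<n → q i (ℕₚ.m<n⇒m<1+n i<n) (ℕₚ.<⇒≢ i<n)))) (+-identityˡ _)
  ... | no  j≢n    = trans (+-cong (Σ<-single n f j (ℕₚ.≤∧≢⇒< (ℕₚ.≤-pred j<n) j≢n) (λ i i<n → q i (ℕₚ.m<n⇒m<1+n i<n)))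
                       (q n (ℕₚ.n<1+n n) (j≢n ∘ ≡.sym))) (+-identityʳ _)

-- The characteristic and Lucas' theorem.

module Arithmetic {c ℓ : Level} (F : FiniteField c ℓ) where
  open FiniteField F hiding (zero)
  open FieldFacts F public
  open Sums F public
  open import Relation.Binary.Reasoning.Setoid setoid
  open import Algebra.Solver.Ring.NaturalCoefficients.Default commutativeSemiring using (solve; _:+_; _:*_; _:=_)
  open import Algebra.Properties.CommutativeSemigroup +-commutativeSemigroup using () renaming (interchange to +-interchange)
  open import Algebra.Properties.Group +-group using () renaming (∙-cancelˡ to +-cancelˡ; ∙-cancelʳ to +-cancelʳ)

  private
    _^_ : Carrier → ℕ → Carrier
    _^_ = _^ᶠ_ F

  ι : ℕ → Carrier
  ι zero    = 0#
  ι (suc n) = 1# + ι n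

  ι-+ : ∀ m n → ι (m ℕ.+ n) ≈ ι m + ι n
  ι-+ zero    n = sym (+-identityˡ (ι n))
  ι-+ (suc m) n = trans (+-congˡ (ι-+ m n)) (sym (+-assoc 1# (ι m) (ι n)))

  ι-* : ∀ m n → ι (m ℕ.* n) ≈ ι m * ι n
  ι-* zero    n = sym (zeroˡ (ι n))
  ι-* (suc m) n = begin
    ι (n ℕ.+ m ℕ.* n)       ≈⟨ ι-+ n (m ℕ.* n) ⟩
    ι n + ι (m ℕ.* n)       ≈⟨ +-cong (sym (*-identityˡ (ι n))) (ι-* m n) ⟩
    1# * ι n + ι m * ι n    ≈⟨ distribʳ (ι n) 1# (ι m) ⟨
    (1# + ι m) * ι n        ∎

  ι-≡ : ∀ {m n} → m ≡ n → ι m ≈ ι n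
  ι-≡ q = reflexive (≡.cong ι q)

  ι-1 : ι 1 ≈ 1#
  ι-1 = +-identityʳ 1#

  ^-cong : ∀ {x y} m → x ≈ y → x ^ m ≈ y ^ m
  ^-cong zero    q = refl
  ^-cong (suc m) q = *-cong q (^-cong m q)

  ^-+ : ∀ x m n → x ^ (m ℕ.+ n) ≈ x ^ m * x ^ n
  ^-+ x zero    n = sym (*-identityˡ _)
  ^-+ x (suc m) n = trans (*-congˡ (^-+ x m n)) (sym (*-assoc x (x ^ m) (x ^ n)))

  ^-* : ∀ x y m → (x * y) ^ m ≈ x ^ m * y ^ m
  ^-* x y zero    = sym (*-identityˡ 1#)
  ^-* x y (suc m) = trans (*-congˡ (^-* x y m)) (solve 4 (λ a b c d → (a :* b) :* (c :* d) := (a :* c) :* (b :* d)) refl x y (x ^ m) (y ^ m))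

  ^-nonzero : ∀ {x} m → ¬ (x ≈ 0#) → ¬ (x ^ m ≈ 0#)
  ^-nonzero zero    x≉0 = 1≉0
  ^-nonzero (suc m) x≉0 = *-nonzero x≉0 (^-nonzero m x≉0)

  module Σ⁺ = Folds +-commutativeMonoid
  module Π* = Folds *-commutativeMonoid

  Σᶠ : (Carrier → Carrier) → Carrier
  Σᶠ = Σ⁺.fold elems

  Σᶠ-*ˡ : ∀ a f → Σᶠ (λ x → a * f x) ≈ a * Σᶠ f
  Σᶠ-*ˡ a f = go elems
    where
    go : ∀ xs → Σ⁺.fold xs (λ x → a * f x) ≈ a * Σ⁺.fold xs f
    go []       = sym (zeroʳ a)
    go (x ∷ xs) = trans (+-congˡ (go xs)) (sym (distribˡ a (f x) (Σ⁺.fold xs f)))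

  Σ-translate : ∀ {f} → Σ⁺.Resp f → Σᶠ (λ x → f (x + 1#)) ≈ Σᶠ f
  Σ-translate f-resp = Σ⁺.reindex f-resp (_+ 1#) +-congʳ (λ {x} {y} → +-cancelʳ 1# x y)
    (λ y → y + - 1# , trans (+-assoc y (- 1#) 1#) (trans (+-congˡ (-‿inverseˡ 1#)) (+-identityʳ y)))

  module Scale (g : Carrier) (g≉0 : ¬ (g ≈ 0#)) where
    surj : ∀ y → ∃ λ x → g * x ≈ y
    surj y = let (z , gz≈1) = inverse g g≉0 in z * y , trans (sym (*-assoc g z y)) (trans (*-congʳ gz≈1) (*-identityˡ y))

    Σ-scale : ∀ {f} → Σ⁺.Resp f → Σᶠ (λ x → f (g * x)) ≈ Σᶠ f
    Σ-scale f-resp = Σ⁺.reindex f-resp (g *_) *-congˡ (*-cancelˡ g≉0) surj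

    Π-scale : ∀ {f} → Π*.Resp f → Π*.fold elems (λ x → f (g * x)) ≈ Π*.fold elems f
    Π-scale f-resp = Π*.reindex f-resp (g *_) *-congˡ (*-cancelˡ g≉0) surj

  -- Translation by 1 permutes the field, yet changes the sum of all elements by `Σ 1`.
  Σ-1 : Σᶠ (λ _ → 1#) ≈ 0#
  Σ-1 = +-cancelˡ (Σᶠ id) _ _ (begin
    Σᶠ id + Σᶠ (λ _ → 1#)      ≈⟨ Σ⁺.fold-∙ elems id (λ _ → 1#) ⟨
    Σᶠ (λ x → x + 1#)          ≈⟨ Σ-translate {id} id ⟩
    Σᶠ id                      ≈⟨ +-identityʳ _ ⟨
    Σᶠ id + 0#                 ∎)

  size : ℕ
  size = length elems

  ι-size : ι size ≈ 0#
  ι-size = trans (reflexive (go elems)) Σ-1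
    where
    go : ∀ xs → ι (length xs) ≡ Σ⁺.fold xs (λ _ → 1#)
    go []       = ≡.refl
    go (x ∷ xs) = ≡.cong (1# +_) (go xs)

  size-pos : 0 ℕ.< size
  size-pos with elems | complete 0#
  ... | _ ∷ _ | _ = s≤s z≤n

  abstract
    characteristic : ∃ λ p → (0 ℕ.< p × ι p ≈ 0#) × (∀ i → i ℕ.< p → ¬ (0 ℕ.< i × ι i ≈ 0#))
    characteristic = least (λ m → 0 ℕ.< m × ι m ≈ 0#) (λ m → 0 ℕ.<? m ×-dec ι m ≈? 0#) size (size-pos , ι-size)

  p : ℕ
  p = proj₁ characteristic

  ι-p : ι p ≈ 0#
  ι-p = proj₂ (proj₁ (proj₂ characteristic))

  ι-<p : ∀ {i} → 0 ℕ.< i → i ℕ.< p → ¬ (ι i ≈ 0#)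
  ι-<p 0<i i<p q = proj₂ (proj₂ characteristic) _ i<p (0<i , q)

  2≤p : 2 ℕ.≤ p
  2≤p with p | ι-p | proj₁ (proj₁ (proj₂ characteristic))
  ... | suc zero    | q | _ = contradiction (trans (sym ι-1) q) 1≉0
  ... | suc (suc _) | _ | _ = s≤s (s≤s z≤n)

  open Digits p 2≤p public using (dig; _⊑_; val-dig; p-nz)

  p′ : ℕ
  p′ = p ℕ.∸ 1

  p≡ : suc p′ ≡ p
  p≡ = ℕₚ.m+[n∸m]≡n (ℕₚ.≤-trans (s≤s z≤n) 2≤p)

  β : ℕ → ℕ → Carrier
  β n k = ι (binomial n k)

  β-pascal : ∀ n k → β (suc n) (suc k) ≈ β n k + β n (suc k)
  β-pascal n k = ι-+ (binomial n k) (binomial n (suc k))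

  -- `k C(p, k) = p C(p - 1, k - 1)` vanishes, and `ι k` cancels since `k` is below the
  -- characteristic.
  β-p : ∀ k → 0 ℕ.< k → k ℕ.< p → β p k ≈ 0#
  β-p (suc k) 0<k k<p = *-cancel-0 (ι-<p 0<k k<p) (begin
    ι (suc k) * β p (suc k)                      ≈⟨ ι-* (suc k) (binomial p (suc k)) ⟨
    ι (suc k ℕ.* binomial p (suc k))             ≡⟨ ≡.cong (λ z → ι (suc k ℕ.* binomial z (suc k))) p≡ ⟨
    ι (suc k ℕ.* binomial (suc p′) (suc k))      ≈⟨ ι-≡ (binomial-absorb p′ k) ⟩
    ι (suc p′ ℕ.* binomial p′ k)                 ≡⟨ ≡.cong (λ z → ι (z ℕ.* binomial p′ k)) p≡ ⟩
    ι (p ℕ.* binomial p′ k)                      ≈⟨ ι-* p (binomial p′ k) ⟩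
    ι p * β p′ k                                 ≈⟨ *-congʳ ι-p ⟩
    0# * β p′ k                                  ≈⟨ zeroˡ _ ⟩
    0#                                           ∎)

  mutual
    -- (1 + x)^(n + p) = (1 + x)^n (1 + x^p), coefficient by coefficient
    β-+p-low : ∀ n k → k ℕ.< p → β (n ℕ.+ p) k ≈ β n k
    β-+p-low zero    zero    k<p = refl
    β-+p-low zero    (suc k) k<p = β-p (suc k) (s≤s z≤n) k<p
    β-+p-low (suc n) zero    k<p = refl
    β-+p-low (suc n) (suc k) k<p = trans (β-pascal (n ℕ.+ p) k)
      (trans (+-cong (β-+p-low n k (ℕₚ.<-trans (ℕₚ.n<1+n k) k<p)) (β-+p-low n (suc k) k<p)) (sym (β-pascal n k)))

    β-+p-high : ∀ n k → β (n ℕ.+ p) (k ℕ.+ p) ≈ β n (k ℕ.+ p) + β n k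
    β-+p-high zero zero = trans (ι-≡ (binomial-diag p)) (trans (sym (+-identityˡ _)) (+-congʳ (ι-≡ (≡.sym (binomial-zero {0} {p} (ℕₚ.≤-trans (s≤s z≤n) 2≤p))))))
    β-+p-high zero (suc k) = trans (ι-≡ (binomial-zero {p} {suc k ℕ.+ p} (s≤s (ℕₚ.m≤n+m p k)))) (sym (+-identityʳ 0#))
    β-+p-high (suc n) zero = begin
      β (suc (n ℕ.+ p)) p                               ≡⟨ ≡.cong (β (suc (n ℕ.+ p))) p≡ ⟨
      β (suc (n ℕ.+ p)) (suc p′)                        ≈⟨ β-pascal (n ℕ.+ p) p′ ⟩
      β (n ℕ.+ p) p′ + β (n ℕ.+ p) (suc p′)             ≡⟨ ≡.cong (λ z → β (n ℕ.+ p) p′ + β (n ℕ.+ p) z) p≡ ⟩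
      β (n ℕ.+ p) p′ + β (n ℕ.+ p) p                    ≈⟨ +-cong (β-+p-low n p′ (ℕₚ.≤-reflexive p≡)) (β-+p-high n 0) ⟩
      β n p′ + (β n p + β n 0)                          ≈⟨ +-assoc _ _ _ ⟨
      β n p′ + β n p + β n 0                            ≡⟨ ≡.cong (λ z → β n p′ + β n z + β n 0) p≡ ⟨
      β n p′ + β n (suc p′) + β n 0                     ≈⟨ +-congʳ (β-pascal n p′) ⟨
      β (suc n) (suc p′) + β n 0                        ≡⟨ ≡.cong (λ z → β (suc n) z + β n 0) p≡ ⟩
      β (suc n) p + β (suc n) 0                         ∎
    β-+p-high (suc n) (suc k) = begin
      β (suc (n ℕ.+ p)) (suc (k ℕ.+ p))                                   ≈⟨ β-pascal (n ℕ.+ p) (k ℕ.+ p) ⟩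
      β (n ℕ.+ p) (k ℕ.+ p) + β (n ℕ.+ p) (suc k ℕ.+ p)                   ≈⟨ +-cong (β-+p-high n k) (β-+p-high n (suc k)) ⟩
      (β n (k ℕ.+ p) + β n k) + (β n (suc k ℕ.+ p) + β n (suc k))         ≈⟨ +-interchange _ _ _ _ ⟩
      (β n (k ℕ.+ p) + β n (suc k ℕ.+ p)) + (β n k + β n (suc k))         ≈⟨ +-cong (β-pascal n (k ℕ.+ p)) (β-pascal n k) ⟨
      β (suc n) (suc k ℕ.+ p) + β (suc n) (suc k)                         ∎

  -- Raising `n` by 1 multiplies `(1 + x)^(a + n p)` by `1 + x^p`, which turns into Pascal's rule
  -- for `β n k`.
  lucas : ∀ n k {a b} → a ℕ.< p → b ℕ.< p → β (a ℕ.+ n ℕ.* p) (b ℕ.+ k ℕ.* p) ≈ β n k * β a b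
  lucas zero zero {a} {b} a<p b<p = trans (reflexive (≡.cong₂ β (ℕₚ.+-identityʳ a) (ℕₚ.+-identityʳ b)))
    (sym (trans (*-congʳ ι-1) (*-identityˡ _)))
  lucas zero (suc k) {a} {b} a<p b<p = trans (ι-≡ (≡.trans (≡.cong (λ z → binomial z (b ℕ.+ suc k ℕ.* p)) (ℕₚ.+-identityʳ a))
      (binomial-zero (ℕₚ.<-≤-trans a<p (ℕₚ.≤-trans (ℕₚ.m≤m+n p (k ℕ.* p)) (ℕₚ.m≤n+m _ b))))))
    (sym (zeroˡ _))
  lucas (suc n) zero {a} {b} a<p b<p = begin
    β (a ℕ.+ (p ℕ.+ n ℕ.* p)) (b ℕ.+ 0)      ≡⟨ ≡.cong₂ β (shuffle a p (n ℕ.* p)) (ℕₚ.+-identityʳ b) ⟩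
    β (a ℕ.+ n ℕ.* p ℕ.+ p) b                ≈⟨ β-+p-low (a ℕ.+ n ℕ.* p) b b<p ⟩
    β (a ℕ.+ n ℕ.* p) b                      ≡⟨ ≡.cong (β (a ℕ.+ n ℕ.* p)) (ℕₚ.+-identityʳ b) ⟨
    β (a ℕ.+ n ℕ.* p) (b ℕ.+ 0)              ≈⟨ lucas n zero a<p b<p ⟩
    β n 0 * β a b                            ∎
    where
    shuffle : ∀ a b c → a ℕ.+ (b ℕ.+ c) ≡ a ℕ.+ c ℕ.+ b
    shuffle = solve-∀
  lucas (suc n) (suc k) {a} {b} a<p b<p = begin
    β (a ℕ.+ (p ℕ.+ n ℕ.* p)) (b ℕ.+ (p ℕ.+ k ℕ.* p))                            ≡⟨ ≡.cong₂ β (shuffle a p (n ℕ.* p)) (shuffle b p (k ℕ.* p)) ⟩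
    β (a ℕ.+ n ℕ.* p ℕ.+ p) (b ℕ.+ k ℕ.* p ℕ.+ p)                                ≈⟨ β-+p-high (a ℕ.+ n ℕ.* p) (b ℕ.+ k ℕ.* p) ⟩
    β (a ℕ.+ n ℕ.* p) (b ℕ.+ k ℕ.* p ℕ.+ p) + β (a ℕ.+ n ℕ.* p) (b ℕ.+ k ℕ.* p)  ≡⟨ ≡.cong (λ z → β (a ℕ.+ n ℕ.* p) z + β (a ℕ.+ n ℕ.* p) (b ℕ.+ k ℕ.* p)) (shuffle b p (k ℕ.* p)) ⟨
    β (a ℕ.+ n ℕ.* p) (b ℕ.+ suc k ℕ.* p) + β (a ℕ.+ n ℕ.* p) (b ℕ.+ k ℕ.* p)    ≈⟨ +-cong (lucas n (suc k) a<p b<p) (lucas n k a<p b<p) ⟩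
    β n (suc k) * β a b + β n k * β a b                                          ≈⟨ distribʳ (β a b) _ _ ⟨
    (β n (suc k) + β n k) * β a b                                                ≈⟨ *-congʳ (trans (+-comm _ _) (sym (β-pascal n k))) ⟩
    β (suc n) (suc k) * β a b                                                    ∎
    where
    shuffle : ∀ a b c → a ℕ.+ (b ℕ.+ c) ≡ a ℕ.+ c ℕ.+ b
    shuffle = solve-∀

  -- Absorption writes `C(a + 1, b + 1)` times `b + 1` as `a + 1` times `C(a, b)`, and `ι (a + 1)`
  -- is nonzero below the characteristic.
  β-small : ∀ {a b} → b ℕ.≤ a → a ℕ.< p → ¬ (β a b ≈ 0#)
  β-small {a}     {zero}  _         a<p q = 1≉0 (trans (sym ι-1) q)
  β-small {suc a} {suc b} (s≤s b≤a) a<p q = *-nonzero (ι-<p (s≤s z≤n) a<p) (β-small b≤a (ℕₚ.<-trans (ℕₚ.n<1+n a) a<p)) (begin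
    ι (suc a) * β a b                   ≈⟨ ι-* (suc a) (binomial a b) ⟨
    ι (suc a ℕ.* binomial a b)          ≡⟨ ≡.cong ι (binomial-absorb a b) ⟨
    ι (suc b ℕ.* binomial (suc a) (suc b)) ≈⟨ ι-* (suc b) (binomial (suc a) (suc b)) ⟩
    ι (suc b) * β (suc a) (suc b)       ≈⟨ *-congˡ q ⟩
    ι (suc b) * 0#                      ≈⟨ zeroʳ _ ⟩
    0#                                  ∎)

  β-digits : ∀ n k → β n k ≈ β (n / p) (k / p) * β (n % p) (k % p)
  β-digits n k = trans (reflexive (≡.cong₂ β (m≡m%n+[m/n]*n n p) (m≡m%n+[m/n]*n k p))) (lucas (n / p) (k / p) (m%n<n n p) (m%n<n k p))

  β-≉0⇒⊑ : ∀ n k → ¬ (β n k ≈ 0#) → k ⊑ n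
  β-≉0⇒⊑ n k β≉0 zero = ℕₚ.≮⇒≥ λ lt → β≉0 (trans (β-digits n k) (trans (*-congˡ (ι-≡ (binomial-zero lt))) (zeroʳ _)))
  β-≉0⇒⊑ n k β≉0 (suc l) = β-≉0⇒⊑ (n / p) (k / p) (λ q → β≉0 (trans (β-digits n k) (trans (*-congʳ q) (zeroˡ _)))) l

  ⊑⇒β-≉0 : ∀ L n k → n ℕ.< p ℕ.^ L → k ℕ.< p ℕ.^ L → k ⊑ n → ¬ (β n k ≈ 0#)
  ⊑⇒β-≉0 zero    zero zero _ _ _ q = 1≉0 (trans (sym ι-1) q)
  ⊑⇒β-≉0 zero    (suc n) k (s≤s ())
  ⊑⇒β-≉0 zero    zero (suc k) _ (s≤s ())
  ⊑⇒β-≉0 (suc L) n k n< k< k⊑n q =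
    *-nonzero (⊑⇒β-≉0 L (n / p) (k / p) (smaller n n<) (smaller k k<) (k⊑n ∘ suc)) (β-small (k⊑n 0) (m%n<n n p)) (trans (sym (β-digits n k)) q)
    where
    smaller : ∀ n → n ℕ.< p ℕ.^ suc L → n / p ℕ.< p ℕ.^ L
    smaller n n< = m<n*o⇒m/o<n (ℕₚ.≤-trans n< (ℕₚ.≤-reflexive (ℕₚ.*-comm p (p ℕ.^ L))))

  ι-0⇒p∣ : ∀ m → ι m ≈ 0# → p ∣ m
  ι-0⇒p∣ m q = m%n≡0⇒n∣m m p (small (m % p) (m%n<n m p) (begin
    ι (m % p)                              ≈⟨ +-identityʳ _ ⟨
    ι (m % p) + 0#                         ≈⟨ +-congˡ (trans (*-congˡ ι-p) (zeroʳ _)) ⟨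
    ι (m % p) + ι (m / p) * ι p            ≈⟨ +-congˡ (ι-* (m / p) p) ⟨
    ι (m % p) + ι (m / p ℕ.* p)            ≈⟨ ι-+ (m % p) (m / p ℕ.* p) ⟨
    ι (m % p ℕ.+ m / p ℕ.* p)              ≡⟨ ≡.cong ι (m≡m%n+[m/n]*n m p) ⟨
    ι m                                    ≈⟨ q ⟩
    0#                                     ∎))
    where
    small : ∀ i → i ℕ.< p → ι i ≈ 0# → i ≡ 0
    small zero    _   _ = ≡.refl
    small (suc i) i<p r = contradiction r (ι-<p (s≤s z≤n) i<p)

  -- The exponent of the multiplicative group and the power sums of the field.

  unit : Carrier → Carrier
  unit x = if does (x ≈? 0#) then 1# else x

  unit-resp : ∀ {x y} → x ≈ y → unit x ≈ unit y
  unit-resp {x} {y} x≈y with x ≈? 0# | y ≈? 0#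
  ... | yes _ | yes _ = refl
  ... | no  _ | no  _ = x≈y
  ... | yes q | no  r = contradiction (trans (sym x≈y) q) r
  ... | no  q | yes r = contradiction (trans x≈y r) q

  unit-nonzero : ∀ x → ¬ (unit x ≈ 0#)
  unit-nonzero x with x ≈? 0#
  ... | yes _ = 1≉0
  ... | no  q = q

  nonzeros : List Carrier → ℕ
  nonzeros []       = 0
  nonzeros (x ∷ xs) = (if does (x ≈? 0#) then 0 else 1) ℕ.+ nonzeros xs

  nonzeros-pos : ∀ {xs x} → ¬ (x ≈ 0#) → x ∈ xs → 0 ℕ.< nonzeros xs
  nonzeros-pos {y ∷ ys} x≉0 (here x≈y) with y ≈? 0#
  ... | yes q = contradiction (trans x≈y q) x≉0
  ... | no  _ = s≤s z≤n
  nonzeros-pos {y ∷ ys} x≉0 (there q) = ℕₚ.≤-trans (nonzeros-pos x≉0 q) (ℕₚ.m≤n+m _ _)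

  -- Multiplication by g permutes the nonzero elements.
  fermat : ∀ g → ¬ (g ≈ 0#) → g ^ nonzeros elems ≈ 1#
  fermat g g≉0 = *-cancelˡ (Π-nonzero elems) (begin
    Π*.fold elems unit * g ^ nonzeros elems             ≈⟨ *-congˡ (scale-fold elems) ⟨
    Π*.fold elems unit * Π*.fold elems scale            ≈⟨ Π*.fold-∙ elems unit scale ⟨
    Π*.fold elems (λ x → unit x * scale x)              ≈⟨ Π*.fold-cong elems unit-scale ⟨
    Π*.fold elems (λ x → unit (g * x))                  ≈⟨ Scale.Π-scale g g≉0 {unit} unit-resp ⟩
    Π*.fold elems unit                                  ≈⟨ *-identityʳ _ ⟨
    Π*.fold elems unit * 1#                             ∎)
    where
    scale : Carrier → Carrier
    scale x = if does (x ≈? 0#) then 1# else g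
    Π-nonzero : ∀ xs → ¬ (Π*.fold xs unit ≈ 0#)
    Π-nonzero []       = 1≉0
    Π-nonzero (x ∷ xs) = *-nonzero (unit-nonzero x) (Π-nonzero xs)
    scale-fold : ∀ xs → Π*.fold xs scale ≈ g ^ nonzeros xs
    scale-fold [] = refl
    scale-fold (x ∷ xs) with x ≈? 0#
    ... | yes _ = trans (*-identityˡ _) (scale-fold xs)
    ... | no  _ = *-congˡ (scale-fold xs)
    unit-scale : ∀ x → unit (g * x) ≈ unit x * scale x
    unit-scale x with g * x ≈? 0# | x ≈? 0#
    ... | yes _ | yes _ = sym (*-identityˡ 1#)
    ... | no  _ | no  _ = *-comm g x
    ... | yes q | no  r = contradiction (*-cancel-0 g≉0 q) r
    ... | no  q | yes r = contradiction (trans (*-congˡ r) (zeroʳ g)) q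

  -- The exponent h of the multiplicative group plays the role of q - 1. That h + 1 is a power of p is
  -- extracted from the power sums below, so neither cyclicity nor the order of the field is needed.
  Exponent : ℕ → Set (c Level.⊔ ℓ)
  Exponent m = 0 ℕ.< m × Allᴸ (λ x → x ≈ 0# ⊎ x ^ m ≈ 1#) elems

  abstract
    exponent : ∃ λ h → Exponent h × (∀ i → i ℕ.< h → ¬ Exponent i)
    exponent = least Exponent (λ m → 0 ℕ.<? m ×-dec Allᴸ.all? (λ x → x ≈? 0# ⊎-dec x ^ m ≈? 1#) elems)
      (nonzeros elems) (nonzeros-pos 1≉0 (complete 1#) , Allᴸ.tabulate each)
      where
      each : ∀ {x} → x ∈≡ elems → x ≈ 0# ⊎ x ^ nonzeros elems ≈ 1#
      each {x} _ with x ≈? 0#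
      ... | yes q = inj₁ q
      ... | no  q = inj₂ (fermat x q)

  h : ℕ
  h = proj₁ exponent

  h-pos : 0 ℕ.< h
  h-pos = proj₁ (proj₁ (proj₂ exponent))

  instance
    h-nonZero : NonZero h
    h-nonZero = ℕ.>-nonZero h-pos

  ^h≈1 : ∀ x → ¬ (x ≈ 0#) → x ^ h ≈ 1#
  ^h≈1 x x≉0 = go elems (proj₂ (proj₁ (proj₂ exponent))) (complete x)
    where
    go : ∀ xs → Allᴸ (λ x → x ≈ 0# ⊎ x ^ h ≈ 1#) xs → x ∈ xs → x ^ h ≈ 1#
    go (y ∷ ys) (inj₁ y≈0 ∷ _) (here x≈y)  = contradiction (trans x≈y y≈0) x≉0
    go (y ∷ ys) (inj₂ q ∷ _)   (here x≈y)  = trans (^-cong h x≈y) q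
    go (y ∷ ys) (_ ∷ qs)       (there x∈) = go ys qs x∈

  ^qh≈1 : ∀ q x → ¬ (x ≈ 0#) → x ^ (q ℕ.* h) ≈ 1#
  ^qh≈1 zero    x x≉0 = refl
  ^qh≈1 (suc q) x x≉0 = trans (^-+ x h (q ℕ.* h)) (trans (*-cong (^h≈1 x x≉0) (^qh≈1 q x x≉0)) (*-identityˡ 1#))

  all-1⇒h∣ : ∀ m → (∀ x → ¬ (x ≈ 0#) → x ^ m ≈ 1#) → h ∣ m
  all-1⇒h∣ m q = m%n≡0⇒n∣m m h (zero-if (m % h) (m%n<n m h) rem)
    where
    rem : ∀ x → ¬ (x ≈ 0#) → x ^ (m % h) ≈ 1#
    rem x x≉0 = begin
      x ^ (m % h)                              ≈⟨ *-identityʳ _ ⟨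
      x ^ (m % h) * 1#                         ≈⟨ *-congˡ (^qh≈1 (m / h) x x≉0) ⟨
      x ^ (m % h) * x ^ (m / h ℕ.* h)          ≈⟨ ^-+ x (m % h) (m / h ℕ.* h) ⟨
      x ^ (m % h ℕ.+ m / h ℕ.* h)              ≡⟨ ≡.cong (x ^_) (m≡m%n+[m/n]*n m h) ⟨
      x ^ m                                    ≈⟨ q x x≉0 ⟩
      1#                                       ∎
    zero-if : ∀ i → i ℕ.< h → (∀ x → ¬ (x ≈ 0#) → x ^ i ≈ 1#) → i ≡ 0
    zero-if zero    _   _ = ≡.refl
    zero-if (suc i) i<h r = contradiction (s≤s z≤n , Allᴸ.tabulate each) (proj₂ (proj₂ exponent) (suc i) i<h)
      where
      each : ∀ {x} → x ∈≡ elems → x ≈ 0# ⊎ x ^ suc i ≈ 1#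
      each {x} _ with x ≈? 0#
      ... | yes s = inj₁ s
      ... | no  s = inj₂ (r x s)

  P : ℕ → Carrier
  P m = Σᶠ (λ x → x ^ m)

  P-0 : P 0 ≈ 0#
  P-0 = Σ-1

  -- Scaling by `g` permutes the field, so `P m` is unchanged by the factor `g ^ m`; a nonzero `P m`
  -- cancels and leaves `g ^ m = 1`.
  P-≉0⇒h∣ : ∀ m → ¬ (P m ≈ 0#) → h ∣ m
  P-≉0⇒h∣ m P≉0 = all-1⇒h∣ m λ g g≉0 → *-cancelˡ P≉0 (begin
    P m * g ^ m                   ≈⟨ *-comm _ _ ⟩
    g ^ m * P m                   ≈⟨ Σᶠ-*ˡ (g ^ m) (λ x → x ^ m) ⟨
    Σᶠ (λ x → g ^ m * x ^ m)      ≈⟨ Σ⁺.fold-cong elems (λ x → ^-* g x m) ⟨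
    Σᶠ (λ x → (g * x) ^ m)        ≈⟨ Scale.Σ-scale g g≉0 {λ x → x ^ m} (^-cong m) ⟩
    P m                           ≈⟨ *-identityʳ _ ⟨
    P m * 1#                      ∎)

  isZero : Carrier → Carrier
  isZero x = if does (x ≈? 0#) then 1# else 0#

  isZero-resp : ∀ {x y} → x ≈ y → isZero x ≈ isZero y
  isZero-resp {x} {y} x≈y with x ≈? 0# | y ≈? 0#
  ... | yes _ | yes _ = refl
  ... | no  _ | no  _ = refl
  ... | yes q | no  r = contradiction (trans (sym x≈y) q) r
  ... | no  q | yes r = contradiction (trans x≈y r) q

  Σ-isZero : Σᶠ isZero ≈ 1#
  Σ-isZero = trans E.fold-eq (trans (+-cong at-0 (others E.rest (λ q → proj₂ (E.from q)))) (+-identityʳ 1#))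
    where
    module E = Σ⁺.Extracted (Σ⁺.extract {isZero} isZero-resp 0# elems distinct (complete 0#))
    at-0 : isZero 0# ≈ 1#
    at-0 with 0# ≈? 0#
    ... | yes _ = refl
    ... | no  q = contradiction refl q
    others : ∀ xs → (∀ {x} → x ∈ xs → ¬ (x ≈ 0#)) → Σ⁺.fold xs isZero ≈ 0#
    others []       q = refl
    others (x ∷ xs) q with x ≈? 0#
    ... | yes r = contradiction r (q (here refl))
    ... | no  _ = trans (+-identityˡ _) (others xs (q ∘ there))

  -- Every nonzero `x` has `x ^ m = 1`, and `isZero` supplies the missing 1 at 0; the corrected sum
  -- is `Σ 1 = 0`.
  P-div : ∀ m → 0 ℕ.< m → h ∣ m → P m + 1# ≈ 0#
  P-div m 0<m (divides q ≡.refl) = begin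
    P m + 1#                             ≈⟨ +-congˡ Σ-isZero ⟨
    P m + Σᶠ isZero                      ≈⟨ Σ⁺.fold-∙ elems (λ x → x ^ m) isZero ⟨
    Σᶠ (λ x → x ^ m + isZero x)          ≈⟨ Σ⁺.fold-cong elems each ⟩
    Σᶠ (λ _ → 1#)                        ≈⟨ Σ-1 ⟩
    0#                                   ∎
    where
    0^ : ∀ {x} m → 0 ℕ.< m → x ≈ 0# → x ^ m ≈ 0#
    0^ (suc m) _ x≈0 = trans (*-congʳ x≈0) (zeroˡ _)
    each : ∀ x → x ^ m + isZero x ≈ 1#
    each x with x ≈? 0#
    ... | yes x≈0 = trans (+-congʳ (0^ m 0<m x≈0)) (+-identityˡ 1#)
    ... | no  x≉0 = trans (+-identityʳ _) (^qh≈1 q x x≉0)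

  P-nonzero : ∀ m → 0 ℕ.< m → h ∣ m → ¬ (P m ≈ 0#)
  P-nonzero m 0<m h∣m q = 1≉0 (trans (sym (+-identityˡ 1#)) (trans (+-congʳ (sym q)) (P-div m 0<m h∣m)))

  binomial-theorem : ∀ x m → (x + 1#) ^ m ≈ Σ< (suc m) (λ i → β m i * x ^ i)
  binomial-theorem x zero = sym (trans (+-identityˡ _) (trans (*-identityʳ _) ι-1))
  binomial-theorem x (suc m) = begin
    (x + 1#) * (x + 1#) ^ m                                                   ≈⟨ *-congˡ (binomial-theorem x m) ⟩
    (x + 1#) * B                                                              ≈⟨ distribʳ B x 1# ⟩
    x * B + 1# * B                                                            ≈⟨ +-cong (sym (Σ<-*ˡ (suc m) x _)) (*-identityˡ B) ⟩
    Σ< (suc m) (λ i → x * (β m i * x ^ i)) + B                                ≈⟨ +-cong (Σ<-cong (suc m) (λ i _ → solve 3 (λ a b c → a :* (b :* c) := b :* (a :* c)) refl x (β m i) (x ^ i))) B-longer ⟩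
    Σ< (suc m) (λ i → β m i * x ^ suc i) + (β m 0 * 1# + Σ< (suc m) (λ i → β m (suc i) * x ^ suc i))
                                                                              ≈⟨ solve 3 (λ a b c → a :+ (b :+ c) := b :+ (a :+ c)) refl _ _ _ ⟩
    β m 0 * 1# + (Σ< (suc m) (λ i → β m i * x ^ suc i) + Σ< (suc m) (λ i → β m (suc i) * x ^ suc i))
                                                                              ≈⟨ +-congˡ (Σ<-+ (suc m) _ _) ⟨
    β m 0 * 1# + Σ< (suc m) (λ i → β m i * x ^ suc i + β m (suc i) * x ^ suc i)
                                                                              ≈⟨ +-congˡ (Σ<-cong (suc m) (λ i _ → trans (sym (distribʳ _ _ _)) (*-congʳ (sym (β-pascal m i))))) ⟩
    β (suc m) 0 * 1# + Σ< (suc m) (λ i → β (suc m) (suc i) * x ^ suc i)       ≈⟨ Σ<-first (suc m) (λ i → β (suc m) i * x ^ i) ⟨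
    Σ< (suc (suc m)) (λ i → β (suc m) i * x ^ i)                              ∎
    where
    B : Carrier
    B = Σ< (suc m) (λ i → β m i * x ^ i)
    B-longer : B ≈ β m 0 * 1# + Σ< (suc m) (λ i → β m (suc i) * x ^ suc i)
    B-longer = begin
      B                                                      ≈⟨ +-identityʳ B ⟨
      B + 0#                                                 ≈⟨ +-congˡ (trans (*-congʳ (ι-≡ (binomial-zero (ℕₚ.n<1+n m)))) (zeroˡ _)) ⟨
      Σ< (suc (suc m)) (λ i → β m i * x ^ i)                 ≈⟨ Σ<-first (suc m) (λ i → β m i * x ^ i) ⟩
      β m 0 * 1# + Σ< (suc m) (λ i → β m (suc i) * x ^ suc i) ∎

  Σᶠ-Σ< : ∀ n (a : ℕ → Carrier) (f : ℕ → Carrier → Carrier) → Σᶠ (λ x → Σ< n (λ i → a i * f i x)) ≈ Σ< n (λ i → a i * Σᶠ (f i))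
  Σᶠ-Σ< zero a f = go elems
    where
    go : ∀ xs → Σ⁺.fold xs (λ _ → 0#) ≈ 0#
    go []       = refl
    go (x ∷ xs) = trans (+-identityˡ _) (go xs)
  Σᶠ-Σ< (suc n) a f = trans (Σ⁺.fold-∙ elems _ _) (+-cong (Σᶠ-Σ< n a f) (Σᶠ-*ˡ (a n) (f n)))

  -- Translation by 1 leaves `P m` unchanged. In the binomial expansion of the translated sum the
  -- term `i = m` is `P m` itself and cancels.
  P-relation : ∀ m → Σ< m (λ i → β m i * P i) ≈ 0#
  P-relation m = +-cancelʳ (P m) _ _ (begin
    Σ< m (λ i → β m i * P i) + P m                          ≈⟨ +-congˡ (trans (*-congʳ (trans (ι-≡ (binomial-diag m)) ι-1)) (*-identityˡ _)) ⟨
    Σ< (suc m) (λ i → β m i * P i)                          ≈⟨ Σᶠ-Σ< (suc m) (β m) (λ i x → x ^ i) ⟨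
    Σᶠ (λ x → Σ< (suc m) (λ i → β m i * x ^ i))             ≈⟨ Σ⁺.fold-cong elems (λ x → binomial-theorem x m) ⟨
    Σᶠ (λ x → (x + 1#) ^ m)                                 ≈⟨ Σ-translate {λ x → x ^ m} (^-cong m) ⟩
    P m                                                     ≈⟨ +-identityˡ _ ⟨
    0# + P m                                                ∎)

  -- C(n + r, n) = 0 for 0 < r ≤ n; by Lucas this forces n + 1 to be a power of p.
  Full : ℕ → Set ℓ
  Full n = ∀ r → 0 ℕ.< r → r ℕ.≤ n → β (n ℕ.+ r) n ≈ 0#

  -- In `P-relation` for `h + r` only `i = h` survives: `P 0` vanishes, and `2 h` lies outside the
  -- range because `r ≤ h`.
  full-h : Full h
  full-h r 0<r r≤h = *-cancel-0 (P-nonzero h h-pos (divides 1 (≡.sym (ℕₚ.*-identityˡ h))))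
    (trans (*-comm _ _) (trans (sym (Σ<-single (h ℕ.+ r) (λ i → β (h ℕ.+ r) i * P i) h
      (ℕₚ.m<m+n h 0<r) others)) (P-relation (h ℕ.+ r))))
    where
    P≈0 : ∀ i → i ℕ.< h ℕ.+ r → i ≢ h → P i ≈ 0#
    P≈0 i i<m i≢h with P i ≈? 0#
    ... | yes q = q
    ... | no  q with P-≉0⇒h∣ i q
    ...   | divides zero          ≡.refl = P-0
    ...   | divides (suc zero)    eq     = contradiction (≡.trans eq (ℕₚ.*-identityˡ h)) i≢h
    ...   | divides (suc (suc k)) ≡.refl = contradiction i<m (ℕₚ.≤⇒≯ (ℕₚ.+-monoʳ-≤ h (ℕₚ.≤-trans r≤h (ℕₚ.m≤m+n h _))))
    others : ∀ i → i ℕ.< h ℕ.+ r → i ≢ h → β (h ℕ.+ r) i * P i ≈ 0#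
    others i i<m i≢h = trans (*-congˡ (P≈0 i i<m i≢h)) (zeroʳ _)

  -- The case `r = 1` reads `n + 1 = 0` in the field, so the last digit of `n` is `p - 1`. Lucas
  -- strips this digit, taking multiples of `p` for `r`, and the remaining digits are full again.
  full⇒power : ∀ n → 0 ℕ.< n → Full n → ∃ λ e′ → suc n ≡ p ℕ.^ suc e′
  full⇒power n = go n (<-wellFounded n)
    where
    go : ∀ n → Acc ℕ._<_ n → 0 ℕ.< n → Full n → ∃ λ e′ → suc n ≡ p ℕ.^ suc e′
    go n (acc rs) 0<n full with ι-0⇒p∣ (suc n) (trans (ι-≡ (≡.sym (≡.trans (≡.cong (λ z → binomial z n) (ℕₚ.+-comm n 1)) (binomial-pred n)))) (full 1 (s≤s z≤n) 0<n))
    ... | divides (suc zero) eq = 0 , ≡.trans eq (ℕₚ.*-comm 1 p)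
    ... | divides (suc (suc k)) eq = let (e′ , q) = go m (rs m<n) (s≤s z≤n) full-m in
            suc e′ , ≡.trans eq (≡.trans (ℕₚ.*-comm (suc m) p) (≡.cong (p ℕ.*_) q))
      where
      m : ℕ
      m = suc k
      n≡ : n ≡ p′ ℕ.+ m ℕ.* p
      n≡ = ℕₚ.suc-injective (≡.trans eq (≡.cong (ℕ._+ m ℕ.* p) (≡.sym p≡)))
      m*p≤n : m ℕ.* p ℕ.≤ n
      m*p≤n = ℕₚ.≤-trans (ℕₚ.m≤n+m _ p′) (ℕₚ.≤-reflexive (≡.sym n≡))
      m<n : m ℕ.< n
      m<n = ℕₚ.<-≤-trans (ℕₚ.m<m*n m p 2≤p) m*p≤n
      full-m : Full m
      full-m r 0<r r≤m = trans (sym (*-identityʳ _)) (trans (*-congˡ (sym (trans (ι-≡ (binomial-diag p′)) ι-1))) (begin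
        β (m ℕ.+ r) m * β p′ p′                                  ≈⟨ lucas (m ℕ.+ r) m (ℕₚ.≤-reflexive p≡) (ℕₚ.≤-reflexive p≡) ⟨
        β (p′ ℕ.+ (m ℕ.+ r) ℕ.* p) (p′ ℕ.+ m ℕ.* p)              ≡⟨ ≡.cong (λ z → β z (p′ ℕ.+ m ℕ.* p)) (shuffle p′ m r p) ⟩
        β (p′ ℕ.+ m ℕ.* p ℕ.+ r ℕ.* p) (p′ ℕ.+ m ℕ.* p)          ≡⟨ ≡.cong (λ z → β (z ℕ.+ r ℕ.* p) z) n≡ ⟨
        β (n ℕ.+ r ℕ.* p) n                                      ≈⟨ full (r ℕ.* p) (ℕₚ.<-≤-trans 0<r (ℕₚ.m≤m*n r p)) (ℕₚ.≤-trans (ℕₚ.*-monoˡ-≤ p r≤m) m*p≤n) ⟩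
        0#                                                       ∎))
        where
        shuffle : ∀ a b c d → a ℕ.+ (b ℕ.+ c) ℕ.* d ≡ a ℕ.+ b ℕ.* d ℕ.+ c ℕ.* d
        shuffle = solve-∀

  h-power : ∃ λ e′ → suc h ≡ p ℕ.^ suc e′
  h-power = full⇒power h h-pos full-h

-- Power series and the recursion for the power sums.

module Series {c ℓ : Level} (F : FiniteField c ℓ) where
  open FiniteField F hiding (zero)
  open Arithmetic F
  open import Relation.Binary.Reasoning.Setoid setoid
  open import Algebra.Solver.Ring.NaturalCoefficients.Default commutativeSemiring using (solve; _:+_; _:*_; _:=_)
  open import Algebra.Properties.Group +-group using () renaming (∙-cancelʳ to +-cancelʳ)

  S : Set c
  S = PS F

  infixl 7 _⊗_
  _⊗_ : S → S → S
  _⊗_ = _·_ F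

  infixr 8 _^^_
  _^^_ : S → ℕ → S
  _^^_ = _^ˢ_ F

  sh : ℕ → S → S
  sh = shift F

  infix 4 _≐_
  _≐_ : S → S → Set ℓ
  f ≐ g = ∀ n → f n ≈ g n

  infixl 6 _⊕_
  _⊕_ : S → S → S
  (f ⊕ g) n = f n + g n

  infixr 7 _•_
  _•_ : Carrier → S → S
  (a • f) n = a * f n

  tl : S → S
  tl f n = f (suc n)

  ⊗-0 : ∀ f g → (f ⊗ g) 0 ≈ f 0 * g 0
  ⊗-0 f g = +-identityˡ _

  ⊗-suc : ∀ f g n → (f ⊗ g) (suc n) ≈ f 0 * g (suc n) + (tl f ⊗ g) n
  ⊗-suc f g n = Σ<-first (suc n) (λ i → f i * g (suc n ∸ i))

  ⊗-congˡ-≤ : ∀ f {g g′} n → (∀ i → i ℕ.≤ n → g i ≈ g′ i) → (f ⊗ g) n ≈ (f ⊗ g′) n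
  ⊗-congˡ-≤ f n q = Σ<-cong (suc n) (λ i _ → *-congˡ (q (n ∸ i) (ℕₚ.m∸n≤m n i)))

  ⊗-cong : ∀ {f f′ g g′} → f ≐ f′ → g ≐ g′ → f ⊗ g ≐ f′ ⊗ g′
  ⊗-cong p q n = Σ<-cong (suc n) (λ i _ → *-cong (p i) (q (n ∸ i)))

  ⊗-congˡ : ∀ f {g g′} → g ≐ g′ → f ⊗ g ≐ f ⊗ g′
  ⊗-congˡ f q = ⊗-cong {f} (λ _ → refl) q

  ⊗-congʳ : ∀ g {f f′} → f ≐ f′ → f ⊗ g ≐ f′ ⊗ g
  ⊗-congʳ g p = ⊗-cong {g = g} p (λ _ → refl)

  ⊗-distribʳ : ∀ f g k → (f ⊕ g) ⊗ k ≐ f ⊗ k ⊕ g ⊗ k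
  ⊗-distribʳ f g k n = trans (Σ<-cong (suc n) (λ i _ → distribʳ (k (n ∸ i)) (f i) (g i))) (Σ<-+ (suc n) _ _)

  ⊗-distribˡ : ∀ f g k → f ⊗ (g ⊕ k) ≐ f ⊗ g ⊕ f ⊗ k
  ⊗-distribˡ f g k n = trans (Σ<-cong (suc n) (λ i _ → distribˡ (f i) (g (n ∸ i)) (k (n ∸ i)))) (Σ<-+ (suc n) _ _)

  ⊗-•ˡ : ∀ a f g → (a • f) ⊗ g ≐ a • (f ⊗ g)
  ⊗-•ˡ a f g n = trans (Σ<-cong (suc n) (λ i _ → *-assoc a (f i) (g (n ∸ i)))) (Σ<-*ˡ (suc n) a _)

  ⊗-•ʳ : ∀ a f g → f ⊗ (a • g) ≐ a • (f ⊗ g)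
  ⊗-•ʳ a f g n = trans (Σ<-cong (suc n) (λ i _ → solve 3 (λ x y z → x :* (y :* z) := y :* (x :* z)) refl (f i) a (g (n ∸ i)))) (Σ<-*ˡ (suc n) a _)

  ⊗-assoc : ∀ f g k → (f ⊗ g) ⊗ k ≐ f ⊗ (g ⊗ k)
  ⊗-assoc f g k zero = begin
    ((f ⊗ g) ⊗ k) 0          ≈⟨ ⊗-0 (f ⊗ g) k ⟩
    (f ⊗ g) 0 * k 0          ≈⟨ *-congʳ (⊗-0 f g) ⟩
    f 0 * g 0 * k 0          ≈⟨ *-assoc _ _ _ ⟩
    f 0 * (g 0 * k 0)        ≈⟨ *-congˡ (⊗-0 g k) ⟨
    f 0 * (g ⊗ k) 0          ≈⟨ ⊗-0 f (g ⊗ k) ⟨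
    (f ⊗ (g ⊗ k)) 0          ∎
  ⊗-assoc f g k (suc n) = begin
    ((f ⊗ g) ⊗ k) (suc n)                                                    ≈⟨ ⊗-suc (f ⊗ g) k n ⟩
    (f ⊗ g) 0 * k (suc n) + (tl (f ⊗ g) ⊗ k) n                               ≈⟨ +-cong (*-congʳ (⊗-0 f g)) (⊗-congʳ k (⊗-suc f g) n) ⟩
    f 0 * g 0 * k (suc n) + ((f 0 • tl g ⊕ tl f ⊗ g) ⊗ k) n                  ≈⟨ +-congˡ (⊗-distribʳ (f 0 • tl g) (tl f ⊗ g) k n) ⟩
    f 0 * g 0 * k (suc n) + (((f 0 • tl g) ⊗ k) n + ((tl f ⊗ g) ⊗ k) n)      ≈⟨ +-congˡ (+-cong (⊗-•ˡ (f 0) (tl g) k n) (⊗-assoc (tl f) g k n)) ⟩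
    f 0 * g 0 * k (suc n) + (f 0 * (tl g ⊗ k) n + (tl f ⊗ (g ⊗ k)) n)        ≈⟨ solve 5 (λ a b c d e → a :* b :* c :+ (a :* d :+ e) := a :* (b :* c :+ d) :+ e) refl _ _ _ _ _ ⟩
    f 0 * (g 0 * k (suc n) + (tl g ⊗ k) n) + (tl f ⊗ (g ⊗ k)) n              ≈⟨ +-congʳ (*-congˡ (⊗-suc g k n)) ⟨
    f 0 * (g ⊗ k) (suc n) + (tl f ⊗ (g ⊗ k)) n                               ≈⟨ ⊗-suc f (g ⊗ k) n ⟨
    (f ⊗ (g ⊗ k)) (suc n)                                                    ∎

  𝟘⊗ : ∀ {f} g → (∀ n → f n ≈ 0#) → ∀ n → (f ⊗ g) n ≈ 0#
  𝟘⊗ g q n = Σ<-zero (suc n) (λ i _ → trans (*-congʳ (q i)) (zeroˡ _))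

  one-⊗ : ∀ f → one F ⊗ f ≐ f
  one-⊗ f zero    = trans (⊗-0 (one F) f) (*-identityˡ _)
  one-⊗ f (suc n) = trans (⊗-suc (one F) f n) (trans (+-cong (*-identityˡ _) (𝟘⊗ f (λ _ → refl) n)) (+-identityʳ _))

  ⊗-one : ∀ f → f ⊗ one F ≐ f
  ⊗-one f zero    = trans (⊗-0 f (one F)) (*-identityʳ _)
  ⊗-one f (suc n) = trans (⊗-suc f (one F) n) (trans (+-cong (zeroʳ _) (⊗-one (tl f) n)) (+-identityˡ _))

  sh-cong : ∀ k {f g} → f ≐ g → sh k f ≐ sh k g
  sh-cong zero    q n       = q n
  sh-cong (suc k) q zero    = refl
  sh-cong (suc k) q (suc n) = sh-cong k q n

  sh-⊕ : ∀ k f g → sh k (f ⊕ g) ≐ sh k f ⊕ sh k g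
  sh-⊕ zero    f g n       = refl
  sh-⊕ (suc k) f g zero    = sym (+-identityˡ 0#)
  sh-⊕ (suc k) f g (suc n) = sh-⊕ k f g n

  sh-• : ∀ k a f → sh k (a • f) ≐ a • sh k f
  sh-• zero    a f n       = refl
  sh-• (suc k) a f zero    = sym (zeroʳ a)
  sh-• (suc k) a f (suc n) = sh-• k a f n

  sh-⊗ˡ : ∀ k f g → sh k f ⊗ g ≐ sh k (f ⊗ g)
  sh-⊗ˡ zero    f g n       = refl
  sh-⊗ˡ (suc k) f g zero    = trans (⊗-0 (sh (suc k) f) g) (zeroˡ _)
  sh-⊗ˡ (suc k) f g (suc n) = trans (⊗-suc (sh (suc k) f) g n) (trans (+-cong (zeroˡ _) (sh-⊗ˡ k f g n)) (+-identityˡ _))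

  sh-⊗ʳ : ∀ k f g → f ⊗ sh k g ≐ sh k (f ⊗ g)
  sh-⊗ʳ zero    f g n       = refl
  sh-⊗ʳ (suc k) f g zero    = trans (⊗-0 f (sh (suc k) g)) (zeroʳ _)
  sh-⊗ʳ (suc k) f g (suc n) = trans (+-cong (Σ<-cong (suc n) λ i i<n → *-congˡ (reflexive (≡.cong (sh (suc k) g) (ℕₚ.+-∸-assoc 1 (ℕₚ.≤-pred i<n)))))
                                              (trans (*-congˡ (reflexive (≡.cong (sh (suc k) g) (ℕₚ.n∸n≡0 n)))) (zeroʳ _)))
                                (trans (+-identityʳ _) (sh-⊗ʳ k f g n))

  sh-sh : ∀ a b f → sh a (sh b f) ≐ sh (a ℕ.+ b) f
  sh-sh zero    b f n       = refl
  sh-sh (suc a) b f zero    = refl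
  sh-sh (suc a) b f (suc n) = sh-sh a b f n

  sh-+ : ∀ k f n → sh k f (k ℕ.+ n) ≈ f n
  sh-+ zero    f n = refl
  sh-+ (suc k) f n = sh-+ k f n

  sh-< : ∀ k f {n} → n ℕ.< k → sh k f n ≈ 0#
  sh-< (suc k) f {zero}  _         = refl
  sh-< (suc k) f {suc n} (s≤s n<k) = sh-< k f n<k

  ^^-cong : ∀ {f g} s → f ≐ g → f ^^ s ≐ g ^^ s
  ^^-cong zero    q n = refl
  ^^-cong (suc s) q   = ⊗-cong q (^^-cong s q)

  sh-^^ : ∀ k f s → sh k f ^^ s ≐ sh (k ℕ.* s) (f ^^ s)
  sh-^^ k f zero n = reflexive (≡.cong (λ z → sh z (one F) n) (≡.sym (ℕₚ.*-zeroʳ k)))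
  sh-^^ k f (suc s) n = begin
    (sh k f ⊗ sh k f ^^ s) n                    ≈⟨ ⊗-congˡ (sh k f) (sh-^^ k f s) n ⟩
    (sh k f ⊗ sh (k ℕ.* s) (f ^^ s)) n          ≈⟨ sh-⊗ˡ k f (sh (k ℕ.* s) (f ^^ s)) n ⟩
    sh k (f ⊗ sh (k ℕ.* s) (f ^^ s)) n          ≈⟨ sh-cong k (sh-⊗ʳ (k ℕ.* s) f (f ^^ s)) n ⟩
    sh k (sh (k ℕ.* s) (f ^^ suc s)) n          ≈⟨ sh-sh k (k ℕ.* s) (f ^^ suc s) n ⟩
    sh (k ℕ.+ k ℕ.* s) (f ^^ suc s) n           ≡⟨ ≡.cong (λ z → sh z (f ^^ suc s) n) (ℕₚ.*-suc k s) ⟨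
    sh (k ℕ.* suc s) (f ^^ suc s) n             ∎

  Low : ℕ → S → Set ℓ
  Low k f = ∀ n → n ℕ.< k → f n ≈ 0#

  low-⊗ : ∀ {a b f g} → Low a f → Low b g → Low (a ℕ.+ b) (f ⊗ g)
  low-⊗ {a} {b} {f} {g} lf lg n n<ab = Σ<-zero (suc n) each
    where
    each : ∀ i → i ℕ.< suc n → f i * g (n ∸ i) ≈ 0#
    each i i≤n with i ℕ.<? a
    ... | yes i<a = trans (*-congʳ (lf i i<a)) (zeroˡ _)
    ... | no  i≮a = trans (*-congˡ (lg (n ∸ i) (ℕₚ.+-cancelˡ-< i _ _ (ℕₚ.<-≤-trans (ℕₚ.≤-<-trans (ℕₚ.≤-reflexive (ℕₚ.m+[n∸m]≡n (ℕₚ.≤-pred i≤n))) n<ab) (ℕₚ.+-monoˡ-≤ b (ℕₚ.≮⇒≥ i≮a)))))) (zeroʳ _)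

  lead-⊗ : ∀ {a b f g} → Low a f → Low b g → (f ⊗ g) (a ℕ.+ b) ≈ f a * g b
  lead-⊗ {a} {b} {f} {g} lf lg = trans (Σ<-single (suc (a ℕ.+ b)) _ a (s≤s (ℕₚ.m≤m+n a b)) each) (*-congˡ (reflexive (≡.cong g (ℕₚ.m+n∸m≡n a b))))
    where
    each : ∀ i → i ℕ.< suc (a ℕ.+ b) → i ≢ a → f i * g (a ℕ.+ b ∸ i) ≈ 0#
    each i i≤n i≢a with i ℕ.<? a
    ... | yes i<a = trans (*-congʳ (lf i i<a)) (zeroˡ _)
    ... | no  i≮a = trans (*-congˡ (lg _ (ℕₚ.+-cancelˡ-< i _ _ (ℕₚ.≤-<-trans (ℕₚ.≤-reflexive (ℕₚ.m+[n∸m]≡n (ℕₚ.≤-pred i≤n)))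
                      (ℕₚ.+-monoˡ-< b (ℕₚ.≤∧≢⇒< (ℕₚ.≮⇒≥ i≮a) (i≢a ∘ ≡.sym))))))) (zeroʳ _)

  low-^^ : ∀ {f} → f 0 ≈ 0# → ∀ s → Low s (f ^^ s)
  low-^^ f0 zero    n ()
  low-^^ f0 (suc s) = low-⊗ {1} {s} (λ { zero _ → f0 ; (suc n) (s≤s ()) }) (low-^^ f0 s)

  ⊗-cancelˡ : ∀ {u y y′} → u 0 ≈ 1# → u ⊗ y ≐ u ⊗ y′ → y ≐ y′
  ⊗-cancelˡ {u} {y} {y′} u0 q n = below (suc n) n (ℕₚ.n<1+n n)
    where
    below : ∀ m n → n ℕ.< m → y n ≈ y′ n
    u0y : ∀ (z : S) n → u 0 * z n ≈ z n
    u0y z n = trans (*-congʳ u0) (*-identityˡ _)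
    below (suc m) zero    _         = trans (sym (u0y y 0)) (trans (sym (⊗-0 u y)) (trans (q 0) (trans (⊗-0 u y′) (u0y y′ 0))))
    below (suc m) (suc n) (s≤s n<m) = trans (sym (u0y y (suc n))) (trans (+-cancelʳ ((tl u ⊗ y) n) _ _ (begin
      u 0 * y (suc n) + (tl u ⊗ y) n          ≈⟨ ⊗-suc u y n ⟨
      (u ⊗ y) (suc n)                         ≈⟨ q (suc n) ⟩
      (u ⊗ y′) (suc n)                        ≈⟨ ⊗-suc u y′ n ⟩
      u 0 * y′ (suc n) + (tl u ⊗ y′) n        ≈⟨ +-congˡ (⊗-congˡ-≤ (tl u) n (λ i i≤n → below m i (ℕₚ.≤-<-trans i≤n n<m))) ⟨
      u 0 * y′ (suc n) + (tl u ⊗ y) n         ∎)) (u0y y′ (suc n)))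

  cv : S → ℕ → List Carrier → Carrier
  cv u i []       = 0#
  cv u i (b ∷ bs) = u i * b + cv u (suc i) bs

  -- The underscores are solved by the local functions of invUpto and uCoeff, which have no name.
  mutual
    inv-suc : ∀ u n → inv F u (suc n) ≡ - cv u 1 (invUpto F u n)
    inv-suc u n with 1 | invUpto F u n
    ... | i | bs = ≡.cong -_ (conv≡cv u n i bs)

    conv≡cv : ∀ (u : S) (n : ℕ) (i : ℕ) (bs : List Carrier) → _ ≡ cv u i bs
    conv≡cv u n i []       = ≡.refl
    conv≡cv u n i (b ∷ bs) = ≡.cong (u i * b +_) (conv≡cv u n (suc i) bs)

  nth : ∀ {m} → Vec Carrier m → ℕ → Carrier
  nth []       _       = 0#
  nth (x ∷ xs) zero    = x
  nth (x ∷ xs) (suc j) = nth xs j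

  mutual
    uCoeff-suc : ∀ {d} (cs : Vec Carrier d) i → uCoeff F cs (suc i) ≡ nth (Vec.reverse cs) i
    uCoeff-suc cs i with Vec.reverse cs
    uCoeff-suc cs i       | []     = ≡.refl
    uCoeff-suc cs zero    | x ∷ xs = ≡.refl
    uCoeff-suc cs (suc j) | x ∷ xs = go-tail cs j xs

    go-tail : ∀ {d} (cs : Vec Carrier (suc d)) (j : ℕ) (xs : Vec Carrier d) → _ ≡ nth xs j
    go-tail {d} cs j xs with suc j | suc d
    ... | i | d′ = go≡nth cs i xs j

    go≡nth : ∀ {d} (cs : Vec Carrier d) (i : ℕ) {m} (xs : Vec Carrier m) (j : ℕ) → _ ≡ nth xs j
    go≡nth cs i []       j       = ≡.refl
    go≡nth cs i (x ∷ xs) zero    = ≡.refl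
    go≡nth cs i (x ∷ xs) (suc j) = go≡nth cs i xs j

  -- `invUpto` lists the coefficients of the inverse backwards, so pairing it with `u` from index
  -- `i` on is a Cauchy product with the shifted `u`.
  cv-⊗ : ∀ u n i → cv u i (invUpto F u n) ≈ ((λ k → u (i ℕ.+ k)) ⊗ inv F u) n
  cv-⊗ u zero    i = trans (+-identityʳ _) (trans (*-congʳ (reflexive (≡.cong u (≡.sym (ℕₚ.+-identityʳ i))))) (sym (⊗-0 (λ k → u (i ℕ.+ k)) (inv F u))))
  cv-⊗ u (suc n) i = begin
    u i * inv F u (suc n) + cv u (suc i) (invUpto F u n)                              ≈⟨ +-cong (*-congʳ (reflexive (≡.cong u (≡.sym (ℕₚ.+-identityʳ i))))) (cv-⊗ u n (suc i)) ⟩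
    u (i ℕ.+ 0) * inv F u (suc n) + ((λ k → u (suc i ℕ.+ k)) ⊗ inv F u) n             ≈⟨ +-congˡ (⊗-congʳ (inv F u) (λ k → reflexive (≡.cong u (≡.sym (ℕₚ.+-suc i k)))) n) ⟩
    u (i ℕ.+ 0) * inv F u (suc n) + ((λ k → u (i ℕ.+ suc k)) ⊗ inv F u) n             ≈⟨ ⊗-suc (λ k → u (i ℕ.+ k)) (inv F u) n ⟨
    ((λ k → u (i ℕ.+ k)) ⊗ inv F u) (suc n)                                           ∎

  inv-inverseʳ : ∀ u → u 0 ≈ 1# → u ⊗ inv F u ≐ one F
  inv-inverseʳ u u0 zero    = trans (⊗-0 u (inv F u)) (trans (*-identityʳ _) u0)
  inv-inverseʳ u u0 (suc n) = begin
    (u ⊗ inv F u) (suc n)                                        ≈⟨ ⊗-suc u (inv F u) n ⟩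
    u 0 * inv F u (suc n) + (tl u ⊗ inv F u) n                   ≈⟨ +-cong (trans (*-congʳ u0) (*-identityˡ _)) (sym (cv-⊗ u n 1)) ⟩
    inv F u (suc n) + cv u 1 (invUpto F u n)                     ≡⟨ ≡.cong (_+ cv u 1 (invUpto F u n)) (inv-suc u n) ⟩
    - cv u 1 (invUpto F u n) + cv u 1 (invUpto F u n)            ≈⟨ -‿inverseˡ _ ⟩
    0#                                                           ∎

  inv-inverseˡ : ∀ u → u 0 ≈ 1# → inv F u ⊗ u ≐ one F
  inv-inverseˡ u u0 = ⊗-cancelˡ u0 λ n → begin
    (u ⊗ (inv F u ⊗ u)) n       ≈⟨ ⊗-assoc u (inv F u) u n ⟨
    ((u ⊗ inv F u) ⊗ u) n       ≈⟨ ⊗-congʳ u (inv-inverseʳ u u0) n ⟩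
    (one F ⊗ u) n               ≈⟨ one-⊗ u n ⟩
    u n                         ≈⟨ ⊗-one u n ⟨
    (u ⊗ one F) n               ∎

  nth-∷ʳ : ∀ {d} (xs : Vec Carrier d) x i → nth (xs Vec.∷ʳ x) i ≈ nth xs i + x * sh d (one F) i
  nth-∷ʳ []       x zero    = trans (sym (*-identityʳ x)) (sym (+-identityˡ _))
  nth-∷ʳ []       x (suc i) = sym (trans (+-identityˡ _) (zeroʳ x))
  nth-∷ʳ (y ∷ ys) x zero    = sym (trans (+-congˡ (zeroʳ x)) (+-identityʳ y))
  nth-∷ʳ (y ∷ ys) x (suc i) = nth-∷ʳ ys x i

  -- `u` reads the polynomial from its leading coefficient down, so a new constant coefficient
  -- appears at degree `d + 1`.
  uCoeff-∷ : ∀ {d} x (cs : Vec Carrier d) → uCoeff F (x ∷ cs) ≐ uCoeff F cs ⊕ x • sh (suc d) (one F)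
  uCoeff-∷ x cs zero    = sym (trans (+-congˡ (zeroʳ x)) (+-identityʳ 1#))
  uCoeff-∷ {d} x cs (suc i) = begin
    uCoeff F (x ∷ cs) (suc i)                         ≡⟨ uCoeff-suc (x ∷ cs) i ⟩
    nth (Vec.reverse (x ∷ cs)) i                      ≡⟨ ≡.cong (λ z → nth z i) (Vecₚ.reverse-∷ x cs) ⟩
    nth (Vec.reverse cs Vec.∷ʳ x) i                   ≈⟨ nth-∷ʳ (Vec.reverse cs) x i ⟩
    nth (Vec.reverse cs) i + x * sh d (one F) i       ≡⟨ ≡.cong (_+ x * sh d (one F) i) (uCoeff-suc cs i) ⟨
    uCoeff F cs (suc i) + x * sh d (one F) i          ∎

  -- With a = θ a′ + x, the series Q = 1/(θ a′) and R = 1/a satisfy R + x Q R = Q.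
  module _ {d : ℕ} (x : Carrier) (cs : Vec Carrier d) where
    u u′ J I R Q : S
    u  = uCoeff F (x ∷ cs)
    u′ = uCoeff F cs
    J  = inv F u
    I  = inv F u′
    R  = sh (suc d) J
    Q  = sh (suc d) I

    reciprocals : R ⊕ x • (Q ⊗ R) ≐ Q
    reciprocals n = begin
      R n + x * (Q ⊗ R) n                      ≈⟨ +-congˡ (*-congˡ (sh-⊗ˡ (suc d) I R n)) ⟩
      R n + x * sh (suc d) (I ⊗ R) n           ≈⟨ +-congˡ (sh-• (suc d) x (I ⊗ R) n) ⟨
      R n + sh (suc d) (x • (I ⊗ R)) n         ≈⟨ sh-⊕ (suc d) J (x • (I ⊗ R)) n ⟨
      sh (suc d) (J ⊕ x • (I ⊗ R)) n           ≈⟨ sh-cong (suc d) unshifted n ⟩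
      Q n                                      ∎
      where
      uJ : u′ ⊗ J ⊕ x • R ≐ one F
      uJ n = begin
        (u′ ⊗ J) n + x * R n                              ≈⟨ +-congˡ (*-congˡ (trans (sh-⊗ˡ (suc d) (one F) J n) (sh-cong (suc d) (one-⊗ J) n))) ⟨
        (u′ ⊗ J) n + x * (sh (suc d) (one F) ⊗ J) n       ≈⟨ +-congˡ (⊗-•ˡ x (sh (suc d) (one F)) J n) ⟨
        (u′ ⊗ J) n + ((x • sh (suc d) (one F)) ⊗ J) n     ≈⟨ ⊗-distribʳ u′ (x • sh (suc d) (one F)) J n ⟨
        ((u′ ⊕ x • sh (suc d) (one F)) ⊗ J) n             ≈⟨ ⊗-congʳ J (uCoeff-∷ x cs) n ⟨
        (u ⊗ J) n                                         ≈⟨ inv-inverseʳ u refl n ⟩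
        one F n                                           ∎
      unshifted : J ⊕ x • (I ⊗ R) ≐ I
      unshifted n = begin
        J n + x * (I ⊗ R) n                    ≈⟨ +-cong (one-⊗ J n) (⊗-•ʳ x I R n) ⟨
        (one F ⊗ J) n + (I ⊗ (x • R)) n        ≈⟨ +-congʳ (⊗-congʳ J (inv-inverseˡ u′ refl) n) ⟨
        ((I ⊗ u′) ⊗ J) n + (I ⊗ (x • R)) n     ≈⟨ +-congʳ (⊗-assoc I u′ J n) ⟩
        (I ⊗ (u′ ⊗ J)) n + (I ⊗ (x • R)) n     ≈⟨ ⊗-distribˡ I (u′ ⊗ J) (x • R) n ⟨
        (I ⊗ (u′ ⊗ J ⊕ x • R)) n               ≈⟨ ⊗-congˡ I uJ n ⟩
        (I ⊗ one F) n                          ≈⟨ ⊗-one I n ⟩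
        I n                                    ∎

  private
    _^_ : Carrier → ℕ → Carrier
    _^_ = _^ᶠ_ F

  -- The coefficient of `z^m` in `(1 + z)^(-s)`; `κ-pascal` is multiplication by `1 + z`.
  κ : ℕ → ℕ → Carrier
  κ s m = (- 1#) ^ m * ι (multichoose s m)

  κ-pascal : ∀ s m → κ (suc s) (suc m) + κ (suc s) m ≈ κ s (suc m)
  κ-pascal s m = begin
    (- 1# * σ) * ι (A ℕ.+ B) + σ * ι B              ≈⟨ +-congʳ (*-congˡ (ι-+ A B)) ⟩
    (- 1# * σ) * (ι A + ι B) + σ * ι B              ≈⟨ +-congˡ (*-identityˡ _) ⟨
    (- 1# * σ) * (ι A + ι B) + 1# * (σ * ι B)       ≈⟨ solve 5 (λ a b c d e → (a :* b) :* (c :+ d) :+ e :* (b :* d) := (a :* b) :* c :+ (a :+ e) :* (b :* d)) refl (- 1#) σ (ι A) (ι B) 1# ⟩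
    (- 1# * σ) * ι A + (- 1# + 1#) * (σ * ι B)      ≈⟨ +-congˡ (trans (*-congʳ (-‿inverseˡ 1#)) (zeroˡ _)) ⟩
    (- 1# * σ) * ι A + 0#                           ≈⟨ +-identityʳ _ ⟩
    (- 1# * σ) * ι A                                ∎
    where
    σ = (- 1#) ^ m
    A = multichoose s (suc m)
    B = multichoose (suc s) m

  ⊗-Σ< : ∀ M q (a : ℕ → Carrier) (g : ℕ → S) n → (q ⊗ (λ i → Σ< M (λ m → a m * g m i))) n ≈ Σ< M (λ m → a m * (q ⊗ g m) n)
  ⊗-Σ< zero    q a g n = Σ<-zero (suc n) (λ i _ → zeroʳ _)
  ⊗-Σ< (suc M) q a g n = trans (⊗-distribˡ q (λ i → Σ< M (λ m → a m * g m i)) (a M • g M) n)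
    (+-cong (⊗-Σ< M q a g n) (⊗-•ʳ (a M) q (g M) n))

  -- R^s = Σ_m (-1)^m C(s+m-1, m) x^m Q^(s+m), compared below degree M.
  module Expansion (x : Carrier) (R Q : S) (Q0 : Q 0 ≈ 0#) (rel : R ⊕ x • (Q ⊗ R) ≐ Q) where

    T : ℕ → ℕ → S
    T s M n = Σ< M (λ m → (κ s m * x ^ m) * (Q ^^ (s ℕ.+ m)) n)

    -- As `Q` has no constant term, a coefficient of `Q ⊗ y` involves only lower coefficients of
    -- `y`, and the equation determines `y` recursively.
    solution-unique : ∀ M {y y′ : S} → (∀ n → n ℕ.< M → y n + x * (Q ⊗ y) n ≈ y′ n + x * (Q ⊗ y′) n) → ∀ n → n ℕ.< M → y n ≈ y′ n
    solution-unique M {y} {y′} q n n<M = below (suc n) n (ℕₚ.n<1+n n) n<M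
      where
      below : ∀ m n → n ℕ.< m → n ℕ.< M → y n ≈ y′ n
      below (suc m) zero _ 0<M = +-cancelʳ (x * (Q ⊗ y) 0) _ _ (trans (q 0 0<M) (+-congˡ (*-congˡ (trans (vanish y′) (sym (vanish y))))))
        where
        vanish : ∀ z → (Q ⊗ z) 0 ≈ 0#
        vanish z = trans (⊗-0 Q z) (trans (*-congʳ Q0) (zeroˡ _))
      below (suc m) (suc n) (s≤s n<m) n<M = +-cancelʳ (x * (Q ⊗ y) (suc n)) _ _ (trans (q (suc n) n<M) (+-congˡ (*-congˡ
        (trans (drop y′) (trans (sym (⊗-congˡ-≤ (tl Q) n (λ i i≤n → below m i (ℕₚ.≤-<-trans i≤n n<m) (ℕₚ.≤-<-trans i≤n (ℕₚ.<-trans (ℕₚ.n<1+n n) n<M))))) (sym (drop y)))))))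
        where
        drop : ∀ z → (Q ⊗ z) (suc n) ≈ (tl Q ⊗ z) n
        drop z = trans (⊗-suc Q z n) (trans (+-congʳ (trans (*-congʳ Q0) (zeroˡ _))) (+-identityˡ _))

    -- Multiplying by `Q` shifts the summation index by 1 and `κ-pascal` merges the two sums. The
    -- boundary term at `M` is divisible by a power of `Q` that begins above degree `n`.
    T-rel : ∀ s M n → n ℕ.< M → T (suc s) M n + x * (Q ⊗ T (suc s) M) n ≈ (Q ⊗ T s M) n
    T-rel s M n n<M = begin
      T (suc s) M n + x * (Q ⊗ T (suc s) M) n                                                       ≈⟨ +-cong extend (*-congˡ (trans (⊗-Σ< M Q b (λ m → Q ^^ (suc s ℕ.+ m)) n) (Σ<-cong M (λ m _ → *-congˡ (next m))))) ⟩
      Σ< (suc M) (λ m → b m * a m) + x * Σ< M (λ m → b m * a (suc m))                               ≈⟨ +-cong (Σ<-first M _) (sym (Σ<-*ˡ M x _)) ⟩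
      (b 0 * a 0 + Σ< M (λ m → b (suc m) * a (suc m))) + Σ< M (λ m → x * (b m * a (suc m)))         ≈⟨ +-assoc _ _ _ ⟩
      b 0 * a 0 + (Σ< M (λ m → b (suc m) * a (suc m)) + Σ< M (λ m → x * (b m * a (suc m))))         ≈⟨ +-congˡ (Σ<-+ M _ _) ⟨
      b 0 * a 0 + Σ< M (λ m → b (suc m) * a (suc m) + x * (b m * a (suc m)))                        ≈⟨ +-congˡ (Σ<-cong M (λ m _ → merge m)) ⟩
      b′ 0 * a 0 + Σ< M (λ m → b′ (suc m) * a (suc m))                                              ≈⟨ Σ<-first M (λ m → b′ m * a m) ⟨
      Σ< (suc M) (λ m → b′ m * a m)                                                                 ≈⟨ trans (+-congˡ (trans (*-congˡ (a-small M ℕₚ.≤-refl)) (zeroʳ _))) (+-identityʳ _) ⟩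
      Σ< M (λ m → b′ m * a m)                                                                       ≈⟨ ⊗-Σ< M Q b′ (λ m → Q ^^ (s ℕ.+ m)) n ⟨
      (Q ⊗ T s M) n                                                                                 ∎
      where
      a b b′ : ℕ → Carrier
      a m  = (Q ^^ (suc s ℕ.+ m)) n
      b m  = κ (suc s) m * x ^ m
      b′ m = κ s m * x ^ m
      a-small : ∀ m → M ℕ.≤ m → a m ≈ 0#
      a-small m M≤m = low-^^ Q0 (suc s ℕ.+ m) n (ℕₚ.<-≤-trans n<M (ℕₚ.≤-trans M≤m (ℕₚ.m≤n+m m (suc s))))
      extend : T (suc s) M n ≈ Σ< (suc M) (λ m → b m * a m)
      extend = sym (trans (+-congˡ (trans (*-congˡ (a-small M ℕₚ.≤-refl)) (zeroʳ _))) (+-identityʳ _))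
      next : ∀ m → (Q ⊗ Q ^^ (suc s ℕ.+ m)) n ≈ a (suc m)
      next m = reflexive (≡.cong (λ z → (Q ^^ suc z) n) (≡.sym (ℕₚ.+-suc s m)))
      merge : ∀ m → b (suc m) * a (suc m) + x * (b m * a (suc m)) ≈ b′ (suc m) * a (suc m)
      merge m = trans (solve 5 (λ k₁ k₀ y z w → (k₁ :* (y :* z)) :* w :+ y :* ((k₀ :* z) :* w) := ((k₁ :+ k₀) :* (y :* z)) :* w) refl (κ (suc s) (suc m)) (κ (suc s) m) x (x ^ m) (a (suc m)))
                      (*-congʳ (*-congʳ (κ-pascal s m)))

    -- In the induction step both sides solve `y + x Q y = Q R^s`, where `R^s` is known below degree
    -- `M`.
    expansion : ∀ s M n → n ℕ.< M → (R ^^ s) n ≈ T s M n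
    expansion zero M n n<M = sym (trans (Σ<-single M (λ m → (κ 0 m * x ^ m) * (Q ^^ m) n) 0 (ℕₚ.≤-trans (s≤s z≤n) n<M) others)
        (trans (*-congʳ (trans (*-identityʳ _) (trans (*-identityˡ _) ι-1))) (*-identityˡ _)))
      where
      others : ∀ m → m ℕ.< M → m ≢ 0 → (κ 0 m * x ^ m) * (Q ^^ m) n ≈ 0#
      others zero    _ q = contradiction ≡.refl q
      others (suc m) _ q = trans (*-congʳ (trans (*-congʳ (zeroʳ _)) (zeroˡ _))) (zeroˡ _)
    expansion (suc s) M = solution-unique M λ n n<M → begin
      (R ⊗ R ^^ s) n + x * (Q ⊗ (R ⊗ R ^^ s)) n           ≈⟨ +-congˡ (*-congˡ (⊗-assoc Q R (R ^^ s) n)) ⟨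
      (R ⊗ R ^^ s) n + x * ((Q ⊗ R) ⊗ R ^^ s) n           ≈⟨ +-congˡ (⊗-•ˡ x (Q ⊗ R) (R ^^ s) n) ⟨
      (R ⊗ R ^^ s) n + ((x • (Q ⊗ R)) ⊗ R ^^ s) n         ≈⟨ ⊗-distribʳ R (x • (Q ⊗ R)) (R ^^ s) n ⟨
      ((R ⊕ x • (Q ⊗ R)) ⊗ R ^^ s) n                      ≈⟨ ⊗-congʳ (R ^^ s) rel n ⟩
      (Q ⊗ R ^^ s) n                                      ≈⟨ ⊗-congˡ-≤ Q n (λ i i≤n → expansion s M i (ℕₚ.≤-<-trans i≤n n<M)) ⟩
      (Q ⊗ T s M) n                                       ≈⟨ T-rel s M n n<M ⟨
      T (suc s) M n + x * (Q ⊗ T (suc s) M) n             ∎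

  recip-expansion : ∀ {d} x (cs : Vec Carrier d) s n →
    recipPow F (x ∷ cs) s n ≈ Σ< (suc n) (λ m → (κ s m * x ^ m) * sh (s ℕ.+ m) (recipPow F cs (s ℕ.+ m)) n)
  recip-expansion {d} x cs s n = begin
    recipPow F (x ∷ cs) s n                                                                  ≈⟨ sh-^^ (suc d) (inv F (uCoeff F (x ∷ cs))) s n ⟨
    (sh (suc d) (inv F (uCoeff F (x ∷ cs))) ^^ s) n                                          ≈⟨ expansion s (suc n) n (ℕₚ.n<1+n n) ⟩
    Σ< (suc n) (λ m → (κ s m * x ^ m) * (sh (suc d) (inv F (uCoeff F cs)) ^^ (s ℕ.+ m)) n)   ≈⟨ Σ<-cong (suc n) (λ m _ → *-congˡ (power (s ℕ.+ m))) ⟩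
    Σ< (suc n) (λ m → (κ s m * x ^ m) * sh (s ℕ.+ m) (recipPow F cs (s ℕ.+ m)) n)            ∎
    where
    open Expansion x (sh (suc d) (inv F (uCoeff F (x ∷ cs)))) (sh (suc d) (inv F (uCoeff F cs))) refl (reciprocals x cs)
    power : ∀ t → (sh (suc d) (inv F (uCoeff F cs)) ^^ t) n ≈ sh t (recipPow F cs t) n
    power t = trans (sh-^^ (suc d) (inv F (uCoeff F cs)) t n) (sym (sh-sh t (d ℕ.* t) (inv F (uCoeff F cs) ^^ t) n))

  ΣL : {A : Set c} → List A → (A → Carrier) → Carrier
  ΣL = sumList F

  ΣL-cong : ∀ {A : Set c} (as : List A) {f g : A → Carrier} → (∀ a → f a ≈ g a) → ΣL as f ≈ ΣL as g
  ΣL-cong []       q = refl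
  ΣL-cong (a ∷ as) q = +-cong (q a) (ΣL-cong as q)

  ΣL-++ : ∀ {A : Set c} (as bs : List A) f → ΣL (as List.++ bs) f ≈ ΣL as f + ΣL bs f
  ΣL-++ []       bs f = sym (+-identityˡ _)
  ΣL-++ (a ∷ as) bs f = trans (+-congˡ (ΣL-++ as bs f)) (sym (+-assoc _ _ _))

  ΣL-map : ∀ {A B : Set c} (g : A → B) as f → ΣL (List.map g as) f ≡ ΣL as (f ∘ g)
  ΣL-map g []       f = ≡.refl
  ΣL-map g (a ∷ as) f = ≡.cong (f (g a) +_) (ΣL-map g as f)

  ΣL-concatMap : ∀ {A B : Set c} (g : A → List B) as f → ΣL (List.concatMap g as) f ≈ ΣL as (λ a → ΣL (g a) f)
  ΣL-concatMap g []       f = refl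
  ΣL-concatMap g (a ∷ as) f = trans (ΣL-++ (g a) (List.concatMap g as) f) (+-congˡ (ΣL-concatMap g as f))

  ΣL-*ˡ : ∀ {A : Set c} (as : List A) x f → ΣL as (λ a → x * f a) ≈ x * ΣL as f
  ΣL-*ˡ []       x f = sym (zeroʳ x)
  ΣL-*ˡ (a ∷ as) x f = trans (+-congˡ (ΣL-*ˡ as x f)) (sym (distribˡ x _ _))

  ΣL-+ : ∀ {A : Set c} (as : List A) (f g : A → Carrier) → ΣL as (λ a → f a + g a) ≈ ΣL as f + ΣL as g
  ΣL-+ []       f g = sym (+-identityˡ 0#)
  ΣL-+ (a ∷ as) f g = trans (+-congˡ (ΣL-+ as f g)) (solve 4 (λ x y z w → (x :+ y) :+ (z :+ w) := (x :+ z) :+ (y :+ w)) refl (f a) (g a) (ΣL as f) (ΣL as g))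

  ΣL-Σ< : ∀ {A : Set c} (as : List A) n (f : A → ℕ → Carrier) → ΣL as (λ a → Σ< n (f a)) ≈ Σ< n (λ i → ΣL as (λ a → f a i))
  ΣL-Σ< as zero    f = go as
    where
    go : ∀ as → ΣL as (λ _ → 0#) ≈ 0#
    go []       = refl
    go (a ∷ as) = trans (+-identityˡ _) (go as)
  ΣL-Σ< as (suc n) f = trans (ΣL-+ as (λ a → Σ< n (f a)) (λ a → f a n)) (+-congʳ (ΣL-Σ< as n f))

  ΣL-sh : ∀ {A : Set c} (as : List A) k (f : A → S) n → ΣL as (λ a → sh k (f a) n) ≈ sh k (λ i → ΣL as (λ a → f a i)) n
  ΣL-sh as zero    f n       = refl
  ΣL-sh as (suc k) f zero    = go as
    where
    go : ∀ as → ΣL as (λ _ → 0#) ≈ 0#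
    go []       = refl
    go (a ∷ as) = trans (+-identityˡ _) (go as)
  ΣL-sh as (suc k) f (suc n) = ΣL-sh as k f n

  ΣL-elems : ∀ f → ΣL elems f ≡ Σᶠ f
  ΣL-elems f = go elems
    where
    go : ∀ xs → ΣL xs f ≡ Σ⁺.fold xs f
    go []       = ≡.refl
    go (x ∷ xs) = ≡.cong (f x +_) (go xs)

  powerSum-suc : ∀ d s n → powerSum F (suc d) s n ≈ Σ< (suc n) (λ m → (κ s m * P m) * sh (s ℕ.+ m) (powerSum F d (s ℕ.+ m)) n)
  powerSum-suc d s n = begin
    powerSum F (suc d) s n
      ≈⟨ ΣL-concatMap (λ x → List.map (x ∷_) (monics F d)) elems _ ⟩
    ΣL elems (λ x → ΣL (List.map (x ∷_) (monics F d)) (λ cs → recipPow F cs s n))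
      ≈⟨ ΣL-cong elems (λ x → reflexive (ΣL-map (x ∷_) (monics F d) _)) ⟩
    ΣL elems (λ x → ΣL (monics F d) (λ cs → recipPow F (x ∷ cs) s n))
      ≈⟨ ΣL-cong elems (λ x → ΣL-cong (monics F d) (λ cs → recip-expansion x cs s n)) ⟩
    ΣL elems (λ x → ΣL (monics F d) (λ cs → Σ< (suc n) (λ m → (κ s m * x ^ m) * sh (s ℕ.+ m) (recipPow F cs (s ℕ.+ m)) n)))
      ≈⟨ ΣL-cong elems (λ x → ΣL-Σ< (monics F d) (suc n) _) ⟩
    ΣL elems (λ x → Σ< (suc n) (λ m → ΣL (monics F d) (λ cs → (κ s m * x ^ m) * sh (s ℕ.+ m) (recipPow F cs (s ℕ.+ m)) n)))
      ≈⟨ ΣL-cong elems (λ x → Σ<-cong (suc n) (λ m _ → trans (ΣL-*ˡ (monics F d) (κ s m * x ^ m) _) (*-congˡ (ΣL-sh (monics F d) (s ℕ.+ m) (λ cs → recipPow F cs (s ℕ.+ m)) n)))) ⟩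
    ΣL elems (λ x → Σ< (suc n) (λ m → (κ s m * x ^ m) * sh (s ℕ.+ m) (powerSum F d (s ℕ.+ m)) n))
      ≈⟨ ΣL-Σ< elems (suc n) _ ⟩
    Σ< (suc n) (λ m → ΣL elems (λ x → (κ s m * x ^ m) * sh (s ℕ.+ m) (powerSum F d (s ℕ.+ m)) n))
      ≈⟨ Σ<-cong (suc n) (λ m _ → collect m) ⟩
    Σ< (suc n) (λ m → (κ s m * P m) * sh (s ℕ.+ m) (powerSum F d (s ℕ.+ m)) n) ∎
    where
    collect : ∀ m → ΣL elems (λ x → (κ s m * x ^ m) * sh (s ℕ.+ m) (powerSum F d (s ℕ.+ m)) n) ≈ (κ s m * P m) * sh (s ℕ.+ m) (powerSum F d (s ℕ.+ m)) n
    collect m = begin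
      ΣL elems (λ x → (κ s m * x ^ m) * w)        ≈⟨ ΣL-cong elems (λ x → solve 3 (λ a b c → (a :* b) :* c := (a :* c) :* b) refl (κ s m) (x ^ m) w) ⟩
      ΣL elems (λ x → (κ s m * w) * x ^ m)        ≈⟨ ΣL-*ˡ elems (κ s m * w) _ ⟩
      (κ s m * w) * ΣL elems (λ x → x ^ m)        ≡⟨ ≡.cong ((κ s m * w) *_) (ΣL-elems (λ x → x ^ m)) ⟩
      (κ s m * w) * P m                           ≈⟨ solve 3 (λ a b c → (a :* c) :* b := (a :* b) :* c) refl (κ s m) (P m) w ⟩
      (κ s m * P m) * w                           ∎
      where
      w = sh (s ℕ.+ m) (powerSum F d (s ℕ.+ m)) n

-- Leading coefficients of the power sums and of the multizeta value.

module Leading {c ℓ : Level} (F : FiniteField c ℓ) where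
  open FiniteField F hiding (zero)
  open Arithmetic F
  open Series F

  abstract
    e′ : ℕ
    e′ = proj₁ h-power

    h-e′ : suc h ≡ p ℕ.^ suc e′
    h-e′ = proj₂ h-power

  open Paths p 2≤p e′ using (IsPath; []; _∷_; _⇝_; step; pcost) renaming (h to h₀)
  open Digits p 2≤p using (m<p^L)

  h₀≡h : h₀ ≡ h
  h₀≡h = ≡.sym (≡.cong (_∸ 1) h-e′)

  module _ (K d : ℕ) where
    private
      abstract
        unique : Paths.From.Unique p 2≤p e′ K d
        unique = Paths.From.uniquePath p 2≤p e′ K d

    path : List ℕ
    path = proj₁ unique

    path-length : length path ≡ d
    path-length = proj₁ (proj₂ unique)

    path-ok : IsPath K path
    path-ok = proj₁ (proj₂ (proj₂ unique))

    path-least : ∀ ms → length ms ≡ d → IsPath K ms → pcost path ℕ.< pcost ms ⊎ path ≡ ms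
    path-least = proj₂ (proj₂ (proj₂ unique))

  V : ℕ → ℕ → ℕ
  V d K = pcost (path K d)

  V-≤ : ∀ K d {ms} → length ms ≡ d → IsPath K ms → V d K ℕ.≤ pcost ms
  V-≤ K d {ms} len ps with path-least K d ms len ps
  ... | inj₁ lt     = ℕₚ.<⇒≤ lt
  ... | inj₂ ≡.refl = ℕₚ.≤-refl

  -- Dropping the last node of a cheapest path leaves a shorter path that costs strictly less, since
  -- a node costs at least 1.
  V-step : ∀ K d → V d K ℕ.< V (suc d) K
  V-step K d =
    let (ms′ , len′ , ps′ , lt) = dropLast d (path K (suc d)) (path-length K (suc d)) (path-ok K (suc d))
    in ℕₚ.≤-<-trans (V-≤ K d len′ ps′) lt
    where
    dropLast : ∀ d {K} ms → length ms ≡ suc d → IsPath K ms → ∃ λ ms′ → length ms′ ≡ d × IsPath K ms′ × pcost ms′ ℕ.< pcost ms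
    dropLast zero    (m ∷ [])      _   (s ∷ []) = [] , ≡.refl , [] , s≤s z≤n
    dropLast (suc d) (m ∷ ms) len (s ∷ ps) =
      let (ms′ , len′ , ps′ , lt) = dropLast d ms (ℕₚ.suc-injective len) ps
      in m ∷ ms′ , ≡.cong suc len′ , s ∷ ps′ , ℕₚ.+-monoʳ-< (suc m) lt

  V-mono : ∀ K {d d′} → d ℕ.< d′ → V d K ℕ.< V d′ K
  V-mono K {d} d<d′ with ℕₚ.m≤n⇒∃[o]m+o≡n d<d′
  ... | o , ≡.refl = go o
    where
    go : ∀ o → V d K ℕ.< V (suc d ℕ.+ o) K
    go zero    rewrite ℕₚ.+-identityʳ d = V-step K d
    go (suc o) rewrite ℕₚ.+-suc d o = ℕₚ.<-trans (go o) (V-step K (suc (d ℕ.+ o)))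

  d≤V : ∀ K d → d ℕ.≤ V d K
  d≤V K zero    = z≤n
  d≤V K (suc d) = ℕₚ.≤-<-trans (d≤V K d) (V-step K d)

  Lead : ℕ → S → Set ℓ
  Lead k f = Low k f × ¬ (f k ≈ 0#)

  lead-resp : ∀ {k f g} → f ≐ g → Lead k f → Lead k g
  lead-resp q (low , nz) = (λ n n<k → trans (sym (q n)) (low n n<k)) , (λ r → nz (trans (q _) r))

  low-sh : ∀ k {j f} → Low j f → Low (k ℕ.+ j) (sh k f)
  low-sh k {j} {f} low n n<k+j with n ℕ.<? k
  ... | yes q = sh-< k f q
  ... | no  q with ℕₚ.m≤n⇒∃[o]m+o≡n (ℕₚ.≮⇒≥ q)
  ...   | o , ≡.refl = trans (sh-+ k f o) (low o (ℕₚ.+-cancelˡ-< k _ _ n<k+j))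

  *-zero : ∀ x {y} → (¬ (x ≈ 0#) → y ≈ 0#) → x * y ≈ 0#
  *-zero x q with x ≈? 0#
  ... | yes r = trans (*-congʳ r) (zeroˡ _)
  ... | no  r = trans (*-congˡ (q r)) (zeroʳ _)

  powerSum-0 : ∀ s → powerSum F 0 s ≐ one F
  powerSum-0 s n = trans (+-identityʳ _) (trans (^^-cong s inv≐one n) (one^^ s n))
    where
    u≐one : uCoeff F [] ≐ one F
    u≐one zero    = refl
    u≐one (suc i) = reflexive (uCoeff-suc [] i)
    inv≐one : inv F (uCoeff F []) ≐ one F
    inv≐one n = trans (sym (one-⊗ (inv F (uCoeff F [])) n)) (trans (sym (⊗-congʳ (inv F (uCoeff F [])) u≐one n)) (inv-inverseʳ (uCoeff F []) refl n))
    one^^ : ∀ s → one F ^^ s ≐ one F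
    one^^ zero    n = refl
    one^^ (suc s) n = trans (one-⊗ (one F ^^ s) n) (one^^ s n)

  sign-nonzero : ∀ m → ¬ ((_^ᶠ_ F (- 1#) m) ≈ 0#)
  sign-nonzero m = ^-nonzero m -1≉0

  κ-β : ∀ K m → κ (suc K) m ≈ (_^ᶠ_ F (- 1#) m) * β (K ℕ.+ m) K
  κ-β K m = *-congˡ (ι-≡ (multichoose-binomial K m))

  step-nonzero : ∀ K m → K ⇝ K ℕ.+ m → ¬ (κ (suc K) m * P m ≈ 0#)
  step-nonzero K m (step lt h∣ ds) = *-nonzero
    -- `K + m` digits suffice for the digit test, since every `N` is less than `p ^ N`.
    (λ q → *-nonzero (sign-nonzero m) (⊑⇒β-≉0 (K ℕ.+ m) (K ℕ.+ m) K (m<p^L ℕₚ.≤-refl) (m<p^L (ℕₚ.m≤m+n K m)) ds) (trans (sym (κ-β K m)) q))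
    (P-nonzero m (ℕₚ.+-cancelˡ-< K 0 m (≡.subst (ℕ._< K ℕ.+ m) (≡.sym (ℕₚ.+-identityʳ K)) lt))
      (≡.subst₂ _∣_ h₀≡h (ℕₚ.m+n∸m≡n K m) h∣))

  nonzero-step : ∀ K m → ¬ (κ (suc K) m * P m ≈ 0#) → K ⇝ K ℕ.+ m
  nonzero-step K m nz = step (ℕₚ.m<m+n K (positive m P≉0)) (≡.subst₂ _∣_ (≡.sym h₀≡h) (≡.sym (ℕₚ.m+n∸m≡n K m)) (P-≉0⇒h∣ m P≉0))
      (β-≉0⇒⊑ (K ℕ.+ m) K (λ q → nz (trans (*-congʳ (trans (κ-β K m) (trans (*-congˡ q) (zeroʳ _)))) (zeroˡ _))))
    where
    P≉0 : ¬ (P m ≈ 0#)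
    P≉0 q = nz (trans (*-congˡ q) (zeroʳ _))
    positive : ∀ m → ¬ (P m ≈ 0#) → 0 ℕ.< m
    positive zero    q = contradiction P-0 q
    positive (suc m) q = s≤s z≤n

  -- Induction on `d` for all `K` at once, since the expansion changes the exponent. In the degree
  -- of the minimal cost the only contribution comes from the first node of the unique cheapest
  -- path; every other first node leads to a larger valuation.
  powerSum-lead : ∀ d K → Lead (V d K) (powerSum F d (suc K))
  powerSum-lead zero K = ≡.subst (λ k → Lead k (powerSum F 0 (suc K))) (≡.sym (free (path K 0) (path-length K 0)))
      (lead-resp (λ n → sym (powerSum-0 (suc K) n)) ((λ n ()) , 1≉0))
    where
    free : ∀ ms → length ms ≡ 0 → pcost ms ≡ 0
    free [] _ = ≡.refl
  powerSum-lead (suc d) K = low , nonzero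
    where
    coeff : ℕ → ℕ → Carrier
    coeff n m = (κ (suc K) m * P m) * sh (suc K ℕ.+ m) (powerSum F d (suc K ℕ.+ m)) n

    extended : ∀ m → K ⇝ K ℕ.+ m → length (K ℕ.+ m ∷ path (K ℕ.+ m) d) ≡ suc d × IsPath K (K ℕ.+ m ∷ path (K ℕ.+ m) d)
    extended m s = ≡.cong suc (path-length (K ℕ.+ m) d) , s ∷ path-ok (K ℕ.+ m) d

    sh-low : ∀ N n → n ℕ.< suc N ℕ.+ V d N → sh (suc N) (powerSum F d (suc N)) n ≈ 0#
    sh-low N n n< = low-sh (suc N) (proj₁ (powerSum-lead d N)) n n<

    vanishing : ∀ n m → (K ⇝ K ℕ.+ m → n ℕ.< suc (K ℕ.+ m) ℕ.+ V d (K ℕ.+ m)) → coeff n m ≈ 0#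
    vanishing n m q = *-zero (κ (suc K) m * P m) (λ r → sh-low (K ℕ.+ m) n (q (nonzero-step K m r)))

    low : Low (V (suc d) K) (powerSum F (suc d) (suc K))
    low n n<V = trans (powerSum-suc d (suc K) n) (Σ<-zero (suc n) (λ m _ → vanishing n m
      (λ s → ℕₚ.<-≤-trans n<V (V-≤ K (suc d) (proj₁ (extended m s)) (proj₂ (extended m s))))))

    nonzero : ¬ (powerSum F (suc d) (suc K) (V (suc d) K) ≈ 0#)
    nonzero = at-least (path K (suc d)) (path-length K (suc d)) (path-ok K (suc d)) (path-least K (suc d))
      where
      first : ∀ N ms → length (N ∷ ms) ≡ suc d → K ⇝ N → IsPath N ms →
              (∀ ms′ → length ms′ ≡ suc d → IsPath K ms′ → pcost (N ∷ ms) ℕ.< pcost ms′ ⊎ N ∷ ms ≡ ms′) →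
              (∃ λ m → K ℕ.+ m ≡ N) → ¬ (powerSum F (suc d) (suc K) (pcost (N ∷ ms)) ≈ 0#)
      first .(K ℕ.+ m₁) ms len s ps least-path (m₁ , ≡.refl) eq₀ =
        *-nonzero (step-nonzero K m₁ s) at-m₁ (trans (sym (trans (powerSum-suc d (suc K) n) (Σ<-single (suc n) (coeff n) m₁ m₁<n others))) eq₀)
        where
        N₁ = K ℕ.+ m₁
        n = pcost (N₁ ∷ ms)
        m₁<n : m₁ ℕ.< suc n
        m₁<n = s≤s (ℕₚ.≤-trans (ℕₚ.m≤n+m m₁ K) (ℕₚ.≤-trans (ℕₚ.n≤1+n N₁) (ℕₚ.m≤m+n (suc N₁) (pcost ms))))
        -- The rest of a cheapest path is cheapest from its own start, so its cost is the valuation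
        -- given by the induction hypothesis.
        tail-cost : pcost ms ≡ V d N₁
        tail-cost = ℕₚ.≤-antisym (ℕₚ.+-cancelˡ-≤ (suc N₁) _ _ cheaper) (V-≤ N₁ d (ℕₚ.suc-injective len) ps)
          where
          cheaper : n ℕ.≤ suc N₁ ℕ.+ V d N₁
          cheaper with least-path _ (proj₁ (extended m₁ s)) (proj₂ (extended m₁ s))
          ... | inj₁ lt = ℕₚ.<⇒≤ lt
          ... | inj₂ q  = ℕₚ.≤-reflexive (≡.cong pcost q)
        at-m₁ : ¬ (sh (suc K ℕ.+ m₁) (powerSum F d (suc K ℕ.+ m₁)) n ≈ 0#)
        at-m₁ q = proj₂ (powerSum-lead d N₁) (trans (reflexive (≡.cong (powerSum F d (suc N₁)) (≡.sym tail-cost)))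
                    (trans (sym (sh-+ (suc N₁) (powerSum F d (suc N₁)) (pcost ms))) q))
        others : ∀ m → m ℕ.< suc n → m ≢ m₁ → coeff n m ≈ 0#
        others m _ m≢m₁ = vanishing n m bigger
          where
          bigger : K ⇝ K ℕ.+ m → n ℕ.< suc (K ℕ.+ m) ℕ.+ V d (K ℕ.+ m)
          bigger t with least-path _ (proj₁ (extended m t)) (proj₂ (extended m t))
          ... | inj₁ lt = lt
          ... | inj₂ q  = contradiction (≡.sym (ℕₚ.+-cancelˡ-≡ K _ _ (≡.cong head₀ q))) m≢m₁
            where
            head₀ : List ℕ → ℕ
            head₀ []      = 0
            head₀ (x ∷ _) = x
      at-least : ∀ ms → length ms ≡ suc d → IsPath K ms →
                 (∀ ms′ → length ms′ ≡ suc d → IsPath K ms′ → pcost ms ℕ.< pcost ms′ ⊎ ms ≡ ms′) →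
                 ¬ (powerSum F (suc d) (suc K) (pcost ms) ≈ 0#)
      at-least (N ∷ ms) len (s ∷ ps) least-path = first N ms len s ps least-path (ℕₚ.m≤n⇒∃[o]m+o≡n (ℕₚ.<⇒≤ (_⇝_.less s)))

  -- The leading term comes from the degrees r - 1 > … > 0; as s is positive, s ∸ 1 is K with s = K + 1.
  ν : ∀ {r} → Vec ℕ r → ℕ
  ν []                = 0
  ν {suc r} (s ∷ ss)  = V r (s ∸ 1) ℕ.+ ν ss

  -- There are no `r` strictly decreasing degrees below `b < r`.
  Z-zero : ∀ {r} (ss : Vec ℕ r) (es : Vec Carrier r) b → b ℕ.< r → ∀ n → Z F ss es b n ≈ 0#
  Z-zero {suc r} (s ∷ ss) (e ∷ es) b (s≤s b≤r) n = Σ<-zero b λ d d<b →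
    trans (*-congˡ (Σ<-zero (suc n) (λ i _ → trans (*-congˡ (Z-zero ss es d (ℕₚ.<-≤-trans d<b b≤r) (n ∸ i))) (zeroʳ _)))) (zeroʳ _)

  -- An outer degree `d` below the number of remaining entries gives 0 by `Z-zero`, and a greater
  -- one gives a larger valuation by `V-mono`. The valuation of the inner sum is the same for all
  -- admissible `d`, so only the outer factor decides.
  Z-lead : ∀ {r} (ss : Vec ℕ r) → All (1 ℕ.≤_) ss → (es : Vec Carrier r) → All (λ e → ¬ (e ≈ 0#)) es →
           ∀ b → r ℕ.≤ b → Lead (ν ss) (Z F ss es b)
  Z-lead [] [] [] [] b _ = (λ n ()) , 1≉0
  Z-lead {suc r} (suc K ∷ ss) (_ ∷ ps) (e ∷ es) (e≉0 ∷ nz) b r<b = low , nonzero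
    where
    term : ℕ → ℕ → Carrier
    term n d = _^ᶠ_ F e d * (powerSum F d (suc K) ⊗ Z F ss es d) n
    term-low : ∀ d n → n ℕ.< V d K ℕ.+ ν ss → term n d ≈ 0#
    term-low d n n< with d ℕ.<? r
    ... | yes d<r = trans (*-congˡ (Σ<-zero (suc n) (λ i _ → trans (*-congˡ (Z-zero ss es d d<r (n ∸ i))) (zeroʳ _)))) (zeroʳ _)
    ... | no  d≮r = trans (*-congˡ (low-⊗ (proj₁ (powerSum-lead d K)) (proj₁ (Z-lead ss ps es nz d (ℕₚ.≮⇒≥ d≮r))) n n<)) (zeroʳ _)
    term-high : ∀ d n → n ℕ.≤ V r K ℕ.+ ν ss → d ≢ r → term n d ≈ 0#
    term-high d n n≤ d≢r with d ℕ.<? r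
    ... | yes d<r = trans (*-congˡ (Σ<-zero (suc n) (λ i _ → trans (*-congˡ (Z-zero ss es d d<r (n ∸ i))) (zeroʳ _)))) (zeroʳ _)
    ... | no  d≮r = term-low d n (ℕₚ.≤-<-trans n≤ (ℕₚ.+-monoˡ-< (ν ss) (V-mono K (ℕₚ.≤∧≢⇒< (ℕₚ.≮⇒≥ d≮r) (d≢r ∘ ≡.sym)))))
    low : Low (V r K ℕ.+ ν ss) (Z F (suc K ∷ ss) (e ∷ es) b)
    low n n< = Σ<-zero b each
      where
      each : ∀ d → d ℕ.< b → term n d ≈ 0#
      each d _ with d ℕ.≟ r
      ... | yes ≡.refl = term-low d n n<
      ... | no  d≢r    = term-high d n (ℕₚ.<⇒≤ n<) d≢r
    nonzero : ¬ (Z F (suc K ∷ ss) (e ∷ es) b (V r K ℕ.+ ν ss) ≈ 0#)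
    nonzero q = *-nonzero (^-nonzero r e≉0) (*-nonzero (proj₂ (powerSum-lead r K)) (proj₂ rest))
      (trans (*-congˡ (sym (lead-⊗ (proj₁ (powerSum-lead r K)) (proj₁ rest))))
        (trans (sym (Σ<-single b (term (V r K ℕ.+ ν ss)) r r<b (λ d _ d≢r → term-high d _ ℕₚ.≤-refl d≢r))) q))
      where
      rest : Lead (ν ss) (Z F ss es r)
      rest = Z-lead ss ps es nz r ℕₚ.≤-refl

  zeta-nonzero : ∀ {r} → 1 ℕ.≤ r → (ss : Vec ℕ r) → All (1 ℕ.≤_) ss → (es : Vec Carrier r) → All (λ e → ¬ (e ≈ 0#)) es → ZetaNonzero F ss es
  -- The coefficient of index `n` only sums outer degrees up to `n`. By `d≤V` the leading outer
  -- degree `r` is at most `n = ν ss`, so the leading tuple is included.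
  zeta-nonzero {suc r} _ ss@(s ∷ ss′) ps es nz = ν ss , proj₂ (Z-lead ss ps es nz (suc (ν ss))
    (s≤s (ℕₚ.≤-trans (d≤V (s ∸ 1) r) (ℕₚ.m≤m+n _ (ν ss′)))))

theorem2p1 : {c ℓ : Level} (F : FiniteField c ℓ) (r : ℕ) → 1 ≤ r →
    (s : Vec ℕ r) → All (1 ≤_) s →
    (ε : Vec (FiniteField.Carrier F) r) →
    All (λ e → ¬ (FiniteField._≈_ F e (FiniteField.0# F))) ε →
    ZetaNonzero F s ε
theorem2p1 F r 1≤r s 1≤s ε ε≉0 = Leading.zeta-nonzero F 1≤r s 1≤s ε ε≉0
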